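{- Let $\Delta$ be the (finite) limiting density of a minor-closed family $\mathcal{F}$ of simple graphs. Then $1+\Delta$ is a cluster point of the set of limiting densities of minor-closed families of simple graphs, i.e. every neighbourhood of $1+\Delta$ contains a limiting density of some minor-closed family different from $1+\Delta$.
   Context: All graphs are finite simple graphs. A minor of a graph $G$ is a simple graph obtained from $G$ by a sequence of edge contractions (merging resulting parallel edges and deleting resulting loops), edge deletions and vertex deletions. A family $\mathcal{F}$ of graphs is minor-closed if every minor of a graph in $\mathcal{F}$ belongs to $\mathcal{F}$. For a minor-closed family $\mathcal{F}$, let $\mathrm{ex}_{\mathcal{F}}(n)$ be the maximum number of edges of an $n$-vertex graph in $\mathcal{F}$ ($0$ if there is none); the limiting density of $\mathcal{F}$ is $\limsup_{n\to\infty}\mathrm{ex}_{\mathcal{F}}(n)/n$, i.e. the smallest $k$ such that every $n$-vertex graph in $\mathcal{F}$ has at most $kn(1+o(1))$ edges. -}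

module Defs where

open import Data.Nat using (ℕ; zero; suc; _<ᵇ_) renaming (_≤_ to _≤ℕ_)
open import Data.Fin using (Fin; toℕ; punchIn) renaming (_≟_ to _≟F_)
open import Data.Bool using (Bool; true; false; _∧_; _∨_; not; if_then_else_)
open import Data.List using (List; map; allFin)
open import Data.Nat.ListAction using (sum)
open import Data.Product using (Σ; ∃; _×_; _,_)
open import Data.Sum using (_⊎_)
open import Data.Integer using (+_)
open import Data.Rational using (ℚ; _<_; _≤_; _*_; _/_)
open import Relation.Nullary.Decidable using (⌊_⌋)
open import Relation.Binary.PropositionalEquality using (_≡_)
open import Function.Bundles using (_↔_; Inverse)

-- A graph on vertex set Fin n is represented by a Bool-valued relation.
-- Only its symmetrised, loop-free part matters: {i,j} is an edge iff i ≠ j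
-- and (A i j or A j i).  So every such relation represents a finite simple graph.
Adj : ℕ → Set
Adj n = Fin n → Fin n → Bool

Graph : Set
Graph = Σ ℕ Adj

_==_ : ∀ {n} → Fin n → Fin n → Bool
i == j = ⌊ i ≟F j ⌋

E : ∀ {n} → Adj n → Fin n → Fin n → Bool
E A i j = not (i == j) ∧ (A i j ∨ A j i)

edges : ∀ {n} → Adj n → ℕ
edges {n} A = sum (map (λ i → sum (map (λ j → if (toℕ i <ᵇ toℕ j) ∧ E A i j then 1 else 0) (allFin n))) (allFin n))

Iso : ∀ {n} → Adj n → Adj n → Set
Iso {n} A B = Σ (Fin n ↔ Fin n) λ σ → ∀ i j → E A i j ≡ E B (Inverse.to σ i) (Inverse.to σ j)

deleteVertex : ∀ {n} → Fin (suc n) → Adj (suc n) → Adj n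
deleteVertex v A i j = E A (punchIn v i) (punchIn v j)

deleteEdge : ∀ {n} → Fin n → Fin n → Adj n → Adj n
deleteEdge u v A i j = E A i j ∧ not ((i == u ∧ j == v) ∨ (i == v ∧ j == u))

-- contract edge uv: v is merged into u (then v is removed);
-- loops are removed and parallel edges merged automatically by E.
contract : ∀ {n} → Fin (suc n) → Fin (suc n) → Adj (suc n) → Adj n
contract u v A i j =
  let x = punchIn v i ; y = punchIn v j
  in E A x y ∨ ((x == u) ∧ E A v y) ∨ ((y == u) ∧ E A x v)

data _≼_ : Graph → Graph → Set where
  iso   : ∀ {n} {A B : Adj n} → Iso A B → (n , A) ≼ (n , B)
  delV  : ∀ {H n} {A : Adj (suc n)} (v : Fin (suc n)) →
          H ≼ (n , deleteVertex v A) → H ≼ (suc n , A)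
  delE  : ∀ {H n} {A : Adj n} (u v : Fin n) →
          H ≼ (n , deleteEdge u v A) → H ≼ (n , A)
  contr : ∀ {H n} {A : Adj (suc n)} (u v : Fin (suc n)) → E A u v ≡ true →
          H ≼ (n , contract u v A) → H ≼ (suc n , A)

Family : Set₁
Family = Graph → Set

MinorClosed : Family → Set
MinorClosed F = ∀ G H → F G → H ≼ G → F H

ℕ→ℚ : ℕ → ℚ
ℕ→ℚ n = + n / 1

-- ex_F(n) ≤ x   (ex_F(n) = max edges of an n-vertex graph in F, 0 if none)
ExLe : Family → ℕ → ℚ → Set
ExLe F n x = (ℕ→ℚ 0 ≤ x) × (∀ (A : Adj n) → F (n , A) → ℕ→ℚ (edges A) ≤ x)

ExGt : Family → ℕ → ℚ → Set
ExGt F n x = (x < ℕ→ℚ 0) ⊎ (Σ (Adj n) λ A → F (n , A) × x < ℕ→ℚ (edges A))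

-- limiting density d(F) = limsup ex_F(n)/n, compared with rationals (Dedekind-style)
-- d(F) ≤ q
DensLe : Family → ℚ → Set
DensLe F q = ∀ q' → q < q' → ∃ λ N → ∀ n → N ≤ℕ n → ExLe F n (q' * ℕ→ℚ n)

-- d(F) ≥ q   (d(F) = +∞ allowed)
DensGe : Family → ℚ → Set
DensGe F q = ∀ q' → q' < q → ∀ N → ∃ λ n → N ≤ℕ n × ExGt F n (q' * ℕ→ℚ n)

DensLt : Family → ℚ → Set
DensLt F q = ∃ λ q' → q' < q × DensLe F q'

DensGt : Family → ℚ → Set
DensGt F q = ∃ λ q' → q < q' × DensGe F q'

FiniteDens : Family → Set
FiniteDens F = ∃ λ q → DensLe F q

{-# OPTIONS --safe #-}
module Submission where

-- Call a graph with h vertices and e edges overfull, for the slope c = p / W, if e ≥ c (h + 1) + 1.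
-- Delete an edge from a minor-minimal overfull graph with h vertices.  No minor of the result is
-- overfull, so the minors of disjoint unions of copies of its cone have at most (1 + c) n edges, while
-- these unions have density at least 1 + c - 1 / (h + 1).  If c is slightly smaller than a lower bound s
-- of the density of F, a minimal overfull graph with more than K vertices therefore yields a family whose
-- density is a little smaller than 1 + s.
--
-- If no such graph is found up to a computable size, every overfull graph up to that size has an overfull
-- minor with at most K vertices, and then the density of F is at least c + 2 / W.  Indeed the
-- graphs of F have no large clique minors, hence small separators, and a large graph in F with more than
-- c n edges contains many pieces of bounded size that are denser than c.  By the sunflower lemma there are
-- many disjoint connected petals with the same neighbourhood N′ in a common kernel.  If N′ is large, the
-- petals contract to a complete bipartite graph.  Otherwise bounded unions of petals together with N′ are
-- overfull, and the small overfull minors they contain can be glued along N′.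
-- As F has finite density, the lower bound s can be raised only finitely often.

-- Densities are known only through rational comparisons and the argument is constructive, so the
-- alternative between a large minimal overfull graph and a better lower bound has to come out of a
-- finite search. This is why the size limit is computable and every estimate is explicit. Overfull
-- is calibrated to the cone: h + 1 is its number of vertices, and a graph is not overfull exactly
-- if its cone has fewer than 1 + c edges per vertex. The additive 1 is used twice. It pays for the
-- deleted edge, and with W = 2 K it yields the gain 2 / W: one edge spread over at most K vertices
-- is worth 1 / K = 2 / W per vertex. The obstacle in the sunflower step is the kernel. Edges inside
-- it could account for the density of every piece and would be lost when the kernel is removed.
-- Hence the pieces are chosen one after another, each dense in the edges that lie inside no earlier
-- piece. Gluing meets the same obstacle: edges inside N′ are shared, so only vertices and edges
-- outside N′ may be counted.

open import Defs
open import Algebra.Properties.CommutativeMonoid.Sum as Sum using ()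
open import Data.Bool using (Bool; true; false; _∧_; _∨_; not; if_then_else_)
open import Data.Bool.Properties using () renaming (_≟_ to _≟B_)
open import Data.Empty using (⊥; ⊥-elim)
open import Data.Fin using (Fin; zero; suc; toℕ; punchIn; punchOut; combine; quotient; remainder; _↑ˡ_; _↑ʳ_) renaming (_≟_ to _≟F_)
open import Data.Fin.Properties using (punchIn-punchOut; punchInᵢ≢i; punchIn-injective; punchOut-injective; any?; toℕ-injective; injective⇒≤; remQuot-combine; combine-remQuot; combine-injectiveʳ) renaming (suc-injective to sucF-injective)
open import Data.Integer as ℤ using (-[1+_]; +<+)
import Data.Integer.Properties as ℤ
open import Data.List using (List; []; _∷_; length; filter; map; allFin; tabulate)
open import Data.List.Properties using (map-tabulate; length-map; length-tabulate)
open import Data.Maybe using (Maybe; just; nothing; is-just; _>>=_) renaming (map to mapM)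
open import Data.Maybe.Properties using (just-injective)
open import Data.Nat using (ℕ; zero; suc; _+_; _*_; _∸_; _^_; _/_; _%_; _≤_; _<_; _<ᵇ_; z≤n; s≤s; s≤s⁻¹; _≟_; _≤?_; _<?_; NonZero; >-nonZero)
open import Data.Nat.DivMod using (m≡m%n+[m/n]*n; m%n<n)
open import Data.Nat.ListAction using () renaming (sum to sumL)
open import Data.Nat.Properties hiding (_≟_; _≤?_; _<?_)
open import Data.Nat.Tactic.RingSolver using (solve; solve-∀)
open import Data.Product using (Σ; ∃; ∃₂; _×_; _,_; proj₁; proj₂)
open import Data.Rational as ℚ using (ℚ; _-_; 1ℚ; 0ℚ)
import Data.Rational.Properties as ℚ
import Data.Rational.Solver as ℚ
open import Data.Rational.Unnormalised as ℚᵘ using (mkℚᵘ; *≡*; *<*)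
import Data.Rational.Unnormalised.Properties as ℚᵘ
open import Data.Sum using (_⊎_; inj₁; inj₂; map₁; map₂; [_,_]′)
open import Function using (_∘_; id; case_of_)
open import Function.Bundles using (Inverse; mk↔ₛ′)
open import Function.Construct.Identity using (↔-id)
open import Relation.Binary.PropositionalEquality using (_≡_; _≢_; refl; sym; trans; cong; cong₂; subst; subst₂; module ≡-Reasoning)
open import Relation.Nullary using (¬_; Dec; yes; no)
open import Relation.Nullary.Decidable using (⌊_⌋; ¬?; _×-dec_; _⊎-dec_)

open Sum +-0-commutativeMonoid using (sum-cong-≗; ∑-distrib-+; ∑-comm; sum-remove; sum-permute) renaming (sum to ∑)

-- S ≤ T is a combination of the hypotheses and R - L = (T - S) + z, with the terms moved so that no
-- subtraction occurs.
lin : ∀ {S T L R} → S ≤ T → ∀ z → L + T + z ≡ R + S → L ≤ R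
lin {S} {T} {L} {R} h z eq =
  +-cancelʳ-≤ S L R (≤-trans (+-monoʳ-≤ L h) (≤-trans (m≤m+n (L + T) z) (≤-reflexive eq)))

infixr 7 _⊙_
_⊙_ : ∀ k {a b} → a ≤ b → k * a ≤ k * b
k ⊙ h = *-monoʳ-≤ k h

infixr 6 _⊕_
_⊕_ : ∀ {a b c d} → a ≤ b → c ≤ d → a + c ≤ b + d
_⊕_ = +-mono-≤

-- Truth values and decidable predicates

true≢false : ∀ {b} → b ≡ true → b ≡ false → ⊥
true≢false refl ()

≢true⇒false : ∀ {b} → ¬ (b ≡ true) → b ≡ false
≢true⇒false {true} h = ⊥-elim (h refl)
≢true⇒false {false} h = refl

∧-true⁺ : ∀ {a b} → a ≡ true → b ≡ true → a ∧ b ≡ true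
∧-true⁺ refl refl = refl

∧-true⁻ : ∀ {a b} → a ∧ b ≡ true → a ≡ true × b ≡ true
∧-true⁻ {true} {true} refl = refl , refl

∨-true⁺ˡ : ∀ {a b} → a ≡ true → a ∨ b ≡ true
∨-true⁺ˡ refl = refl

∨-true⁺ʳ : ∀ {a b} → b ≡ true → a ∨ b ≡ true
∨-true⁺ʳ {true} refl = refl
∨-true⁺ʳ {false} refl = refl

∨-true⁻ : ∀ {a b} → a ∨ b ≡ true → a ≡ true ⊎ b ≡ true
∨-true⁻ {true} h = inj₁ refl
∨-true⁻ {false} h = inj₂ h

not-true⁺ : ∀ {a} → a ≡ false → not a ≡ true
not-true⁺ refl = refl

not-true⁻ : ∀ {a} → not a ≡ true → a ≡ false
not-true⁻ {false} h = refl

⇔⇒≡ : ∀ {a b} → (a ≡ true → b ≡ true) → (b ≡ true → a ≡ true) → a ≡ b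
⇔⇒≡ {true} f g = sym (f refl)
⇔⇒≡ {false} {true} f g = g refl
⇔⇒≡ {false} {false} f g = refl

⌊⌋-true⁺ : ∀ {p} {P : Set p} (d : Dec P) → P → ⌊ d ⌋ ≡ true
⌊⌋-true⁺ (yes _) p = refl
⌊⌋-true⁺ (no ¬p) p = ⊥-elim (¬p p)

⌊⌋-true⁻ : ∀ {p} {P : Set p} (d : Dec P) → ⌊ d ⌋ ≡ true → P
⌊⌋-true⁻ (yes p) h = p

==-true⁺ : ∀ {n} {i j : Fin n} → i ≡ j → (i == j) ≡ true
==-true⁺ {i = i} {j} = ⌊⌋-true⁺ (i ≟F j)

==-true⁻ : ∀ {n} {i j : Fin n} → (i == j) ≡ true → i ≡ j
==-true⁻ {i = i} {j} = ⌊⌋-true⁻ (i ≟F j)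

==-false⁺ : ∀ {n} {i j : Fin n} → i ≢ j → (i == j) ≡ false
==-false⁺ i≢j = ≢true⇒false (i≢j ∘ ==-true⁻)

true? : (b : Bool) → Dec (b ≡ true)
true? b = b ≟B true

anyF : ∀ {n} → (Fin n → Bool) → Bool
anyF P = ⌊ any? (true? ∘ P) ⌋

anyF⁺ : ∀ {n} (P : Fin n → Bool) i → P i ≡ true → anyF P ≡ true
anyF⁺ P i h = ⌊⌋-true⁺ (any? (true? ∘ P)) (i , h)

anyF⁻ : ∀ {n} (P : Fin n → Bool) → anyF P ≡ true → ∃ λ i → P i ≡ true
anyF⁻ P = ⌊⌋-true⁻ (any? (true? ∘ P))

-- Finite sums

𝟙 : Bool → ℕ
𝟙 b = if b then 1 else 0

𝟙≤1 : ∀ b → 𝟙 b ≤ 1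
𝟙≤1 true = ≤-refl
𝟙≤1 false = z≤n

𝟙-true : ∀ {b} → b ≡ true → 𝟙 b ≡ 1
𝟙-true refl = refl

𝟙-mono : ∀ {a b} → (a ≡ true → b ≡ true) → 𝟙 a ≤ 𝟙 b
𝟙-mono {true} h = ≤-reflexive (sym (𝟙-true (h refl)))
𝟙-mono {false} h = z≤n

𝟙-< : ∀ {a b} → a ≡ false → b ≡ true → 𝟙 a < 𝟙 b
𝟙-< refl refl = s≤s z≤n

𝟙-+ : ∀ {a b c} → (a ≡ true → c ≡ true) → (b ≡ true → c ≡ true) → (a ≡ true → b ≡ true → ⊥) →
      𝟙 a + 𝟙 b ≤ 𝟙 c
𝟙-+ {true} {true} f g h = ⊥-elim (h refl refl)
𝟙-+ {true} {false} f g h = ≤-reflexive (sym (𝟙-true (f refl)))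
𝟙-+ {false} f g h = 𝟙-mono g

𝟙-∪ : ∀ {a b c} → (c ≡ true → a ≡ true ⊎ b ≡ true) → 𝟙 c ≤ 𝟙 a + 𝟙 b
𝟙-∪ {a} {b} {true} f = case f refl of λ where
  (inj₁ refl) → m≤m+n 1 (𝟙 b)
  (inj₂ refl) → m≤n+m 1 (𝟙 a)
𝟙-∪ {c = false} f = z≤n

∑-cong : ∀ {n} {f g : Fin n → ℕ} → (∀ i → f i ≡ g i) → ∑ f ≡ ∑ g
∑-cong h = sum-cong-≗ h

∑-mono : ∀ {n} {f g : Fin n → ℕ} → (∀ i → f i ≤ g i) → ∑ f ≤ ∑ g
∑-mono {zero} h = z≤n
∑-mono {suc n} h = +-mono-≤ (h zero) (∑-mono (h ∘ suc))

∑∑-mono : ∀ {m n} {f g : Fin m → Fin n → ℕ} → (∀ i j → f i j ≤ g i j) →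
          ∑ (λ i → ∑ (f i)) ≤ ∑ (λ i → ∑ (g i))
∑∑-mono h = ∑-mono λ i → ∑-mono (h i)

∑∑-cong : ∀ {m n} {f g : Fin m → Fin n → ℕ} → (∀ i j → f i j ≡ g i j) →
          ∑ (λ i → ∑ (f i)) ≡ ∑ (λ i → ∑ (g i))
∑∑-cong h = ∑-cong λ i → ∑-cong (h i)

∑∑-+ : ∀ {m n} (f g : Fin m → Fin n → ℕ) →
       ∑ (λ i → ∑ (λ j → f i j + g i j)) ≡ ∑ (λ i → ∑ (f i)) + ∑ (λ i → ∑ (g i))
∑∑-+ f g = trans (∑-cong λ i → ∑-distrib-+ (f i) (g i)) (∑-distrib-+ (∑ ∘ f) (∑ ∘ g))

∑-*ˡ : ∀ {n} c (f : Fin n → ℕ) → ∑ (λ i → c * f i) ≡ c * ∑ f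
∑-*ˡ {zero} c f = sym (*-zeroʳ c)
∑-*ˡ {suc n} c f = trans (cong (c * f zero +_) (∑-*ˡ c (f ∘ suc))) (sym (*-distribˡ-+ c (f zero) _))

∑-const : ∀ n c → ∑ {n} (λ _ → c) ≡ n * c
∑-const zero c = refl
∑-const (suc n) c = cong (c +_) (∑-const n c)

∑∑-zero : ∀ {m n} {f : Fin m → Fin n → ℕ} → (∀ i j → f i j ≡ 0) → ∑ (λ i → ∑ (f i)) ≡ 0
∑∑-zero {m} {n} h = trans (∑-cong λ i → trans (∑-cong (h i)) (trans (∑-const n 0) (*-zeroʳ n)))
                          (trans (∑-const m 0) (*-zeroʳ m))

∑-≤const : ∀ {n c} {f : Fin n → ℕ} → (∀ i → f i ≤ c) → ∑ f ≤ n * c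
∑-≤const {n} {c} h = ≤-trans (∑-mono h) (≤-reflexive (∑-const n c))

∑-single : ∀ {n} (f : Fin n → ℕ) i → f i ≤ ∑ f
∑-single f zero = m≤m+n _ _
∑-single f (suc i) = ≤-trans (∑-single (f ∘ suc) i) (m≤n+m _ _)

-- The summand at the image of `zero` is split off the right side; the other images avoid that
-- index, so it can be punched out of the range.
∑-injective : ∀ {m n} (g : Fin m → Fin n) → (∀ {i j} → g i ≡ g j → i ≡ j) → (f : Fin n → ℕ) →
              ∑ (f ∘ g) ≤ ∑ f
∑-injective {zero} g inj f = z≤n
∑-injective {suc m} {zero} g inj f with g zero
... | ()
∑-injective {suc m} {suc n} g inj f = begin
  f a + ∑ (f ∘ g ∘ suc)                ≡⟨ cong (f a +_) (∑-cong λ i → cong f (punchIn-punchOut (avoid i))) ⟨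
  f a + ∑ (f ∘ punchIn a ∘ g′)         ≤⟨ +-monoʳ-≤ (f a) (∑-injective g′ inj′ (f ∘ punchIn a)) ⟩
  f a + ∑ (f ∘ punchIn a)              ≡⟨ sum-remove {i = a} f ⟨
  ∑ f                                  ∎
  where
  open ≤-Reasoning
  a = g zero
  avoid : ∀ i → a ≢ g (suc i)
  avoid i e = case inj e of λ ()
  g′ : Fin m → Fin n
  g′ i = punchOut (avoid i)
  inj′ : ∀ {i j} → g′ i ≡ g′ j → i ≡ j
  inj′ {i} {j} e = sucF-injective (inj (punchOut-injective (avoid i) (avoid j) e))

∑-+-split : ∀ m {n} (f : Fin (m + n) → ℕ) → ∑ f ≡ ∑ (λ i → f (i ↑ˡ n)) + ∑ (λ j → f (m ↑ʳ j))
∑-+-split zero f = refl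
∑-+-split (suc m) f = trans (cong (f zero +_) (∑-+-split m (f ∘ suc))) (sym (+-assoc (f zero) _ _))

∑-combine : ∀ m {n} (f : Fin (m * n) → ℕ) → ∑ f ≡ ∑ (λ i → ∑ (λ j → f (combine {m} {n} i j)))
∑-combine zero f = refl
∑-combine (suc m) {n} f = trans (∑-+-split n f) (cong (∑ (λ j → f (j ↑ˡ (m * n))) +_) (∑-combine m (λ k → f (n ↑ʳ k))))

count : ∀ {n} → (Fin n → Bool) → ℕ
count P = ∑ (𝟙 ∘ P)

count-mono : ∀ {n} {P Q : Fin n → Bool} → (∀ i → P i ≡ true → Q i ≡ true) → count P ≤ count Q
count-mono h = ∑-mono λ i → 𝟙-mono (h i)

count-∪ : ∀ {n} {P Q R : Fin n → Bool} → (∀ i → R i ≡ true → P i ≡ true ⊎ Q i ≡ true) →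
          count R ≤ count P + count Q
count-∪ {P = P} {Q} h = ≤-trans (∑-mono λ i → 𝟙-∪ (h i)) (≤-reflexive (∑-distrib-+ (𝟙 ∘ P) (𝟙 ∘ Q)))

count-⊎ : ∀ {n} {P Q R : Fin n → Bool} → (∀ i → P i ≡ true → R i ≡ true) → (∀ i → Q i ≡ true → R i ≡ true) →
          (∀ i → P i ≡ true → Q i ≡ true → ⊥) → count P + count Q ≤ count R
count-⊎ {P = P} {Q} f g h =
  ≤-trans (≤-reflexive (sym (∑-distrib-+ (𝟙 ∘ P) (𝟙 ∘ Q)))) (∑-mono λ i → 𝟙-+ (f i) (g i) (h i))

count≤n : ∀ {n} (P : Fin n → Bool) → count P ≤ n
count≤n {n} P = ≤-trans (∑-≤const (𝟙≤1 ∘ P)) (≤-reflexive (*-identityʳ n))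

count-pos : ∀ {n} {P : Fin n → Bool} i → P i ≡ true → 1 ≤ count P
count-pos {P = P} i h = ≤-trans (≤-reflexive (sym (𝟙-true h))) (∑-single (𝟙 ∘ P) i)

count-pos⁻ : ∀ {n} {P : Fin n → Bool} → 1 ≤ count P → ∃ λ i → P i ≡ true
count-pos⁻ {suc n} {P} h with P zero in e
... | true = zero , e
... | false = let (i , p) = count-pos⁻ {P = P ∘ suc} h in suc i , p

count-zero : ∀ {n} {P : Fin n → Bool} → (∀ i → ¬ (P i ≡ true)) → count P ≡ 0
count-zero {P = P} h with count P in e
... | zero = refl
... | suc k = let (i , p) = count-pos⁻ {P = P} (≤-trans (s≤s z≤n) (≤-reflexive (sym e))) in ⊥-elim (h i p)

count-false : ∀ n → count {n} (λ _ → false) ≡ 0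
count-false n = count-zero {n} λ _ ()

count-true : ∀ n → count {n} (λ _ → true) ≡ n
count-true n = trans (∑-const n 1) (*-identityʳ n)

count-== : ∀ {n} (x : Fin n) → count (_== x) ≤ 1
count-== {suc n} zero = ≤-reflexive (cong suc (count-false n))
count-== {suc n} (suc x) = ≤-trans (≤-reflexive (∑-cong {n} λ i → cong 𝟙 (⇔⇒≡ (λ h → ==-true⁺ (sucF-injective (==-true⁻ h))) (λ h → ==-true⁺ (cong suc (==-true⁻ h)))))) (count-== x)

enumAux : ∀ b {m n} → (Fin m → Fin n) → Fin (𝟙 b + m) → Fin (suc n)
enumAux true g zero = zero
enumAux true g (suc k) = suc (g k)
enumAux false g k = suc (g k)

enum : ∀ {n} (P : Fin n → Bool) → Fin (count P) → Fin n
enum {suc n} P = enumAux (P zero) (enum (P ∘ suc))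

enum-∈ : ∀ {n} (P : Fin n → Bool) k → P (enum P k) ≡ true
enum-∈ {suc n} P k with P zero in e
enum-∈ {suc n} P zero | true = e
enum-∈ {suc n} P (suc k) | true = enum-∈ (P ∘ suc) k
enum-∈ {suc n} P k | false = enum-∈ (P ∘ suc) k

enum-injective : ∀ {n} (P : Fin n → Bool) {k l} → enum P k ≡ enum P l → k ≡ l
enum-injective {suc n} P {k} {l} h with P zero
enum-injective {suc n} P {zero} {zero} h | true = refl
enum-injective {suc n} P {suc k} {suc l} h | true = cong suc (enum-injective (P ∘ suc) (sucF-injective h))
enum-injective {suc n} P {k} {l} h | false = enum-injective (P ∘ suc) (sucF-injective h)

enum-onto : ∀ {n} (P : Fin n → Bool) i → P i ≡ true → ∃ λ k → enum P k ≡ i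
enum-onto {suc n} P i h with P zero in e
enum-onto {suc n} P zero h | true = zero , refl
enum-onto {suc n} P (suc i) h | true = let (k , q) = enum-onto (P ∘ suc) i h in suc k , cong suc q
enum-onto {suc n} P zero h | false = ⊥-elim (true≢false h e)
enum-onto {suc n} P (suc i) h | false = let (k , q) = enum-onto (P ∘ suc) i h in k , cong suc q

∑-enum : ∀ {n} (P : Fin n → Bool) (f : Fin n → ℕ) → ∑ (f ∘ enum P) ≡ ∑ (λ i → 𝟙 (P i) * f i)
∑-enum {zero} P f = refl
∑-enum {suc n} P f with P zero
... | true = cong₂ _+_ (sym (+-identityʳ (f zero))) (∑-enum (P ∘ suc) (f ∘ suc))
... | false = ∑-enum (P ∘ suc) (f ∘ suc)

-- Adjacency, edge counts and the elementary minor operations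

E-true⁻ : ∀ {n} (A : Adj n) {i j} → E A i j ≡ true → i ≢ j × (A i j ≡ true ⊎ A j i ≡ true)
E-true⁻ A {i} {j} h = let (p , q) = ∧-true⁻ {not (i == j)} h in
  (λ e → true≢false (==-true⁺ e) (not-true⁻ p)) , ∨-true⁻ q

E-true⁺ : ∀ {n} (A : Adj n) {i j} → i ≢ j → A i j ≡ true ⊎ A j i ≡ true → E A i j ≡ true
E-true⁺ A {i} {j} i≢j h = ∧-true⁺ (not-true⁺ (==-false⁺ i≢j)) (case h of λ where
  (inj₁ p) → ∨-true⁺ˡ p
  (inj₂ p) → ∨-true⁺ʳ {A i j} p)

E⇒≢ : ∀ {n} (A : Adj n) {i j} → E A i j ≡ true → i ≢ j
E⇒≢ A h = proj₁ (E-true⁻ A h)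

E-sym : ∀ {n} (A : Adj n) {i j} → E A i j ≡ true → E A j i ≡ true
E-sym A h = let (p , q) = E-true⁻ A h in E-true⁺ A (p ∘ sym) (case q of λ where
  (inj₁ r) → inj₂ r
  (inj₂ r) → inj₁ r)

infix 4 _≈_
-- The relations represent the same simple graph. Equality of functions is too strong for this, so
-- this congruence takes its place.
record _≈_ {n} (A B : Adj n) : Set where
  constructor ≈[_]
  field ≈-at : ∀ i j → E A i j ≡ E B i j
open _≈_ public

-- Ordered pairs of adjacent vertices, that is, twice the number of edges.
edges₂ : ∀ {n} → Adj n → ℕ
edges₂ A = ∑ λ i → ∑ λ j → 𝟙 (E A i j)

sumL-tabulate : ∀ {n} (f : Fin n → ℕ) → sumL (tabulate f) ≡ ∑ f
sumL-tabulate {zero} f = refl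
sumL-tabulate {suc n} f = cong (f zero +_) (sumL-tabulate (f ∘ suc))

sumL-allFin : ∀ {n} (f : Fin n → ℕ) → sumL (map f (allFin n)) ≡ ∑ f
sumL-allFin {n} f = trans (cong sumL (map-tabulate {n = n} id f)) (sumL-tabulate f)

edges-∑ : ∀ {n} (A : Adj n) → edges A ≡ ∑ λ i → ∑ λ j → 𝟙 ((toℕ i <ᵇ toℕ j) ∧ E A i j)
edges-∑ {n} A = trans (sumL-allFin {n} _) (∑-cong {n} λ i → sumL-allFin {n} (λ j → 𝟙 ((toℕ i <ᵇ toℕ j) ∧ E A i j)))

<ᵇ-split : ∀ m n → m ≢ n → ∀ {b} → 𝟙 b ≡ 𝟙 ((m <ᵇ n) ∧ b) + 𝟙 ((n <ᵇ m) ∧ b)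
<ᵇ-split zero zero h = ⊥-elim (h refl)
<ᵇ-split zero (suc n) h {b} = sym (+-identityʳ (𝟙 b))
<ᵇ-split (suc m) zero h = refl
<ᵇ-split (suc m) (suc n) h = <ᵇ-split m n (h ∘ cong suc)

edges₂≡2*edges : ∀ {n} (A : Adj n) → edges₂ A ≡ 2 * edges A
edges₂≡2*edges {n} A = begin
  edges₂ A                                       ≡⟨ ∑∑-cong split ⟩
  ∑ (λ i → ∑ λ j → L i j + L j i)                ≡⟨ ∑∑-+ L (λ i j → L j i) ⟩
  ∑ (λ i → ∑ (L i)) + ∑ (λ i → ∑ λ j → L j i)    ≡⟨ cong (∑ (λ i → ∑ (L i)) +_) (∑-comm (λ i j → L j i)) ⟩
  ∑ (λ i → ∑ (L i)) + ∑ (λ i → ∑ (L i))          ≡⟨ cong₂ _+_ (edges-∑ A) (edges-∑ A) ⟨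
  edges A + edges A                              ≡⟨ cong (edges A +_) (+-identityʳ (edges A)) ⟨
  2 * edges A                                    ∎
  where
  open ≡-Reasoning
  L : Fin n → Fin n → ℕ
  L i j = 𝟙 ((toℕ i <ᵇ toℕ j) ∧ E A i j)
  E-comm : ∀ i j → E A i j ≡ E A j i
  E-comm i j = ⇔⇒≡ (E-sym A) (E-sym A)
  split : ∀ i j → 𝟙 (E A i j) ≡ L i j + L j i
  split i j with E A i j in e
  ... | true = trans (<ᵇ-split (toℕ i) (toℕ j) (E⇒≢ A e ∘ toℕ-injective) {true})
                     (cong (λ b → 𝟙 ((toℕ i <ᵇ toℕ j) ∧ true) + 𝟙 ((toℕ j <ᵇ toℕ i) ∧ b)) (trans (sym e) (E-comm i j)))
  ... | false with toℕ i <ᵇ toℕ j | toℕ j <ᵇ toℕ i | trans (sym (E-comm i j)) e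
  ...   | true | true | e′ rewrite e′ = refl
  ...   | true | false | e′ = refl
  ...   | false | true | e′ rewrite e′ = refl
  ...   | false | false | e′ = refl

edges₂-≤ : ∀ {n} (A : Adj n) → edges₂ A ≤ n * n
edges₂-≤ {n} A = ∑-≤const λ i → ≤-trans (∑-≤const (λ j → 𝟙≤1 (E A i j))) (≤-reflexive (*-identityʳ n))

∑-strict : ∀ {n} {f g : Fin n → ℕ} → (∀ i → f i ≤ g i) → ∀ i → f i < g i → ∑ f < ∑ g
∑-strict h zero s = +-mono-<-≤ s (∑-mono (h ∘ suc))
∑-strict h (suc i) s = +-mono-≤-< (h zero) (∑-strict (h ∘ suc) i s)

E-deleteVertex : ∀ {n} v (A : Adj (suc n)) i j → E (deleteVertex v A) i j ≡ E A (punchIn v i) (punchIn v j)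
E-deleteVertex v A i j = ⇔⇒≡
  (λ h → case proj₂ (E-true⁻ (deleteVertex v A) {i} {j} h) of λ where
    (inj₁ p) → p
    (inj₂ p) → E-sym A p)
  (λ h → E-true⁺ (deleteVertex v A) (E⇒≢ A h ∘ cong (punchIn v)) (inj₁ h))

E-deleteEdge⁻ : ∀ {n} u v (A : Adj n) {i j} → E (deleteEdge u v A) i j ≡ true →
                E A i j ≡ true × ¬ (i ≡ u × j ≡ v) × ¬ (i ≡ v × j ≡ u)
E-deleteEdge⁻ u v A {i} {j} h with proj₂ (E-true⁻ (deleteEdge u v A) {i} {j} h)
... | inj₁ p = let (e , q) = ∧-true⁻ {E A i j} p in
  e , (λ (a , b) → true≢false (∨-true⁺ˡ (∧-true⁺ (==-true⁺ a) (==-true⁺ b))) (not-true⁻ q))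
    , (λ (a , b) → true≢false (∨-true⁺ʳ {i == u ∧ j == v} (∧-true⁺ (==-true⁺ a) (==-true⁺ b))) (not-true⁻ q))
... | inj₂ p = let (e , q) = ∧-true⁻ {E A j i} p in
  E-sym A e
    , (λ (a , b) → true≢false (∨-true⁺ʳ {j == u ∧ i == v} (∧-true⁺ (==-true⁺ b) (==-true⁺ a))) (not-true⁻ q))
    , (λ (a , b) → true≢false (∨-true⁺ˡ (∧-true⁺ (==-true⁺ b) (==-true⁺ a))) (not-true⁻ q))

E-deleteEdge⁺ : ∀ {n} u v (A : Adj n) {i j} → E A i j ≡ true → ¬ (i ≡ u × j ≡ v) → ¬ (i ≡ v × j ≡ u) →
                E (deleteEdge u v A) i j ≡ true
E-deleteEdge⁺ u v A {i} {j} e p q = E-true⁺ (deleteEdge u v A) (E⇒≢ A e)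
  (inj₁ (∧-true⁺ e (not-true⁺ (≢true⇒false λ h → case ∨-true⁻ {i == u ∧ j == v} h of λ where
    (inj₁ r) → let (a , b) = ∧-true⁻ {i == u} r in p (==-true⁻ a , ==-true⁻ b)
    (inj₂ r) → let (a , b) = ∧-true⁻ {i == v} r in q (==-true⁻ a , ==-true⁻ b)))))

module _ {n} (u v : Fin (suc n)) (A : Adj (suc n)) where

  ContractEdge : Fin n → Fin n → Set
  ContractEdge i j = let x = punchIn v i ; y = punchIn v j in
    E A x y ≡ true ⊎ (x ≡ u × E A v y ≡ true) ⊎ (y ≡ u × E A x v ≡ true)

  contract-true⁻ : ∀ {i j} → contract u v A i j ≡ true → ContractEdge i j
  contract-true⁻ {i} {j} h with ∨-true⁻ {E A (punchIn v i) (punchIn v j)} h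
  ... | inj₁ p = inj₁ p
  ... | inj₂ p with ∨-true⁻ {(punchIn v i == u) ∧ E A v (punchIn v j)} p
  ...   | inj₁ q = let (a , b) = ∧-true⁻ {punchIn v i == u} q in inj₂ (inj₁ (==-true⁻ a , b))
  ...   | inj₂ q = let (a , b) = ∧-true⁻ {punchIn v j == u} q in inj₂ (inj₂ (==-true⁻ a , b))

  E-contract⁻ : ∀ {i j} → E (contract u v A) i j ≡ true → ContractEdge i j
  E-contract⁻ {i} {j} h with proj₂ (E-true⁻ (contract u v A) {i} {j} h)
  ... | inj₁ p = contract-true⁻ p
  ... | inj₂ p with contract-true⁻ p
  ...   | inj₁ q = inj₁ (E-sym A q)
  ...   | inj₂ (inj₁ (a , b)) = inj₂ (inj₂ (a , E-sym A b))
  ...   | inj₂ (inj₂ (a , b)) = inj₂ (inj₁ (a , E-sym A b))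

  E-contract⁺ : ∀ {i j} → i ≢ j → ContractEdge i j → E (contract u v A) i j ≡ true
  E-contract⁺ {i} {j} i≢j h = E-true⁺ (contract u v A) i≢j (inj₁ (case h of λ where
    (inj₁ p) → ∨-true⁺ˡ p
    (inj₂ (inj₁ (a , b))) → ∨-true⁺ʳ {E A (punchIn v i) (punchIn v j)} (∨-true⁺ˡ (∧-true⁺ (==-true⁺ a) b))
    (inj₂ (inj₂ (a , b))) → ∨-true⁺ʳ {E A (punchIn v i) (punchIn v j)}
      (∨-true⁺ʳ {(punchIn v i == u) ∧ E A v (punchIn v j)} (∧-true⁺ (==-true⁺ a) b))))

edges₂-deleteEdge : ∀ {n} u v (A : Adj n) → E A u v ≡ true → edges₂ (deleteEdge u v A) < edges₂ A
edges₂-deleteEdge u v A e = ∑-strict (λ i → ∑-mono (le i)) u (∑-strict (le u) v lt)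
  where
  le : ∀ i j → 𝟙 (E (deleteEdge u v A) i j) ≤ 𝟙 (E A i j)
  le i j = 𝟙-mono (proj₁ ∘ E-deleteEdge⁻ u v A)
  lt : 𝟙 (E (deleteEdge u v A) u v) < 𝟙 (E A u v)
  lt = 𝟙-< (≢true⇒false λ h → proj₁ (proj₂ (E-deleteEdge⁻ u v A h)) (refl , refl)) e

edges₂-iso : ∀ {n} {A B : Adj n} → Iso A B → edges₂ A ≡ edges₂ B
edges₂-iso {n} {A} {B} (σ , h) = trans (∑∑-cong λ i j → cong 𝟙 (h i j))
  (trans (∑-cong {n} λ i → sym (sum-permute (λ j → 𝟙 (E B (Inverse.to σ i) j)) σ))
         (sym (sum-permute (λ i → ∑ λ j → 𝟙 (E B i j)) σ)))

-- Paths and minor models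

data Path {n} (A : Adj n) (P : Fin n → Set) : Fin n → Fin n → Set where
  stop : ∀ {u} → P u → Path A P u u
  step : ∀ {u w v} → P u → E A u w ≡ true → Path A P w v → Path A P u v

path-source : ∀ {n} {A : Adj n} {P u v} → Path A P u v → P u
path-source (stop p) = p
path-source (step p _ _) = p

path-trans : ∀ {n} {A : Adj n} {P u v w} → Path A P u v → Path A P v w → Path A P u w
path-trans (stop _) q = q
path-trans (step p e r) q = step p e (path-trans r q)

path-sym : ∀ {n} {A : Adj n} {P u v} → Path A P u v → Path A P v u
path-sym (stop p) = stop p
path-sym {A = A} (step p e r) = path-trans (path-sym r) (step (path-source r) (E-sym A e) (stop p))

-- An edge may be replaced by a whole path: an edge of a contraction can lift to a detour over the
-- contracted edge.
path-bind : ∀ {m n} {A : Adj m} {B : Adj n} {P : Fin m → Set} {Q : Fin n → Set} (g : Fin m → Fin n) →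
            (∀ {i} → P i → Q (g i)) → (∀ {i j} → P i → P j → E A i j ≡ true → Path B Q (g i) (g j)) →
            ∀ {u v} → Path A P u v → Path B Q (g u) (g v)
path-bind g f h (stop p) = stop (f p)
path-bind g f h (step p e r) = path-trans (h p (path-source r) e) (path-bind g f h r)

path-map : ∀ {m n} {A : Adj m} {B : Adj n} {P : Fin m → Set} {Q : Fin n → Set} (g : Fin m → Fin n) →
           (∀ {i} → P i → Q (g i)) → (∀ {i j} → E A i j ≡ true → E B (g i) (g j) ≡ true) →
           ∀ {u v} → Path A P u v → Path B Q (g u) (g v)
path-map g f h = path-bind g f λ p q e → step (f p) (h e) (stop (f q))

-- A minor model of H in A: the branch sets are the fibres of a partial map.
record Model {h n} (H : Adj h) (A : Adj n) : Set where
  field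
    f : Fin n → Maybe (Fin h)
    onto : ∀ x → ∃ λ v → f v ≡ just x
    conn : ∀ {u v x} → f u ≡ just x → f v ≡ just x → Path A (λ w → f w ≡ just x) u v
    edge : ∀ {x y} → E H x y ≡ true → ∃₂ λ u v → f u ≡ just x × f v ≡ just y × E A u v ≡ true

model-iso : ∀ {n} {A B : Adj n} → Iso A B → Model A B
model-iso {n} {A} {B} (σ , h) = record
  { f = just ∘ from
  ; onto = λ x → to x , cong just (inverseʳ refl)
  ; conn = λ {u} {v} {x} p q → subst (Path B _ u)
      (trans (sym (inverseˡ refl)) (trans (cong to (just-injective (trans p (sym q)))) (inverseˡ refl))) (stop p)
  ; edge = λ {x} {y} e → to x , to y , cong just (inverseʳ refl) , cong just (inverseʳ refl) , trans (sym (h x y)) e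
  }
  where open Inverse σ

model-mono : ∀ {h n} {H : Adj h} {A B : Adj n} → (∀ {i j} → E A i j ≡ true → E B i j ≡ true) → Model H A → Model H B
model-mono sub M = record
  { f = f
  ; onto = onto
  ; conn = λ p q → path-map id id sub (conn p q)
  ; edge = λ e → let (u , v , p , q , r) = edge e in u , v , p , q , sub r
  }
  where open Model M

module _ {h n} {H : Adj h} {A : Adj (suc n)} (v : Fin (suc n)) (M : Model H (deleteVertex v A)) where
  open Model M

  extend : Fin (suc n) → Maybe (Fin h)
  extend w with v ≟F w
  ... | yes _ = nothing
  ... | no v≢w = f (punchOut v≢w)

  extend-punchIn : ∀ i → extend (punchIn v i) ≡ f i
  extend-punchIn i with v ≟F punchIn v i
  ... | yes e = ⊥-elim (punchInᵢ≢i v i (sym e))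
  ... | no v≢w = cong f (punchIn-injective v _ _ (punchIn-punchOut v≢w))

  extend⁻ : ∀ {w x} → extend w ≡ just x → ∃ λ i → punchIn v i ≡ w × f i ≡ just x
  extend⁻ {w} p with v ≟F w
  ... | no v≢w = punchOut v≢w , punchIn-punchOut v≢w , p

  model-delV : Model H A
  model-delV = record
    { f = extend
    ; onto = λ x → let (w , p) = onto x in punchIn v w , trans (extend-punchIn w) p
    ; conn = λ p q → conn′ (extend⁻ p) (extend⁻ q)
    ; edge = λ e → let (a , b , p , q , r) = edge e in
        punchIn v a , punchIn v b , trans (extend-punchIn a) p , trans (extend-punchIn b) q , lift r
    }
    where
    lift : ∀ {a b} → E (deleteVertex v A) a b ≡ true → E A (punchIn v a) (punchIn v b) ≡ true
    lift {a} {b} r = trans (sym (E-deleteVertex v A a b)) r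
    conn′ : ∀ {a b x} → (∃ λ i → punchIn v i ≡ a × f i ≡ just x) → (∃ λ i → punchIn v i ≡ b × f i ≡ just x) →
            Path A (λ w → extend w ≡ just x) a b
    conn′ (i , refl , p) (j , refl , q) = path-map (punchIn v) (λ {k} r → trans (extend-punchIn k) r) lift (conn p q)

module _ {n} {u v : Fin (suc n)} (u≢v : u ≢ v) where

  -- The quotient map of the contraction of uv; v is sent to the index of u.
  merge : Fin (suc n) → Fin n
  merge w with v ≟F w
  ... | yes _ = punchOut (u≢v ∘ sym)
  ... | no v≢w = punchOut v≢w

  merge-≢ : ∀ {w} → v ≢ w → punchIn v (merge w) ≡ w
  merge-≢ {w} v≢w with v ≟F w
  ... | yes e = ⊥-elim (v≢w e)
  ... | no p = punchIn-punchOut p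

  merge-v : punchIn v (merge v) ≡ u
  merge-v with v ≟F v
  ... | yes _ = punchIn-punchOut (u≢v ∘ sym)
  ... | no p = ⊥-elim (p refl)

  merge-punchIn : ∀ i → merge (punchIn v i) ≡ i
  merge-punchIn i = punchIn-injective v _ _ (merge-≢ (punchInᵢ≢i v i ∘ sym))

  merge-u : merge u ≡ merge v
  merge-u = punchIn-injective v _ _ (trans (merge-≢ (u≢v ∘ sym)) (sym merge-v))

  E-merge : ∀ (A : Adj (suc n)) {a b} → E A a b ≡ true → merge a ≢ merge b → E (contract u v A) (merge a) (merge b) ≡ true
  E-merge A {a} {b} e ne = E-contract⁺ u v A ne (cases (v ≟F a) (v ≟F b))
    where
    cases : Dec (v ≡ a) → Dec (v ≡ b) → ContractEdge u v A (merge a) (merge b)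
    cases (yes refl) (yes refl) = ⊥-elim (ne refl)
    cases (yes refl) (no q) = inj₂ (inj₁ (merge-v , subst (λ z → E A v z ≡ true) (sym (merge-≢ q)) e))
    cases (no p) (yes refl) = inj₂ (inj₂ (merge-v , subst (λ z → E A z v ≡ true) (sym (merge-≢ p)) e))
    cases (no p) (no q) = inj₁ (trans (cong₂ (E A) (merge-≢ p) (merge-≢ q)) e)

-- The branch sets are pulled back along the quotient map. The one that contains the merged vertex
-- now contains both u and v, joined by the edge `e`, and an edge at the merged vertex comes from an
-- edge at u or at v.
model-contr : ∀ {h n} {H : Adj h} {A : Adj (suc n)} (u v : Fin (suc n)) → E A u v ≡ true →
              Model H (contract u v A) → Model H A
model-contr {n = n} {A = A} u v e M = record
  { f = f ∘ merge u≢v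
  ; onto = λ x → let (w , p) = onto x in punchIn v w , trans (cong f (merge-punchIn u≢v w)) p
  ; conn = λ {a} {b} p q → path-trans (toRep a p) (path-trans (mid p q) (path-sym (toRep b q)))
  ; edge = λ r → let (a , b , p , q , s) = edge r in edge′ p q (E-contract⁻ u v A s)
  }
  where
  open Model M
  u≢v = E⇒≢ A e
  g : Fin (suc n) → Maybe _
  g = f ∘ merge u≢v
  gp : ∀ i {x} → f i ≡ just x → g (punchIn v i) ≡ just x
  gp i p = trans (cong f (merge-punchIn u≢v i)) p
  gv : ∀ i {x} → punchIn v i ≡ u → f i ≡ just x → g v ≡ just x
  gv i r p = trans (cong f (trans (sym (merge-u u≢v)) (trans (cong (merge u≢v) (sym r)) (merge-punchIn u≢v i)))) p
  toRep : ∀ a {x} → g a ≡ just x → Path A (λ w → g w ≡ just x) a (punchIn v (merge u≢v a))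
  toRep a p = cases (v ≟F a)
    where
    cases : Dec (v ≡ a) → Path A (λ w → g w ≡ _) a (punchIn v (merge u≢v a))
    cases (yes refl) = step p (E-sym A e) (subst (Path A _ u) (sym (merge-v u≢v)) (stop (trans (cong f (merge-u u≢v)) p)))
    cases (no v≢a) = subst (Path A _ a) (sym (merge-≢ u≢v v≢a)) (stop p)
  mid : ∀ {a b x} → g a ≡ just x → g b ≡ just x →
        Path A (λ w → g w ≡ just x) (punchIn v (merge u≢v a)) (punchIn v (merge u≢v b))
  mid p q = path-bind (punchIn v) (λ {i} → gp i) (λ {i} {j} r s t → link i j r s (E-contract⁻ u v A t)) (conn p q)
    where
    link : ∀ i j {x} → f i ≡ just x → f j ≡ just x → ContractEdge u v A i j →
           Path A (λ w → g w ≡ just x) (punchIn v i) (punchIn v j)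
    link i j p q (inj₁ t) = step (gp i p) t (stop (gp j q))
    link i j p q (inj₂ (inj₁ (r , t))) =
      step (gp i p) (subst (λ z → E A z v ≡ true) (sym r) e) (step (gv i r p) t (stop (gp j q)))
    link i j p q (inj₂ (inj₂ (r , t))) =
      step (gp i p) t (step (gv j r q) (subst (λ z → E A v z ≡ true) (sym r) (E-sym A e)) (stop (gp j q)))
  edge′ : ∀ {i j x y} → f i ≡ just x → f j ≡ just y → ContractEdge u v A i j →
          ∃₂ λ a b → g a ≡ just x × g b ≡ just y × E A a b ≡ true
  edge′ {i} {j} p q (inj₁ t) = punchIn v i , punchIn v j , gp i p , gp j q , t
  edge′ {i} {j} p q (inj₂ (inj₁ (r , t))) = v , punchIn v j , gv i r p , gp j q , t
  edge′ {i} {j} p q (inj₂ (inj₂ (r , t))) = punchIn v i , v , gp i p , gv j r q , t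

≼⇒Model : ∀ {h n} {H : Adj h} {A : Adj n} → (h , H) ≼ (n , A) → Model H A
≼⇒Model (iso i) = model-iso i
≼⇒Model (delV v d) = model-delV v (≼⇒Model d)
≼⇒Model (delE {A = A} u v d) = model-mono (proj₁ ∘ E-deleteEdge⁻ u v A) (≼⇒Model d)
≼⇒Model (contr u v e d) = model-contr u v e (≼⇒Model d)

-- A model in which every fibre is a single vertex is a spanning subgraph up to
-- isomorphism; otherwise a vertex outside the model or an edge inside a fibre can be eliminated.

module _ {n} (H : Adj n) where

  -- The bijection `s` embeds H; surplus edges of A are deleted one at a time until it is an
  -- isomorphism. `fuel` bounds the ordered pairs of adjacent vertices left.
  bijective⇒≼ : ∀ fuel (A : Adj n) → edges₂ A ≤ fuel → (g : Fin n → Fin n) (s : Fin n → Fin n) →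
                (∀ x → g (s x) ≡ x) → (∀ v → s (g v) ≡ v) →
                (∀ {x y} → E H x y ≡ true → E A (s x) (s y) ≡ true) → (n , H) ≼ (n , A)
  bijective⇒≼ fuel A le g s gs sg sub
    with any? (λ x → any? λ y → true? (E A (s x) (s y)) ×-dec ¬? (true? (E H x y)))
  ... | no ¬p = iso (mk↔ₛ′ s g sg gs , λ x y → ⇔⇒≡ sub (λ e → back x y e (true? (E H x y))))
    where
    back : ∀ x y → E A (s x) (s y) ≡ true → Dec (E H x y ≡ true) → E H x y ≡ true
    back x y e (yes p) = p
    back x y e (no q) = ⊥-elim (¬p (x , y , e , q))
  bijective⇒≼ zero A le g s gs sg sub | yes (x , y , e , q) =
    ⊥-elim (n≮0 (≤-trans (edges₂-deleteEdge (s x) (s y) A e) le))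
  bijective⇒≼ (suc fuel) A le g s gs sg sub | yes (x , y , e , q) =
    delE (s x) (s y) (bijective⇒≼ fuel _ (s≤s⁻¹ (≤-trans (edges₂-deleteEdge (s x) (s y) A e) le)) g s gs sg sub′)
    where
    s-inj : ∀ {a b} → s a ≡ s b → a ≡ b
    s-inj {a} {b} r = trans (sym (gs a)) (trans (cong g r) (gs b))
    sub′ : ∀ {a b} → E H a b ≡ true → E (deleteEdge (s x) (s y) A) (s a) (s b) ≡ true
    sub′ h = E-deleteEdge⁺ (s x) (s y) A (sub h)
      (λ (r , t) → q (subst (λ z → E H z y ≡ true) (s-inj r) (subst (λ z → E H _ z ≡ true) (s-inj t) h)))
      (λ (r , t) → q (E-sym H (subst (λ z → E H z x ≡ true) (s-inj r) (subst (λ z → E H _ z ≡ true) (s-inj t) h))))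

nothing? : ∀ {a} {X : Set a} (m : Maybe X) → Dec (m ≡ nothing)
nothing? nothing = yes refl
nothing? (just _) = no λ ()

total : ∀ {a} {X : Set a} (m : Maybe X) → ¬ (m ≡ nothing) → ∃ λ x → m ≡ just x
total nothing h = ⊥-elim (h refl)
total (just x) h = x , refl

injective-model⇒≼ : ∀ {h n} {H : Adj h} {A : Adj n} (M : Model H A) (g : Fin n → Fin h) →
                    (∀ v → Model.f M v ≡ just (g v)) → (∀ {u v} → g u ≡ g v → u ≡ v) → (h , H) ≼ (n , A)
injective-model⇒≼ {h} {n} {H} {A} M g fg inj = go (≤-antisym (injective⇒≤ inj) (injective⇒≤ s-inj)) g gs sg s s-sub
  where
  open Model M
  s : Fin h → Fin n
  s x = proj₁ (onto x)
  gs : ∀ x → g (s x) ≡ x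
  gs x = just-injective (trans (sym (fg (s x))) (proj₂ (onto x)))
  sg : ∀ v → s (g v) ≡ v
  sg v = inj (gs (g v))
  s-inj : ∀ {x y} → s x ≡ s y → x ≡ y
  s-inj {x} {y} r = trans (sym (gs x)) (trans (cong g r) (gs y))
  s-sub : ∀ {x y} → E H x y ≡ true → E A (s x) (s y) ≡ true
  s-sub {x} {y} e = let (u , v , p , q , r) = edge e in
    subst (λ z → E A z (s y) ≡ true) (at u x p) (subst (λ z → E A u z ≡ true) (at v y q) r)
    where
    at : ∀ w z → f w ≡ just z → w ≡ s z
    at w z p = inj (trans (just-injective (trans (sym (fg w)) p)) (sym (gs z)))
  go : n ≡ h → (g : Fin n → Fin h) {s : Fin h → Fin n} → (∀ x → g (s x) ≡ x) → (∀ v → s (g v) ≡ v) →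
       (s′ : Fin h → Fin n) → (∀ {x y} → E H x y ≡ true → E A (s x) (s y) ≡ true) → (h , H) ≼ (n , A)
  go refl g {s} gs sg _ sub = bijective⇒≼ H (edges₂ A) A ≤-refl g s gs sg sub

model-restrict : ∀ {h m n} {H : Adj h} {A : Adj n} {B : Adj m} (e : Fin m → Fin n) → (∀ {i j} → e i ≡ e j → i ≡ j) →
                 (∀ i j → E B i j ≡ E A (e i) (e j)) → (M : Model H A) →
                 (∀ {v x} → Model.f M v ≡ just x → ∃ λ i → e i ≡ v) → Model H B
model-restrict {A = A} {B} e inj eB M img = record
  { f = f ∘ e
  ; onto = λ x → let (v , p) = onto x ; (i , q) = img p in i , trans (cong f q) p
  ; conn = λ p q → restrict refl refl (conn p q)
  ; edge = λ d → let (a , b , p , q , r) = edge d ; (i , s) = img p ; (j , t) = img q in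
      i , j , trans (cong f s) p , trans (cong f t) q , trans (eB i j) (trans (cong₂ (E A) s t) r)
  }
  where
  open Model M
  restrict : ∀ {x a b i j} → e i ≡ a → e j ≡ b → Path A (λ w → f w ≡ just x) a b → Path B (λ w → f (e w) ≡ just x) i j
  restrict {i = i} p q (stop r) = subst (Path _ _ i) (inj (trans p (sym q))) (stop (trans (cong f p) r))
  restrict {i = i} refl q (step r d s) = let (k , t) = img (path-source s) in
    step r (trans (eB i k) (trans (cong (E A (e i)) t) d)) (restrict t q s)

Model⇒≼ : ∀ {h n} {H : Adj h} {A : Adj n} → Model H A → (h , H) ≼ (n , A)
Model⇒≼ {h} {n} {H} {A} M with any? (λ v → nothing? (Model.f M v))
Model⇒≼ {h} {suc n} {H} {A} M | yes (v , v∉) =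
  delV v (Model⇒≼ (model-restrict (punchIn v) (punchIn-injective v _ _) (E-deleteVertex v A) M λ p →
    punchOut (avoid p) , punchIn-punchOut (avoid p)))
  where
  avoid : ∀ {w x} → Model.f M w ≡ just x → v ≢ w
  avoid p refl = case trans (sym p) v∉ of λ ()
Model⇒≼ {h} {n} {H} {A} M | no all with any? (λ u → any? λ v → ¬? (u ≟F v) ×-dec (proj₁ (tot u) ≟F proj₁ (tot v)))
  where
  tot : ∀ v → ∃ λ x → Model.f M v ≡ just x
  tot v = total (Model.f M v) (λ p → all (v , p))
... | no inj = injective-model⇒≼ M (proj₁ ∘ tot) (proj₂ ∘ tot) (λ {u} {v} p → same u v p (u ≟F v))
  where
  tot : ∀ v → ∃ λ x → Model.f M v ≡ just x
  tot v = total (Model.f M v) (λ p → all (v , p))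
  same : ∀ u v → proj₁ (tot u) ≡ proj₁ (tot v) → Dec (u ≡ v) → u ≡ v
  same u v p (yes q) = q
  same u v p (no q) = ⊥-elim (inj (u , v , q , p))
-- The path from u to v stays in their common fibre, so its first edge joins u to another vertex of
-- the fibre and may be contracted.
Model⇒≼ {h} {suc n} {H} {A} M | no all | yes (u , v , u≢v , eq) with
  Model.conn M (proj₂ (total (Model.f M u) (λ p → all (u , p))))
               (trans (proj₂ (total (Model.f M v) (λ p → all (v , p)))) (cong just (sym eq)))
... | stop _ = ⊥-elim (u≢v refl)
... | step {w = w} fu e r = contr u w e (Model⇒≼ record
  { f = f ∘ punchIn w
  ; onto = λ x → let (a , p) = onto x in merge u≢w a , f-merge a p
  ; conn = λ {a} {b} p q → subst (λ z → Path _ _ z b) (merge-punchIn u≢w a)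
      (subst (Path _ _ _) (merge-punchIn u≢w b)
      (path-bind (merge u≢w) (λ {i} → f-merge i) link (conn p q)))
  ; edge = λ {x} {y} d → let (a , b , p , q , s) = edge d in
      merge u≢w a , merge u≢w b , f-merge a p , f-merge b q ,
      E-merge u≢w A s (λ m → E⇒≢ H d (just-injective (trans (sym (f-merge a p)) (trans (cong (f ∘ punchIn w) m) (f-merge b q)))))
  })
  where
  open Model M
  u≢w = E⇒≢ A e
  fw = path-source r
  f-merge : ∀ a {x} → f a ≡ just x → f (punchIn w (merge u≢w a)) ≡ just x
  f-merge a p with w ≟F a
  ... | yes refl = trans (cong f (punchIn-punchOut (u≢w ∘ sym))) (trans fu (trans (sym fw) p))
  ... | no w≢a = trans (cong f (punchIn-punchOut w≢a)) p
  link : ∀ {i j x} → f i ≡ just x → f j ≡ just x → E A i j ≡ true →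
         Path (contract u w A) (λ a → f (punchIn w a) ≡ just x) (merge u≢w i) (merge u≢w j)
  link {i} {j} p q s with merge u≢w i ≟F merge u≢w j
  ... | yes m = subst (Path _ _ _) m (stop (f-merge i p))
  ... | no m = step (f-merge i p) (E-merge u≢w A s m) (stop (f-merge j q))

-- Induced subgraphs

𝟙-∧ : ∀ a b → 𝟙 (a ∧ b) ≡ 𝟙 a * 𝟙 b
𝟙-∧ true b = sym (+-identityʳ (𝟙 b))
𝟙-∧ false b = refl

pairs : ∀ {n} → (Fin n → Fin n → Bool) → (Fin n → Bool) → ℕ
pairs R P = ∑ λ i → ∑ λ j → 𝟙 (P i ∧ (P j ∧ R i j))

induced : ∀ {n} → Adj n → (P : Fin n → Bool) → Adj (count P)
induced A P x y = A (enum P x) (enum P y)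

E-induced : ∀ {n} (A : Adj n) P x y → E (induced A P) x y ≡ E A (enum P x) (enum P y)
E-induced A P x y = cong (λ b → not b ∧ (A (enum P x) (enum P y) ∨ A (enum P y) (enum P x)))
  (⇔⇒≡ {x == y} (λ h → ==-true⁺ (cong (enum P) (==-true⁻ h))) (λ h → ==-true⁺ (enum-injective P (==-true⁻ h))))

edges₂-induced : ∀ {n} (A : Adj n) P → edges₂ (induced A P) ≡ pairs (E A) P
edges₂-induced {n} A P = begin
  edges₂ (induced A P)
    ≡⟨ ∑∑-cong (λ x y → cong 𝟙 (E-induced A P x y)) ⟩
  ∑ (λ x → ∑ λ y → 𝟙 (E A (enum P x) (enum P y)))
    ≡⟨ ∑-cong {count P} (λ x → ∑-enum P (λ j → 𝟙 (E A (enum P x) j))) ⟩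
  ∑ (λ x → ∑ λ j → 𝟙 (P j) * 𝟙 (E A (enum P x) j))
    ≡⟨ ∑-enum P (λ i → ∑ λ j → 𝟙 (P j) * 𝟙 (E A i j)) ⟩
  ∑ (λ i → 𝟙 (P i) * ∑ λ j → 𝟙 (P j) * 𝟙 (E A i j))
    ≡⟨ ∑-cong {n} (λ i → sym (∑-*ˡ (𝟙 (P i)) (λ j → 𝟙 (P j) * 𝟙 (E A i j)))) ⟩
  ∑ (λ i → ∑ λ j → 𝟙 (P i) * (𝟙 (P j) * 𝟙 (E A i j)))
    ≡⟨ ∑∑-cong (λ i j → sym (trans (𝟙-∧ (P i) (P j ∧ E A i j)) (cong (𝟙 (P i) *_) (𝟙-∧ (P j) (E A i j))))) ⟩
  pairs (E A) P ∎
  where open ≡-Reasoning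

locate : ∀ {n} (P : Fin n → Bool) → Fin n → Maybe (Fin (count P))
locate P v with true? (P v)
... | yes p = just (proj₁ (enum-onto P v p))
... | no _ = nothing

locate⁻ : ∀ {n} (P : Fin n → Bool) v {k} → locate P v ≡ just k → enum P k ≡ v
locate⁻ P v h with true? (P v)
locate⁻ P v refl | yes p = proj₂ (enum-onto P v p)

locate⁺ : ∀ {n} (P : Fin n → Bool) k → locate P (enum P k) ≡ just k
locate⁺ P k with true? (P (enum P k))
... | yes p = cong just (enum-injective P (proj₂ (enum-onto P (enum P k) p)))
... | no ¬p = ⊥-elim (¬p (enum-∈ P k))

>>=-just⁻ : ∀ {X Y : Set} (m : Maybe X) {g : X → Maybe Y} {y} → (m >>= g) ≡ just y → ∃ λ x → m ≡ just x × g x ≡ just y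
>>=-just⁻ (just x) h = x , refl , h

module _ {h n} {H : Adj h} {A : Adj n} (P : Fin n → Bool) (M : Model H (induced A P)) where
  open Model M

  induced-f : Fin n → Maybe (Fin h)
  induced-f v = locate P v >>= f

  induced-f⁺ : ∀ k {x} → f k ≡ just x → induced-f (enum P k) ≡ just x
  induced-f⁺ k p = trans (cong (_>>= f) (locate⁺ P k)) p

  induced-f⁻ : ∀ v {x} → induced-f v ≡ just x → ∃ λ k → enum P k ≡ v × f k ≡ just x
  induced-f⁻ v p = let (k , q , r) = >>=-just⁻ (locate P v) p in k , locate⁻ P v q , r

  induced-f-∈ : ∀ {v x} → induced-f v ≡ just x → P v ≡ true
  induced-f-∈ {v} p = let (k , q , _) = induced-f⁻ v p in subst (λ z → P z ≡ true) q (enum-∈ P k)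

  model-induced : Model H A
  model-induced = record
    { f = induced-f
    ; onto = λ x → let (k , p) = onto x in enum P k , induced-f⁺ k p
    ; conn = λ {u} {v} p q → conn′ (induced-f⁻ u p) (induced-f⁻ v q)
    ; edge = λ e → let (a , b , p , q , r) = edge e in
        enum P a , enum P b , induced-f⁺ a p , induced-f⁺ b q , trans (sym (E-induced A P a b)) r
    }
    where
    conn′ : ∀ {u v x} → (∃ λ k → enum P k ≡ u × f k ≡ just x) → (∃ λ k → enum P k ≡ v × f k ≡ just x) →
            Path A (λ w → induced-f w ≡ just x) u v
    conn′ (i , refl , p) (j , refl , q) =
      path-map (enum P) (λ {k} → induced-f⁺ k) (λ {a} {b} r → trans (sym (E-induced A P a b)) r) (conn p q)

-- Certificates of an edge bound that pass to minors

Iso-refl : ∀ {n} (A : Adj n) → Iso A A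
Iso-refl A = ↔-id _ , λ _ _ → refl

-- No edge joins different classes of c, and removing at most one apex from a class leaves a graph all
-- of whose minors satisfy the bound.
record Cert (U V : ℕ) {n} (A : Adj n) : Set where
  field
    k : ℕ
    c : Fin n → Fin k
    apex : Fin n → Bool
    within : ∀ {u v} → E A u v ≡ true → c u ≡ c v
    unique : ∀ {u v} → apex u ≡ true → apex v ≡ true → c u ≡ c v → u ≡ v
    -- The cone over H has at most U / V edges per vertex; `suc h` counts the apex.
    bound : ∀ j {h} (H : Adj h) (M : Model H A) →
            (∀ {v x} → Model.f M v ≡ just x → c v ≡ j × apex v ≡ false) →
            V * (edges₂ H + 2 * h) ≤ 2 * (U * suc h)

module _ {U V : ℕ} where

  cert-iso : ∀ {n} {A B : Adj n} → Iso A B → Cert U V B → Cert U V A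
  cert-iso {A = A} {B} (σ , e) C = record
    { k = k
    ; c = c ∘ to
    ; apex = apex ∘ to
    ; within = λ {u} {v} h → within (trans (sym (e u v)) h)
    ; unique = λ {u} {v} p q r → trans (sym (inverseʳ refl)) (trans (cong from (unique p q r)) (inverseʳ refl))
    ; bound = λ j H M supp → bound j H
        (model-restrict from (λ {a} {b} p → trans (sym (inverseˡ refl)) (trans (cong to p) (inverseˡ refl)))
          (λ a b → sym (trans (e (from a) (from b)) (cong₂ (E B) (inverseˡ refl) (inverseˡ refl)))) M
          (λ {v} _ → to v , inverseʳ refl))
        (λ {v} {x} p → subst (λ z → c z ≡ j × apex z ≡ false) (inverseˡ refl) (supp p))
    }
    where
    open Inverse σ
    open Cert C

  cert-delV : ∀ {n} {A : Adj (suc n)} v → Cert U V A → Cert U V (deleteVertex v A)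
  cert-delV {A = A} v C = record
    { k = k
    ; c = c ∘ punchIn v
    ; apex = apex ∘ punchIn v
    ; within = λ {a} {b} h → within (trans (sym (E-deleteVertex v A a b)) h)
    ; unique = λ p q r → punchIn-injective v _ _ (unique p q r)
    ; bound = λ j H M supp → bound j H (model-delV v M) λ p →
        let (i , q , r) = extend⁻ v M p in subst (λ z → c z ≡ j × apex z ≡ false) q (supp r)
    }
    where open Cert C

  cert-delE : ∀ {n} {A : Adj n} u v → Cert U V A → Cert U V (deleteEdge u v A)
  cert-delE {A = A} u v C = record
    { k = k
    ; c = c
    ; apex = apex
    ; within = λ h → within (proj₁ (E-deleteEdge⁻ u v A h))
    ; unique = unique
    ; bound = λ j H M supp → bound j H (model-mono (λ h → proj₁ (E-deleteEdge⁻ u v A h)) M) supp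
    }
    where open Cert C

  -- The merged vertex becomes an apex if one of its ends was one. Both ends lie in the same class,
  -- since uv is an edge, so a class still has at most one apex. A model that avoids the new apexes
  -- pulls back to a model that avoids the old ones.
  cert-contr : ∀ {n} {A : Adj (suc n)} u v → E A u v ≡ true → Cert U V A → Cert U V (contract u v A)
  cert-contr {n} {A} u v e C = record
    { k = k
    ; c = c ∘ punchIn v
    ; apex = apex′
    ; within = λ h → within′ (E-contract⁻ u v A h)
    ; unique = λ {a} {b} p q r → unique′ a b (apex⁻ a p) (apex⁻ b q) r
    ; bound = λ j H M supp → bound j H (model-contr u v e M) λ {w} p →
        cases (Model.f M) supp w p (v ≟F w)
    }
    where
    open Cert C
    u≢v = E⇒≢ A e
    apex′ : Fin n → Bool
    apex′ i = apex (punchIn v i) ∨ ((punchIn v i == u) ∧ apex v)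
    within′ : ∀ {a b} → ContractEdge u v A a b → c (punchIn v a) ≡ c (punchIn v b)
    within′ (inj₁ p) = within p
    within′ (inj₂ (inj₁ (r , p))) = trans (cong c r) (trans (within e) (within p))
    within′ (inj₂ (inj₂ (r , p))) = trans (within p) (trans (sym (within e)) (cong c (sym r)))
    apex⁻ : ∀ a → apex′ a ≡ true → ∃ λ w → apex w ≡ true × c w ≡ c (punchIn v a) × merge u≢v w ≡ a
    apex⁻ a p with ∨-true⁻ {apex (punchIn v a)} p
    ... | inj₁ q = punchIn v a , q , refl , merge-punchIn u≢v a
    ... | inj₂ q = let (r , s) = ∧-true⁻ {punchIn v a == u} q in
      v , s , trans (sym (within e)) (cong c (sym (==-true⁻ r))) ,
      punchIn-injective v _ _ (trans (merge-v u≢v) (sym (==-true⁻ r)))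
    unique′ : ∀ a b → (∃ λ w → apex w ≡ true × c w ≡ c (punchIn v a) × merge u≢v w ≡ a) →
              (∃ λ w → apex w ≡ true × c w ≡ c (punchIn v b) × merge u≢v w ≡ b) →
              c (punchIn v a) ≡ c (punchIn v b) → a ≡ b
    unique′ a b (x , p , q , r) (y , p′ , q′ , r′) s =
      trans (sym r) (trans (cong (merge u≢v) (unique p p′ (trans q (trans s (sym q′))))) r′)
    cases : ∀ {h j} (f : Fin n → Maybe (Fin h)) → (∀ {i x} → f i ≡ just x → c (punchIn v i) ≡ j × apex′ i ≡ false) →
            ∀ w {x} → f (merge u≢v w) ≡ just x → Dec (v ≡ w) → c w ≡ j × apex w ≡ false
    cases f supp w p (yes refl) = let (q , r) = supp p in
      trans (sym (within e)) (trans (cong c (sym (merge-v u≢v))) q) ,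
      ≢true⇒false (λ s → true≢false (∨-true⁺ʳ {apex (punchIn v (merge u≢v v))} (∧-true⁺ (==-true⁺ (merge-v u≢v)) s)) r)
    cases f supp w p (no v≢w) = let (q , r) = supp p in
      trans (cong c (sym (merge-≢ u≢v v≢w))) q ,
      ≢true⇒false (λ s → true≢false (∨-true⁺ˡ (trans (cong apex (merge-≢ u≢v v≢w)) s)) r)

  cert-≼ : ∀ {h n} {H : Adj h} {A : Adj n} → (h , H) ≼ (n , A) → Cert U V A → Cert U V H
  cert-≼ (iso i) C = cert-iso i C
  cert-≼ (delV v d) C = cert-≼ d (cert-delV v C)
  cert-≼ (delE u v d) C = cert-≼ d (cert-delE u v C)
  cert-≼ (contr u v e d) C = cert-≼ d (cert-contr u v e C)

  module _ {n} (A : Adj n) (C : Cert U V A) where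
    open Cert C

    class : Fin k → Fin n → Bool
    class j u = c u == j

    -- The class without `a` is a model of itself, so `bound` applies to it. The term `2 * h` in
    -- `bound` pays for the edges at `a`, and `suc h` for the vertex `a`.
    rooted-class-bound : ∀ j a → class j a ≡ true → (∀ {v} → class j v ≡ true → apex v ≡ true → v ≡ a) →
                         V * pairs (E A) (class j) ≤ 2 * (U * count (class j))
    rooted-class-bound j a a∈ only = begin
      V * pairs (E A) S
        ≤⟨ V ⊙ pairs-≤ ⟩
      V * (pairs (E A) B + 2 * count B)
        ≡⟨ cong (λ z → V * (z + 2 * count B)) (edges₂-induced A B) ⟨
      V * (edges₂ (induced A B) + 2 * count B)
        ≤⟨ bound j (induced A B) (model-induced {A = A} B self) (λ p → supp (induced-f-∈ {A = A} B self p)) ⟩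
      2 * (U * suc (count B))
        ≤⟨ 2 ⊙ (U ⊙ count-B) ⟩
      2 * (U * count S) ∎
      where
      open ≤-Reasoning
      S = class j
      B : Fin n → Bool
      B i = S i ∧ not (i == a)
      self : Model (induced A B) (induced A B)
      self = model-iso (Iso-refl (induced A B))
      supp : ∀ {v} → B v ≡ true → c v ≡ j × apex v ≡ false
      supp {v} p = let (q , r) = ∧-true⁻ {S v} p in
        ==-true⁻ q , ≢true⇒false (λ s → true≢false (==-true⁺ (only q s)) (not-true⁻ r))
      count-B : suc (count B) ≤ count S
      count-B = ≤-trans (count-pos {P = _== a} a (==-true⁺ refl) ⊕ ≤-refl {count B})
        (count-⊎ {P = _== a} {B} {S} (λ i p → subst (λ z → S z ≡ true) (sym (==-true⁻ p)) a∈)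
          (λ i p → proj₁ (∧-true⁻ {S i} p)) (λ i p q → true≢false p (not-true⁻ (proj₂ (∧-true⁻ {S i} q)))))
      X Y Z : Fin n → Fin n → ℕ
      X u v = 𝟙 (B u ∧ (B v ∧ E A u v))
      Y u v = 𝟙 (u == a) * 𝟙 (B v)
      Z u v = 𝟙 (v == a) * 𝟙 (B u)
      pointwise : ∀ u v → 𝟙 (S u ∧ (S v ∧ E A u v)) ≤ X u v + (Y u v + Z u v)
      pointwise u v with true? (S u ∧ (S v ∧ E A u v))
      ... | no ¬p rewrite ≢true⇒false ¬p = z≤n
      ... | yes p with ∧-true⁻ {S u} p
      ...   | Su , q with ∧-true⁻ {S v} q
      ...     | Sv , e with u ≟F a | v ≟F a
      ...       | yes refl | yes refl = ⊥-elim (E⇒≢ A e refl)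
      ...       | yes refl | no _ rewrite Sv | Su | e = ≤-refl
      ...       | no _ | yes refl rewrite Sv | Su | e = ≤-refl
      ...       | no _ | no _ rewrite Sv | Su | e = ≤-refl
      rows : ∑ (λ u → ∑ λ v → 𝟙 (u == a) * 𝟙 (B v)) ≤ count B
      rows = begin
        ∑ (λ u → ∑ λ v → 𝟙 (u == a) * 𝟙 (B v)) ≡⟨ ∑-cong {n} (λ u → ∑-*ˡ (𝟙 (u == a)) (𝟙 ∘ B)) ⟩
        ∑ (λ u → 𝟙 (u == a) * count B)         ≡⟨ ∑-cong {n} (λ u → *-comm (𝟙 (u == a)) (count B)) ⟩
        ∑ (λ u → count B * 𝟙 (u == a))         ≡⟨ ∑-*ˡ (count B) (λ u → 𝟙 (u == a)) ⟩
        count B * count (_== a)                ≤⟨ count B ⊙ count-== a ⟩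
        count B * 1                            ≡⟨ *-identityʳ (count B) ⟩
        count B                                ∎
      pairs-≤ : pairs (E A) S ≤ pairs (E A) B + 2 * count B
      pairs-≤ = begin
        pairs (E A) S                                       ≤⟨ ∑∑-mono pointwise ⟩
        ∑ (λ u → ∑ λ v → X u v + (Y u v + Z u v))           ≡⟨ ∑∑-+ X (λ u v → Y u v + Z u v) ⟩
        pairs (E A) B + ∑ (λ u → ∑ λ v → Y u v + Z u v)     ≡⟨ cong (pairs (E A) B +_) (∑∑-+ Y Z) ⟩
        pairs (E A) B + (∑ (λ u → ∑ (Y u)) + ∑ (λ u → ∑ (Z u)))
          ≤⟨ ≤-refl {pairs (E A) B} ⊕ (rows ⊕ ≤-trans (≤-reflexive (∑-comm Z)) rows) ⟩
        pairs (E A) B + (count B + count B)                 ≡⟨ cong (λ z → pairs (E A) B + (count B + z)) (+-identityʳ (count B)) ⟨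
        pairs (E A) B + 2 * count B ∎

    class-bound : ∀ j → V * pairs (E A) (class j) ≤ 2 * (U * count (class j))
    class-bound j with any? (λ a → true? (class j a ∧ apex a))
    ... | yes (a , p) = let (q , r) = ∧-true⁻ {class j a} p in
      rooted-class-bound j a q λ s t → unique t r (trans (==-true⁻ s) (sym (==-true⁻ q)))
    ... | no none with any? (λ a → true? (class j a))
    -- In a class without an apex any vertex may serve as the root.
    ...   | yes (a , p) = rooted-class-bound j a p λ {v} s t → ⊥-elim (none (v , ∧-true⁺ s t))
    ...   | no empty = ≤-trans (≤-reflexive (trans (cong (V *_) zero-pairs) (*-zeroʳ V))) z≤n
      where
      zero-pairs : pairs (E A) (class j) ≡ 0
      zero-pairs = ∑∑-zero λ u v → cong 𝟙 (≢true⇒false {class j u ∧ (class j v ∧ E A u v)} λ p →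
        empty (u , proj₁ (∧-true⁻ {class j u} p)))

    cert-edges : V * edges₂ A ≤ 2 * (U * n)
    cert-edges = begin
      V * edges₂ A                                     ≤⟨ V ⊙ cover ⟩
      V * ∑ (λ j → pairs (E A) (class j))              ≡⟨ ∑-*ˡ V (λ j → pairs (E A) (class j)) ⟨
      ∑ (λ j → V * pairs (E A) (class j))              ≤⟨ ∑-mono class-bound ⟩
      ∑ (λ j → 2 * (U * count (class j)))              ≡⟨ ∑-*ˡ 2 (λ j → U * count (class j)) ⟩
      2 * ∑ (λ j → U * count (class j))                ≡⟨ cong (2 *_) (∑-*ˡ U (λ j → count (class j))) ⟩
      2 * (U * ∑ (λ j → count (class j)))              ≡⟨ cong (λ z → 2 * (U * z)) (∑-comm (λ j u → 𝟙 (class j u))) ⟩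
      2 * (U * ∑ (λ u → ∑ λ j → 𝟙 (c u == j)))         ≤⟨ 2 ⊙ (U ⊙ ∑-≤const {n} {1} (λ u → ≤-trans (≤-reflexive (∑-cong {k} λ j → cong 𝟙 (flip-== (c u) j))) (count-== (c u)))) ⟩
      2 * (U * (n * 1))                                ≡⟨ cong (λ z → 2 * (U * z)) (*-identityʳ n) ⟩
      2 * (U * n)                                      ∎
      where
      open ≤-Reasoning
      flip-== : ∀ {m} (a b : Fin m) → (a == b) ≡ (b == a)
      flip-== a b = ⇔⇒≡ {a == b} (λ p → ==-true⁺ (sym (==-true⁻ p))) (λ p → ==-true⁺ (sym (==-true⁻ p)))
      T : Fin k → Fin n → Fin n → ℕ
      T j u v = 𝟙 (class j u ∧ (class j v ∧ E A u v))
      cover : edges₂ A ≤ ∑ (λ j → pairs (E A) (class j))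
      cover = begin
        edges₂ A                                 ≤⟨ ∑∑-mono (λ u v → ≤-trans (𝟙-mono {E A u v} {class (c u) u ∧ (class (c u) v ∧ E A u v)} (λ e → ∧-true⁺ (==-true⁺ {i = c u} refl) (∧-true⁺ (==-true⁺ (sym (within e))) e))) (∑-single (λ j → T j u v) (c u))) ⟩
        ∑ (λ u → ∑ λ v → ∑ λ j → T j u v)        ≡⟨ ∑-cong {n} (λ u → ∑-comm (λ v j → T j u v)) ⟩
        ∑ (λ u → ∑ λ j → ∑ λ v → T j u v)        ≡⟨ ∑-comm (λ u j → ∑ λ v → T j u v) ⟩
        ∑ (λ j → pairs (E A) (class j))          ∎

-- Cones and disjoint copies

cone : ∀ {h} → Adj h → Adj (suc h)
cone A zero zero = false
cone A zero (suc j) = true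
cone A (suc i) zero = true
cone A (suc i) (suc j) = A i j

E-cone : ∀ {h} (A : Adj h) i j → E (cone A) (suc i) (suc j) ≡ E A i j
E-cone A i j = cong (λ b → not b ∧ (A i j ∨ A j i))
  (⇔⇒≡ {suc i == suc j} (λ p → ==-true⁺ (sucF-injective (==-true⁻ p))) (λ p → ==-true⁺ (cong suc (==-true⁻ p))))

edges₂-cone : ∀ {h} (A : Adj h) → edges₂ (cone A) ≡ edges₂ A + 2 * h
edges₂-cone {h} A = begin
  ∑ {h} (λ j → 1) + ∑ (λ i → 1 + ∑ λ j → 𝟙 (E (cone A) (suc i) (suc j)))
    ≡⟨ cong₂ _+_ (count-true h) (∑-cong {h} λ i → cong suc (∑-cong {h} λ j → cong 𝟙 (E-cone A i j))) ⟩
  h + ∑ (λ i → 1 + ∑ λ j → 𝟙 (E A i j))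
    ≡⟨ cong (h +_) (trans (∑-distrib-+ (λ i → 1) (λ i → ∑ λ j → 𝟙 (E A i j))) (cong (_+ edges₂ A) (count-true h))) ⟩
  h + (h + edges₂ A)
    ≡⟨ arith h (edges₂ A) ⟩
  edges₂ A + 2 * h ∎
  where
  open ≡-Reasoning
  arith : ∀ a b → a + (a + b) ≡ b + 2 * a
  arith = solve-∀

copies : ∀ k {m} → Adj m → Adj (k * m)
copies k {m} A a b = (quotient {k} m a == quotient {k} m b) ∧ A (remainder {k} m a) (remainder {k} m b)

module _ (k : ℕ) {m} (A : Adj m) where

  quotient-combine : ∀ (i : Fin k) (x : Fin m) → quotient {k} m (combine i x) ≡ i
  quotient-combine i x = cong proj₁ (remQuot-combine i x)

  remainder-combine : ∀ (i : Fin k) (x : Fin m) → remainder {k} m (combine i x) ≡ x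
  remainder-combine i x = cong proj₂ (remQuot-combine i x)

  E-copies⁻ : ∀ {a b} → E (copies k A) a b ≡ true → quotient {k} m a ≡ quotient {k} m b
  E-copies⁻ {a} {b} e with proj₂ (E-true⁻ (copies k A) {a} {b} e)
  ... | inj₁ p = ==-true⁻ (proj₁ (∧-true⁻ p))
  ... | inj₂ p = sym (==-true⁻ (proj₁ (∧-true⁻ p)))

  E-copies : ∀ (i : Fin k) x y → E A x y ≡ E (copies k A) (combine i x) (combine i y)
  E-copies i x y = cong₂ (λ b c → not b ∧ c)
    (⇔⇒≡ {x == y} (λ p → ==-true⁺ (cong (combine i) (==-true⁻ p))) (λ p → ==-true⁺ (combine-injectiveʳ i x i y (==-true⁻ p))))
    (cong₂ _∨_ (adj x y) (adj y x))
    where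
    adj : ∀ x y → A x y ≡ copies k A (combine i x) (combine i y)
    adj x y = sym (cong₂ _∧_
      (==-true⁺ (trans (quotient-combine i x) (sym (quotient-combine i y))))
      (cong₂ A (remainder-combine i x) (remainder-combine i y)))

  edges₂-copies : k * edges₂ A ≤ edges₂ (copies k A)
  edges₂-copies = begin
    k * edges₂ A
      ≡⟨ ∑-const k (edges₂ A) ⟨
    ∑ {k} (λ i → edges₂ A)
      ≤⟨ ∑-mono {k} (λ i → ∑-mono λ x → ≤-trans
           (≤-reflexive (∑-cong {m} λ y → cong 𝟙 (E-copies i x y)))
           (≤-trans (∑-single (λ j → ∑ λ y → 𝟙 (E (copies k A) (combine i x) (combine j y))) i)
                    (≤-reflexive (sym (∑-combine k (λ b → 𝟙 (E (copies k A) (combine i x) b))))))) ⟩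
    ∑ {k} (λ i → ∑ λ x → ∑ λ b → 𝟙 (E (copies k A) (combine i x) b))
      ≡⟨ ∑-combine k (λ a → ∑ λ b → 𝟙 (E (copies k A) a b)) ⟨
    edges₂ (copies k A) ∎
    where open ≤-Reasoning

-- The classes are the copies and the apexes the cone vertices. A class without its apex is a copy
-- of A, so the hypothesis on the models in A is the bound required of the class.
cert-copies-cone : ∀ {U V h} (A : Adj h) → (∀ {h′} (H : Adj h′) → Model H A → V * (edges₂ H + 2 * h′) ≤ 2 * (U * suc h′)) →
                   ∀ k → Cert U V (copies k (cone A))
cert-copies-cone {h = h} A bnd k = record
  { k = k
  ; c = quotient {k} (suc h)
  ; apex = λ a → remainder {k} (suc h) a == zero
  ; within = E-copies⁻ k (cone A)
  ; unique = λ {a} {b} p q r → trans (sym (combine-remQuot {k} (suc h) a))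
      (trans (cong₂ (combine {k}) r (trans (==-true⁻ p) (sym (==-true⁻ q)))) (combine-remQuot {k} (suc h) b))
  ; bound = λ j H M supp → bnd H (model-restrict (λ x → combine j (suc x))
      (λ {x} {y} p → sucF-injective (combine-injectiveʳ j (suc x) j (suc y) p))
      (λ x y → trans (sym (E-cone A x y)) (E-copies k (cone A) j (suc x) (suc y))) M
      (λ {v} p → let (q , r) = supp p in image j v q r))
  }
  where
  image : ∀ j v → quotient {k} (suc h) v ≡ j → (remainder {k} (suc h) v == zero) ≡ false → ∃ λ x → combine j (suc x) ≡ v
  image j v q r with remainder {k} (suc h) v in e
  ... | suc x = x , trans (cong₂ (combine {k}) (sym q) (sym e)) (combine-remQuot {k} (suc h) v)

-- Exhaustive search

-- `P` need not be decidable: whenever it is not established for some x, the outcome `Q` is already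
-- there. The relation stands for equality, as functions that agree everywhere need not be equal.
Search : (X : Set) → (X → X → Set) → Set₁
Search X _∼_ = ∀ (P : X → Set) {Q : Set} → (∀ {x y} → x ∼ y → P x → P y) → (∀ x → P x ⊎ Q) → (∀ x → P x) ⊎ Q

search-Bool : Search Bool _≡_
search-Bool P resp h with h true | h false
... | inj₂ q | _ = inj₂ q
... | inj₁ _ | inj₂ q = inj₂ q
... | inj₁ p | inj₁ p′ = inj₁ λ where
  true → p
  false → p′

search-Fin : ∀ n → Search (Fin n) _≡_
search-Fin zero P resp h = inj₁ λ ()
search-Fin (suc n) P resp h with h zero | search-Fin n (P ∘ suc) (resp ∘ cong suc) (h ∘ suc)
... | inj₂ q | _ = inj₂ q
... | inj₁ _ | inj₂ q = inj₂ q
... | inj₁ p | inj₁ p′ = inj₁ λ where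
  zero → p
  (suc i) → p′ i

search-Fin-→ : ∀ {X _∼_} → (∀ {x} → x ∼ x) → Search X _∼_ → ∀ n → Search (Fin n → X) (λ f g → ∀ i → f i ∼ g i)
search-Fin-→ {X} {_∼_} ∼-refl S zero P resp h with h (λ ())
... | inj₁ p = inj₁ λ f → resp (λ ()) p
... | inj₂ q = inj₂ q
search-Fin-→ {X} {_∼_} ∼-refl S (suc n) P resp h = map₁ (λ p f → resp (cons-η f) (p (f zero) (f ∘ suc)))
  (S (λ x → ∀ g → P (cons x g)) (λ {x} r p g → resp (λ { zero → r ; (suc i) → ∼-refl }) (p g))
    λ x → search-Fin-→ ∼-refl S n (P ∘ cons x) (λ {f} {g} r → resp (λ { zero → ∼-refl ; (suc i) → r i })) (h ∘ cons x))
  where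
  cons : X → (Fin n → X) → Fin (suc n) → X
  cons x g zero = x
  cons x g (suc i) = g i
  cons-η : ∀ f i → cons (f zero) (f ∘ suc) i ∼ f i
  cons-η f zero = ∼-refl
  cons-η f (suc i) = ∼-refl

search-Adj : ∀ n → Search (Adj n) (λ A B → ∀ i j → A i j ≡ B i j)
search-Adj n = search-Fin-→ (λ _ → refl) (search-Fin-→ refl search-Bool n) n

-- Overfull graphs

pointwise⇒≈ : ∀ {n} {A B : Adj n} → (∀ i j → A i j ≡ B i j) → A ≈ B
pointwise⇒≈ h = ≈[ (λ i j → cong₂ (λ a b → not (i == j) ∧ (a ∨ b)) (h i j) (h j i)) ]

≈-sym : ∀ {n} {A B : Adj n} → A ≈ B → B ≈ A
≈-sym h = ≈[ (λ i j → sym (≈-at h i j)) ]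

module _ {n} {A B : Adj n} (A≈B : A ≈ B) where

  ≈-iso : Iso A B
  ≈-iso = proj₁ (Iso-refl A) , ≈-at A≈B

  deleteEdge-≈ : ∀ u v → deleteEdge u v A ≈ deleteEdge u v B
  deleteEdge-≈ u v = pointwise⇒≈ λ i j → cong (_∧ not ((i == u ∧ j == v) ∨ (i == v ∧ j == u))) (≈-at A≈B i j)

deleteVertex-≈ : ∀ {n} {A B : Adj (suc n)} → A ≈ B → ∀ v → deleteVertex v A ≈ deleteVertex v B
deleteVertex-≈ h v = pointwise⇒≈ λ i j → ≈-at h (punchIn v i) (punchIn v j)

contract-≈ : ∀ {n} {A B : Adj (suc n)} → A ≈ B → ∀ u v → contract u v A ≈ contract u v B
contract-≈ h u v = pointwise⇒≈ λ i j → let x = punchIn v i ; y = punchIn v j in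
  cong₂ _∨_ (≈-at h x y) (cong₂ _∨_ (cong ((x == u) ∧_) (≈-at h v y)) (cong ((y == u) ∧_) (≈-at h x v)))

≼-resp-≈ : ∀ {n G} {A B : Adj n} → A ≈ B → G ≼ (n , A) → G ≼ (n , B)
≼-resp-≈ h (iso (σ , e)) = iso (σ , λ i j → trans (e i j) (≈-at h _ _))
≼-resp-≈ h (delV v d) = delV v (≼-resp-≈ (deleteVertex-≈ h v) d)
≼-resp-≈ h (delE u v d) = delE u v (≼-resp-≈ (deleteEdge-≈ h u v) d)
≼-resp-≈ h (contr u v e d) = contr u v (trans (sym (≈-at h u v)) e) (≼-resp-≈ (contract-≈ h u v) d)

module Overfull (p W : ℕ) where

  Over : ∀ {h} → Adj h → Set
  Over {h} H = 2 * (p * suc h + W) ≤ W * edges₂ H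

  over? : ∀ {h} (H : Adj h) → Dec (Over H)
  over? H = _ ≤? _

  NoOver : ∀ {n} → Adj n → Set
  NoOver {n} A = ∀ {h} (H : Adj h) → (h , H) ≼ (n , A) → ¬ Over H

  -- Minimality is recorded for edge deletions, the operation that produces the base of the cone.
  Critical : ∀ {h} → Adj h → Set
  Critical H = Over H × (∀ u v → E H u v ≡ true → NoOver (deleteEdge u v H))

  HasCritical : ∀ {n} → Adj n → Set
  HasCritical {n} A = ∃₂ λ h (H : Adj h) → (h , H) ≼ (n , A) × Critical H

  Over-iso : ∀ {n} (A B : Adj n) → Iso A B → Over A → Over B
  Over-iso {n} A B i o = subst (λ z → 2 * (p * suc n + W) ≤ W * z) (edges₂-iso {A = A} {B} i) o

  -- `delE` may delete a pair that is not an edge. This leaves the graph unchanged only up to `≈`,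
  -- and the induction runs over the derivation of the minor; hence the statement for all B with A ≈
  -- B.
  noOver-step : ∀ {n} (A : Adj (suc n)) → ¬ Over A → (∀ v → NoOver (deleteVertex v A)) →
                (∀ u v → E A u v ≡ true → NoOver (contract u v A)) →
                (∀ u v → E A u v ≡ true → NoOver (deleteEdge u v A)) →
                ∀ B → A ≈ B → NoOver B
  noOver-step A ¬o hV hC hE B A≈B H (iso i) o = ¬o (Over-iso B A (≈-iso (≈-sym A≈B)) (Over-iso H B i o))
  noOver-step A ¬o hV hC hE B A≈B H (delV v d) = hV v H (≼-resp-≈ (deleteVertex-≈ (≈-sym A≈B) v) d)
  noOver-step A ¬o hV hC hE B A≈B H (contr u v e d) =
    hC u v (trans (≈-at A≈B u v) e) H (≼-resp-≈ (contract-≈ (≈-sym A≈B) u v) d)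
  noOver-step A ¬o hV hC hE B A≈B H (delE u v d) with true? (E A u v)
  ... | yes e = hE u v e H (≼-resp-≈ (deleteEdge-≈ (≈-sym A≈B) u v) d)
  ... | no ¬e = noOver-step A ¬o hV hC hE (deleteEdge u v B) same H d
    where
    ¬B : ∀ {i j} → E B i j ≡ true → i ≡ u → j ≡ v → ⊥
    ¬B e refl refl = ¬e (trans (≈-at A≈B u v) e)
    same : A ≈ deleteEdge u v B
    same = ≈[ (λ i j → ⇔⇒≡ {b = E (deleteEdge u v B) i j}
      (λ e → let e′ = trans (sym (≈-at A≈B i j)) e in
        E-deleteEdge⁺ u v B e′ (λ (r , s) → ¬B e′ r s) (λ (r , s) → ¬B (E-sym B e′) s r))
      (λ e → trans (≈-at A≈B i j) (proj₁ (E-deleteEdge⁻ u v B {i} {j} e)))) ]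

  noOver-zero : (A : Adj 0) → ¬ Over A → NoOver A
  noOver-zero A ¬o H (iso i) o = ¬o (Over-iso H A i o)

  -- All minors reached in one step are searched. If none of them has an overfull minor, A decides
  -- the matter: it is critical if overfull, and otherwise has no overfull minor at all. So
  -- `NoOver`, a statement about infinitely many derivations, need never be tested directly.
  findStep : ∀ {n} (A : Adj (suc n)) → (∀ (B : Adj n) → NoOver B ⊎ HasCritical B) →
             (∀ u v → E A u v ≡ true → NoOver (deleteEdge u v A) ⊎ HasCritical (deleteEdge u v A)) →
             NoOver A ⊎ HasCritical A
  findStep {n} A smaller sparser
    with search-Fin (suc n) (λ v → NoOver (deleteVertex v A)) (λ { refl p {h} → p {h} })
           (λ v → map₂ (λ (h , H , d , c) → h , H , delV v d , c) (smaller (deleteVertex v A)))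
  ... | inj₂ q = inj₂ q
  ... | inj₁ hV
    with search-Fin (suc n) (λ u → ∀ v → E A u v ≡ true → NoOver (contract u v A)) (λ { refl p → p })
           (λ u → search-Fin (suc n) (λ v → E A u v ≡ true → NoOver (contract u v A)) (λ { refl p → p })
             (λ v → contr-case u v (true? (E A u v))))
    where
    contr-case : ∀ u v → Dec (E A u v ≡ true) → (E A u v ≡ true → NoOver (contract u v A)) ⊎ HasCritical A
    contr-case u v (no ¬e) = inj₁ (⊥-elim ∘ ¬e)
    contr-case u v (yes e) with smaller (contract u v A)
    ... | inj₁ p = inj₁ λ _ {h} → p {h}
    ... | inj₂ (h , H , d , c) = inj₂ (h , H , contr u v e d , c)
  ...   | inj₂ q = inj₂ q
  ...   | inj₁ hC
    with search-Fin (suc n) (λ u → ∀ v → E A u v ≡ true → NoOver (deleteEdge u v A)) (λ { refl p → p })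
           (λ u → search-Fin (suc n) (λ v → E A u v ≡ true → NoOver (deleteEdge u v A)) (λ { refl p → p })
             (λ v → delE-case u v (true? (E A u v))))
    where
    delE-case : ∀ u v → Dec (E A u v ≡ true) → (E A u v ≡ true → NoOver (deleteEdge u v A)) ⊎ HasCritical A
    delE-case u v (no ¬e) = inj₁ (⊥-elim ∘ ¬e)
    delE-case u v (yes e) with sparser u v e
    ... | inj₁ p = inj₁ λ _ {h} → p {h}
    ... | inj₂ (h , H , d , c) = inj₂ (h , H , delE u v d , c)
  ...     | inj₂ q = inj₂ q
  ...     | inj₁ hE with over? A
  ...       | yes o = inj₂ (suc n , A , iso (Iso-refl A) , o , hE)
  ...       | no ¬o = inj₁ (noOver-step A ¬o hV hC hE A ≈[ (λ _ _ → refl) ])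

  findSuc : ∀ {n} → (∀ (B : Adj n) → NoOver B ⊎ HasCritical B) →
            ∀ fuel (A : Adj (suc n)) → edges₂ A ≤ fuel → NoOver A ⊎ HasCritical A
  findSuc smaller zero A le = findStep A smaller λ u v e → ⊥-elim (n≮0 (≤-trans (edges₂-deleteEdge u v A e) le))
  findSuc smaller (suc fuel) A le = findStep A smaller λ u v e →
    findSuc smaller fuel (deleteEdge u v A) (s≤s⁻¹ (≤-trans (edges₂-deleteEdge u v A e) le))

  findCritical : ∀ n (A : Adj n) → NoOver A ⊎ HasCritical A
  findCritical zero A with over? A
  ... | yes o = inj₂ (0 , A , iso (Iso-refl A) , o , λ ())
  ... | no ¬o = inj₁ (noOver-zero A ¬o)
  findCritical (suc n) A = findSuc (findCritical n) (edges₂ A) A ≤-refl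

  SmallOver : ℕ → ∀ {n} → Adj n → Set
  SmallOver K A = ∃₂ λ h (H : Adj h) → h ≤ K × Over H × Model H A

  BigCritical : ℕ → Set
  BigCritical K = ∃₂ λ h (H : Adj h) → K < h × Critical H

  smallOver-or-critical : ∀ K {n} (A : Adj n) → Over A → SmallOver K A ⊎ BigCritical K
  smallOver-or-critical K A o with findCritical _ A
  ... | inj₁ none = ⊥-elim (none A (iso (Iso-refl A)) o)
  ... | inj₂ (h , H , d , c) with h ≤? K
  ...   | yes h≤K = inj₁ (h , H , h≤K , proj₁ c , ≼⇒Model d)
  ...   | no h≰K = inj₂ (h , H , ≰⇒> h≰K , c)

  -- The alternative for a single graph is collected over the finitely many relations of each size,
  -- examined by `search-Adj`.
  dichotomy : ∀ K n → (∀ {s} → s < n → (A : Adj s) → Over A → SmallOver K A) ⊎ BigCritical K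
  dichotomy K zero = inj₁ λ ()
  dichotomy K (suc n) with dichotomy K n
  ... | inj₂ q = inj₂ q
  ... | inj₁ small with search-Adj n (λ A → Over A → SmallOver K A) resp alternatives
    where
    resp : ∀ {A B : Adj n} → (∀ i j → A i j ≡ B i j) → (Over A → SmallOver K A) → Over B → SmallOver K B
    resp {A} {B} A≗B s o =
      let A≈B = pointwise⇒≈ A≗B
          (h , H , h≤K , oH , M) = s (Over-iso B A (≈-iso (≈-sym A≈B)) o)
      in h , H , h≤K , oH , model-mono (λ {i} {j} e → trans (sym (≈-at A≈B i j)) e) M
    alternatives : ∀ A → (Over A → SmallOver K A) ⊎ BigCritical K
    alternatives A with over? A
    ... | yes o = map₁ (λ s _ → s) (smallOver-or-critical K A o)
    ... | no ¬o = inj₁ (⊥-elim ∘ ¬o)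
  ...   | inj₂ q = inj₂ q
  ...   | inj₁ here = inj₁ λ {s} s<1+n A o → case m≤n⇒m<n∨m≡n (s≤s⁻¹ s<1+n) of λ where
    (inj₁ s<n) → small s<n A o
    (inj₂ refl) → here A o

edges₂-deleteEdge-≥ : ∀ {n} u v (A : Adj n) → edges₂ A ≤ edges₂ (deleteEdge u v A) + 2
edges₂-deleteEdge-≥ {n} u v A = begin
  edges₂ A                                                       ≤⟨ ∑∑-mono pointwise ⟩
  ∑ (λ i → ∑ λ j → X i j + (Y u v i j + Y v u i j))              ≡⟨ ∑∑-+ X (λ i j → Y u v i j + Y v u i j) ⟩
  edges₂ (deleteEdge u v A) + ∑ (λ i → ∑ λ j → Y u v i j + Y v u i j)
    ≡⟨ cong (edges₂ (deleteEdge u v A) +_) (∑∑-+ (Y u v) (Y v u)) ⟩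
  edges₂ (deleteEdge u v A) + (∑ (λ i → ∑ (Y u v i)) + ∑ (λ i → ∑ (Y v u i)))
    ≤⟨ ≤-refl {edges₂ (deleteEdge u v A)} ⊕ (single u v ⊕ single v u) ⟩
  edges₂ (deleteEdge u v A) + 2 ∎
  where
  open ≤-Reasoning
  X : Fin n → Fin n → ℕ
  X i j = 𝟙 (E (deleteEdge u v A) i j)
  Y : Fin n → Fin n → Fin n → Fin n → ℕ
  Y a b i j = 𝟙 (i == a) * 𝟙 (j == b)
  single : ∀ a b → ∑ (λ i → ∑ (Y a b i)) ≤ 1
  single a b = begin
    ∑ (λ i → ∑ (Y a b i))                      ≡⟨ ∑-cong {n} (λ i → ∑-*ˡ (𝟙 (i == a)) (λ j → 𝟙 (j == b))) ⟩
    ∑ (λ i → 𝟙 (i == a) * count (_== b))       ≤⟨ ∑-mono (λ i → 𝟙 (i == a) ⊙ count-== b) ⟩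
    ∑ (λ i → 𝟙 (i == a) * 1)                   ≡⟨ ∑-cong {n} (λ i → *-identityʳ (𝟙 (i == a))) ⟩
    count (_== a)                              ≤⟨ count-== a ⟩
    1                                          ∎
  pointwise : ∀ i j → 𝟙 (E A i j) ≤ X i j + (Y u v i j + Y v u i j)
  pointwise i j with true? (E A i j)
  ... | no ¬e = ≤-trans (≤-reflexive (cong 𝟙 (≢true⇒false ¬e))) z≤n
  ... | yes e = ≤-trans (𝟙≤1 (E A i j)) (cases ((i ≟F u) ×-dec (j ≟F v)) ((i ≟F v) ×-dec (j ≟F u)))
    where
    Y≡1 : ∀ {a b} → i ≡ a → j ≡ b → 1 ≤ Y a b i j
    Y≡1 {a} {b} p q = ≤-reflexive (sym (cong₂ (λ x y → 𝟙 x * 𝟙 y) (==-true⁺ {i = i} {a} p) (==-true⁺ {i = j} {b} q)))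
    cases : Dec (i ≡ u × j ≡ v) → Dec (i ≡ v × j ≡ u) → 1 ≤ X i j + (Y u v i j + Y v u i j)
    cases (yes (p , q)) _ = ≤-trans (Y≡1 p q) (≤-trans (m≤m+n _ _) (m≤n+m _ (X i j)))
    cases (no _) (yes (p , q)) = ≤-trans (Y≡1 p q) (≤-trans (m≤n+m _ (Y u v i j)) (m≤n+m _ (X i j)))
    cases (no p) (no q) = ≤-trans (≤-reflexive (sym (𝟙-true (E-deleteEdge⁺ u v A {i} {j} e p q)))) (m≤m+n (X i j) _)

-- Growing balls, connecting trees and clique models

complete : ∀ k → Adj k
complete k _ _ = true

-- Growth is measured against the size `b₀` of an initial ball: a layer with b < l f has at least b₀
-- / l vertices, so l layers double the ball.
growth-step : ∀ l s b₀ b b′ f → b + f ≤ b′ → (l + s) * b₀ ≤ l * b → b₀ ≤ b → suc b ≤ l * f → (l + suc s) * b₀ ≤ l * b′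
growth-step l s b₀ b b′ f p q r t = lin (l ⊙ p ⊕ q ⊕ r ⊕ t) 1 (solve (l ∷ s ∷ b₀ ∷ b ∷ b′ ∷ f ∷ []))

double-* : ∀ l b → l * (2 * b) ≡ (l + l) * b
double-* = solve-∀

halves-sum : ∀ r y z → r < 2 * y → r < 2 * z → y + z ≤ r → r + r < r + r
halves-sum r y z p q s = lin (p ⊕ q ⊕ 2 ⊙ s) 1 (solve (r ∷ y ∷ z ∷ []))

module _ {n} (A : Adj n) where

  frontier : (R Y : Fin n → Bool) → Fin n → Bool
  frontier R Y i = not (Y i) ∧ (R i ∧ anyF (λ j → Y j ∧ E A j i))

  grow : (R Y : Fin n → Bool) → Fin n → Bool
  grow R Y i = Y i ∨ frontier R Y i

  frontier⁻ : ∀ R Y {i} → frontier R Y i ≡ true → Y i ≡ false × R i ≡ true × ∃ λ j → Y j ≡ true × E A j i ≡ true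
  frontier⁻ R Y {i} h =
    let (p , q) = ∧-true⁻ {not (Y i)} h
        (r , s) = ∧-true⁻ {R i} q
        (j , t) = anyF⁻ (λ j → Y j ∧ E A j i) s
    in not-true⁻ p , r , j , ∧-true⁻ t

  frontier⁺ : ∀ R Y {i j} → Y i ≡ false → R i ≡ true → Y j ≡ true → E A j i ≡ true → frontier R Y i ≡ true
  frontier⁺ R Y {i} {j} p q r s = ∧-true⁺ (not-true⁺ p) (∧-true⁺ q (anyF⁺ (λ j → Y j ∧ E A j i) j (∧-true⁺ r s)))

  count-grow : ∀ R Y → count Y + count (frontier R Y) ≤ count (grow R Y)
  count-grow R Y = count-⊎ {P = Y} {frontier R Y} {grow R Y} (λ i → ∨-true⁺ˡ) (λ i → ∨-true⁺ʳ {Y i})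
    (λ i p q → true≢false p (proj₁ (frontier⁻ R Y q)))

  ball : (R : Fin n → Bool) → Fin n → ℕ → Fin n → Bool
  ball R y zero = _== y
  ball R y (suc r) = grow R (ball R y r)

  module _ (R : Fin n → Bool) (y : Fin n) (y∈R : R y ≡ true) where

    ball⊆ : ∀ r i → ball R y r i ≡ true → R i ≡ true
    ball⊆ zero i p = subst (λ z → R z ≡ true) (sym (==-true⁻ p)) y∈R
    ball⊆ (suc r) i p with ∨-true⁻ {ball R y r i} p
    ... | inj₁ q = ball⊆ r i q
    ... | inj₂ q = proj₁ (proj₂ (frontier⁻ R (ball R y r) q))

    centre∈ball : ∀ r → ball R y r y ≡ true
    centre∈ball zero = ==-true⁺ {i = y} refl
    centre∈ball (suc r) = ∨-true⁺ˡ (centre∈ball r)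

    ball-nonempty : ∀ r → 1 ≤ count (ball R y r)
    ball-nonempty r = count-pos {P = ball R y r} y (centre∈ball r)

    ball-connected : ∀ r {i} → ball R y r i ≡ true → Path A (λ w → ball R y r w ≡ true) i y
    ball-connected zero p = subst (λ z → Path A _ z y) (sym (==-true⁻ p)) (stop (==-true⁺ {i = y} refl))
    ball-connected (suc r) {i} p with ∨-true⁻ {ball R y r i} p
    ... | inj₁ q = path-map id (λ {w} → ∨-true⁺ˡ) id (ball-connected r q)
    ... | inj₂ q = let (_ , _ , j , s , t) = frontier⁻ R (ball R y r) q in
      step p (E-sym A t) (path-map id (λ {w} → ∨-true⁺ˡ) id (ball-connected r s))

    -- Unless some ball has a small frontier, l layers double it.
    module _ (l : ℕ) where

      Stop : ℕ → Set
      Stop r = count R < 2 * count (ball R y r) ⊎ l * count (frontier R (ball R y r)) ≤ count (ball R y r)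

      stop? : ∀ r → Dec (Stop r)
      stop? r = (_ <? _) ⊎-dec (_ ≤? _)

      module _ {ρ} (never : ∀ {r} → r < ρ → ¬ Stop r) where

        ball-step : ∀ r s → r + s ≤ ρ → (l + s) * count (ball R y r) ≤ l * count (ball R y (s + r)) ×
                                         count (ball R y r) ≤ count (ball R y (s + r))
        ball-step r zero _ = ≤-reflexive (cong (_* count (ball R y r)) (+-identityʳ l)) , ≤-refl
        ball-step r (suc s) le = growth-step l s b₀ b b′ f (count-grow R B) ih mono grows ,
                                 ≤-trans mono (≤-trans (m≤m+n b f) (count-grow R B))
          where
          B = ball R y (s + r)
          b₀ = count (ball R y r)
          b = count B
          b′ = count (grow R B)
          f = count (frontier R B)
          ih = proj₁ (ball-step r s (≤-trans (+-monoʳ-≤ r (n≤1+n s)) le))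
          mono = proj₂ (ball-step r s (≤-trans (+-monoʳ-≤ r (n≤1+n s)) le))
          grows : suc b ≤ l * f
          grows = ≰⇒> λ q → never (≤-trans (≤-reflexive (trans (cong suc (+-comm s r)) (sym (+-suc r s)))) le) (inj₂ q)

        ball-doubling : .{{_ : NonZero l}} → ∀ κ → κ * l ≤ ρ → 2 ^ κ ≤ count (ball R y (κ * l))
        ball-doubling zero _ = ball-nonempty 0
        ball-doubling (suc κ) le = *-cancelˡ-≤ l (≤-trans (l ⊙ (2 ⊙ ball-doubling κ (≤-trans (m≤n+m (κ * l) l) le)))
          (≤-trans (≤-reflexive (double-* l b)) (proj₁ (ball-step (κ * l) l (≤-trans (≤-reflexive (+-comm (κ * l) l)) le)))))
          where b = count (ball R y (κ * l))

  record Cut (R : Fin n → Bool) (l : ℕ) : Set where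
    field
      Y : Fin n → Bool
      Y⊆R : ∀ i → Y i ≡ true → R i ≡ true
      nonempty : 1 ≤ count Y
      half : 2 * count Y ≤ count R
      small : l * count (frontier R Y) ≤ count Y

  -- If no radius below κ l stopped the growth, the ball would reach 2 ^ κ vertices, more than R
  -- has.
  cut-or-large-ball : ∀ R l κ .{{_ : NonZero l}} → count R < 2 ^ κ → ∀ y → R y ≡ true →
                      Cut R l ⊎ (∃ λ r → r ≤ κ * l × count R < 2 * count (ball R y r))
  cut-or-large-ball R l κ R<2^κ y y∈R with anyUpTo? (stop? R y y∈R l) (κ * l)
  ... | yes (r , r< , inj₁ p) = inj₂ (r , <⇒≤ r< , p)
  ... | yes (r , r< , inj₂ p) with count R <? 2 * count (ball R y r)
  ...   | yes q = inj₂ (r , <⇒≤ r< , q)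
  ...   | no q = inj₁ record { Y = ball R y r ; Y⊆R = ball⊆ R y y∈R r ; nonempty = ball-nonempty R y y∈R r ; half = ≮⇒≥ q ; small = p }
  cut-or-large-ball R l κ R<2^κ y y∈R | no none = ⊥-elim (n≮n (count R) (≤-trans R<2^κ (≤-trans
    (ball-doubling R y y∈R l (λ {r} r< s → none (r , r< , s)) κ ≤-refl)
    (count-mono {P = ball R y (κ * l)} {R} (ball⊆ R y y∈R (κ * l))))))

  record Linked (R : Fin n → Bool) (y : Fin n) (T : Fin n → Bool) : Set where
    field
      T⊆R : ∀ i → T i ≡ true → R i ≡ true
      centre : T y ≡ true
      linked : ∀ {i} → T i ≡ true → Path A (λ w → T w ≡ true) i y

  insert : (Fin n → Bool) → Fin n → Fin n → Bool
  insert T v i = T i ∨ (i == v)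

  count-insert : ∀ T v → count (insert T v) ≤ suc (count T)
  count-insert T v = ≤-trans (count-∪ {P = T} {_== v} {insert T v} (λ i → ∨-true⁻))
    (≤-trans (≤-refl {count T} ⊕ count-== v) (≤-reflexive (+-comm (count T) 1)))

  attach : ∀ {R y T u v} → Linked R y T → T u ≡ true → E A u v ≡ true → R v ≡ true → Linked R y (insert T v)
  attach {R} {y} {T} {u} {v} L u∈T e v∈R = record
    { T⊆R = λ i p → case ∨-true⁻ {T i} p of λ where
        (inj₁ q) → T⊆R i q
        (inj₂ q) → subst (λ z → R z ≡ true) (sym (==-true⁻ q)) v∈R
    ; centre = ∨-true⁺ˡ centre
    ; linked = λ {i} p → case ∨-true⁻ {T i} p of λ where
        (inj₁ q) → old q
        (inj₂ q) → subst (λ z → Path A _ z y) (sym (==-true⁻ q))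
          (step (∨-true⁺ʳ {T v} (==-true⁺ {i = v} refl)) (E-sym A e) (old u∈T))
    }
    where
    open Linked L
    old : ∀ {i} → T i ≡ true → Path A (λ w → insert T v w ≡ true) i y
    old q = path-map id (λ {w} → ∨-true⁺ˡ) id (linked q)

  Extension : (R : Fin n → Bool) → Fin n → (T : Fin n → Bool) → ℕ → Fin n → Set
  Extension R y T d v = ∃ λ T′ → Linked R y T′ × (∀ i → T i ≡ true → T′ i ≡ true) × count T′ ≤ d + count T × T′ v ≡ true

  reach-out : ∀ {R y T} c → R c ≡ true → T c ≡ true → Linked R y T → ∀ r {v} → ball R c r v ≡ true → Extension R y T r v
  reach-out {T = T} c c∈R c∈T L zero {v} p = T , L , (λ _ → id) , ≤-refl , subst (λ z → T z ≡ true) (sym (==-true⁻ p)) c∈T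
  reach-out {R} {y} {T} c c∈R c∈T L (suc r) {v} p with ∨-true⁻ {ball R c r v} p
  ... | inj₁ q = let (T′ , L′ , sub , le , t) = reach-out c c∈R c∈T L r q in
    T′ , L′ , sub , ≤-trans le (n≤1+n _) , t
  ... | inj₂ q =
    let (_ , v∈R , j , j∈ , e) = frontier⁻ R (ball R c r) q
        (T′ , L′ , sub , le , t) = reach-out c c∈R c∈T L r j∈
    in insert T′ v , attach L′ t e v∈R , (λ i s → ∨-true⁺ˡ (sub i s)) , ≤-trans (count-insert T′ v) (s≤s le) ,
       ∨-true⁺ʳ {T′ v} (==-true⁺ {i = v} refl)

  -- Here the tree meets the ball at v and is led inwards to the centre, one vertex for each layer;
  -- `reach-out` leads it from the centre outwards.
  reach-back : ∀ {R y T} c → R c ≡ true → Linked R y T → ∀ r {v} → ball R c r v ≡ true → T v ≡ true → Extension R y T r c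
  reach-back {T = T} c c∈R L zero p t = T , L , (λ _ → id) , ≤-refl , subst (λ z → T z ≡ true) (==-true⁻ p) t
  reach-back {R} {y} {T} c c∈R L (suc r) {v} p t with ∨-true⁻ {ball R c r v} p
  ... | inj₁ q = let (T′ , L′ , sub , le , t′) = reach-back c c∈R L r q t in
    T′ , L′ , sub , ≤-trans le (n≤1+n _) , t′
  ... | inj₂ q =
    let (_ , _ , j , j∈ , e) = frontier⁻ R (ball R c r) q
        L′ = attach L t (E-sym A e) (ball⊆ R c c∈R r j j∈)
        (T″ , L″ , sub , le , t″) = reach-back c c∈R L′ r j∈ (∨-true⁺ʳ {T j} (==-true⁺ {i = j} refl))
    in T″ , L″ , (λ i s → sub i (∨-true⁺ˡ s)) ,
       ≤-trans le (≤-trans (+-monoʳ-≤ r (count-insert T j)) (≤-reflexive (+-suc r (count T)))) , t″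

  balls-meet : ∀ {R Y Z : Fin n → Bool} → (∀ i → Y i ≡ true → R i ≡ true) → (∀ i → Z i ≡ true → R i ≡ true) →
               count R < 2 * count Y → count R < 2 * count Z → ∃ λ i → Y i ≡ true × Z i ≡ true
  balls-meet {R} {Y} {Z} Y⊆ Z⊆ p q with any? (λ i → true? (Y i) ×-dec true? (Z i))
  ... | yes r = r
  ... | no none = ⊥-elim (n≮n (count R + count R) (halves-sum (count R) (count Y) (count Z) p q disj))
    where
    disj : count Y + count Z ≤ count R
    disj = count-⊎ {P = Y} {Z} {R} Y⊆ Z⊆ (λ i a b → none (i , a , b))

  module _ (R : Fin n → Bool) (l κ : ℕ) .{{_ : NonZero l}} (R<2^κ : count R < 2 ^ κ) where

    private ρ = κ * l

    -- Unless a cut appears, the balls around y and v both contain more than half of R and therefore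
    -- meet. The tree is led from y out to a common vertex and from there in to v.
    connect : ∀ {y T} → Linked R y T → ∀ v → R v ≡ true → Cut R l ⊎ Extension R y T (ρ + ρ) v
    connect {y} {T} L v v∈R with cut-or-large-ball R l κ R<2^κ y y∈R | cut-or-large-ball R l κ R<2^κ v v∈R
      where y∈R = Linked.T⊆R L y (Linked.centre L)
    ... | inj₁ c | _ = inj₁ c
    ... | inj₂ _ | inj₁ c = inj₁ c
    ... | inj₂ (r , r≤ , p) | inj₂ (s , s≤ , q) =
      let y∈R = Linked.T⊆R L y (Linked.centre L)
          (z , a , b) = balls-meet (ball⊆ R y y∈R r) (ball⊆ R v v∈R s) p q
          (T₁ , L₁ , sub₁ , le₁ , t₁) = reach-out y y∈R (Linked.centre L) L r a
          (T₂ , L₂ , sub₂ , le₂ , t₂) = reach-back v v∈R L₁ s b t₁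
      in inj₂ (T₂ , L₂ , (λ i → sub₂ i ∘ sub₁ i) ,
           ≤-trans le₂ (≤-trans (s≤ ⊕ ≤-trans le₁ (r≤ ⊕ ≤-refl {count T})) (≤-reflexive (sym (+-assoc ρ ρ (count T))))) , t₂)

    connect-all : ∀ {y} → R y ≡ true → ∀ k (τ : Fin k → Fin n) → (∀ j → R (τ j) ≡ true) →
                  Cut R l ⊎ (∃ λ T → Linked R y T × count T ≤ suc (k * (ρ + ρ)) × ∀ j → T (τ j) ≡ true)
    connect-all {y} y∈R zero τ τ∈R = inj₂ ((_== y) , record
      { T⊆R = λ i p → subst (λ z → R z ≡ true) (sym (==-true⁻ p)) y∈R
      ; centre = ==-true⁺ {i = y} refl
      ; linked = λ p → subst (λ z → Path A _ z y) (sym (==-true⁻ p)) (stop (==-true⁺ {i = y} refl))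
      } , count-== y , λ ())
    connect-all {y} y∈R (suc k) τ τ∈R with connect-all y∈R k (τ ∘ suc) (τ∈R ∘ suc)
    ... | inj₁ c = inj₁ c
    ... | inj₂ (T , L , le , t) with connect L (τ zero) (τ∈R zero)
    ...   | inj₁ c = inj₁ c
    ...   | inj₂ (T′ , L′ , sub , le′ , t′) = inj₂ (T′ , L′ ,
      ≤-trans le′ (≤-trans (+-monoʳ-≤ (ρ + ρ) le) (≤-reflexive (+-suc (ρ + ρ) (k * (ρ + ρ))))) ,
      λ { zero → t′ ; (suc j) → sub _ (t j) })

  E-complete : ∀ {k} {i j : Fin k} → i ≢ j → E (complete k) i j ≡ true
  E-complete {k} i≢j = E-true⁺ (complete k) i≢j (inj₁ refl)

  module _ {k} (M : Model (complete (suc k)) A) (j : Fin (suc k)) where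
    open Model M

    dropAux : Maybe (Fin (suc k)) → Maybe (Fin k)
    dropAux nothing = nothing
    dropAux (just i) with j ≟F i
    ... | yes _ = nothing
    ... | no j≢i = just (punchOut j≢i)

    dropAux⁻ : ∀ m {x} → dropAux m ≡ just x → m ≡ just (punchIn j x)
    dropAux⁻ (just i) p with j ≟F i
    dropAux⁻ (just i) refl | no j≢i = cong just (sym (punchIn-punchOut j≢i))

    dropAux⁺ : ∀ x → dropAux (just (punchIn j x)) ≡ just x
    dropAux⁺ x with j ≟F punchIn j x
    ... | yes e = ⊥-elim (punchInᵢ≢i j x (sym e))
    ... | no q = cong just (punchIn-injective j _ _ (punchIn-punchOut q))

    dropAux-total : ∀ i → i ≢ j → ∃ λ x → dropAux (just i) ≡ just x
    dropAux-total i i≢j with j ≟F i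
    ... | yes e = ⊥-elim (i≢j (sym e))
    ... | no j≢i = _ , refl

    drop-model : Model (complete k) A
    drop-model = record
      { f = dropAux ∘ f
      ; onto = λ x → let (v , p) = onto (punchIn j x) in v , lift v p
      ; conn = λ {u} {v} p q → path-map id (λ {w} → lift w) id (conn (dropAux⁻ (f u) p) (dropAux⁻ (f v) q))
      ; edge = λ {x} {y} e → let (u , v , p , q , r) = edge (E-complete (E⇒≢ (complete k) e ∘ punchIn-injective j _ _)) in
          u , v , lift u p , lift v q , r
      }
      where
      lift : ∀ v {x} → f v ≡ just (punchIn j x) → dropAux (f v) ≡ just x
      lift v {x} p = trans (cong dropAux p) (dropAux⁺ x)

  module _ {k} (M : Model (complete k) A) (R T : Fin n → Bool) {y} (L : Linked R y T)
           (fresh : ∀ {v x} → Model.f M v ≡ just x → R v ≡ false)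
           (touch : ∀ x → ∃₂ λ u v → Model.f M u ≡ just x × T v ≡ true × E A u v ≡ true) where
    open Model M
    open Linked L

    add-f : Fin n → Maybe (Fin (suc k))
    add-f v = if T v then just zero else mapM suc (f v)

    add-zero⁺ : ∀ v → T v ≡ true → add-f v ≡ just zero
    add-zero⁺ v p rewrite p = refl

    add-suc⁺ : ∀ v {x} → f v ≡ just x → add-f v ≡ just (suc x)
    add-suc⁺ v p rewrite p | ≢true⇒false {T v} (λ q → true≢false (T⊆R v q) (fresh p)) = refl

    add⁻ : ∀ v {x} → add-f v ≡ just x → (T v ≡ true × x ≡ zero) ⊎ (∃ λ x′ → x ≡ suc x′ × f v ≡ just x′)
    add⁻ v p with T v
    add⁻ v refl | true = inj₁ (refl , refl)
    add⁻ v p | false with f v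
    add⁻ v refl | false | just x = inj₂ (x , refl , refl)

    add-model : Model (complete (suc k)) A
    add-model = record
      { f = add-f
      ; onto = λ { zero → y , add-zero⁺ y centre ; (suc x) → let (v , p) = onto x in v , add-suc⁺ v p }
      ; conn = λ {u} {v} p q → conn′ (add⁻ u p) (add⁻ v q)
      ; edge = λ {x} {y} e → edge′ x y (E⇒≢ (complete (suc k)) e)
      }
      where
      conn′ : ∀ {u v x} → (T u ≡ true × x ≡ zero) ⊎ (∃ λ x′ → x ≡ suc x′ × f u ≡ just x′) →
              (T v ≡ true × x ≡ zero) ⊎ (∃ λ x′ → x ≡ suc x′ × f v ≡ just x′) → Path A (λ w → add-f w ≡ just x) u v
      conn′ (inj₁ (p , refl)) (inj₁ (q , refl)) =
        path-map id (λ {w} → add-zero⁺ w) id (path-trans (linked p) (path-sym (linked q)))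
      conn′ (inj₂ (x , refl , p)) (inj₂ (_ , refl , q)) = path-map id (λ {w} → add-suc⁺ w) id (conn p q)
      conn′ (inj₁ (_ , refl)) (inj₂ (_ , () , _))
      conn′ (inj₂ (_ , refl , _)) (inj₁ (_ , ()))
      edge′ : ∀ x y → x ≢ y → ∃₂ λ u v → add-f u ≡ just x × add-f v ≡ just y × E A u v ≡ true
      edge′ zero zero ne = ⊥-elim (ne refl)
      edge′ zero (suc y) ne = let (u , v , p , q , r) = touch y in v , u , add-zero⁺ v q , add-suc⁺ u p , E-sym A r
      edge′ (suc x) zero ne = let (u , v , p , q , r) = touch x in u , v , add-suc⁺ u p , add-zero⁺ v q , r
      edge′ (suc x) (suc y) ne = let (u , v , p , q , r) = edge (E-complete (ne ∘ cong suc)) in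
        u , v , add-suc⁺ u p , add-suc⁺ v q , r

-- Small separators in graphs without large clique minors

isAt : ∀ {k} → Fin k → Maybe (Fin k) → Bool
isAt x nothing = false
isAt x (just y) = y == x

isAt⁻ : ∀ {k} {x : Fin k} m → isAt x m ≡ true → m ≡ just x
isAt⁻ (just y) p = cong just (==-true⁻ p)

isAt⁺ : ∀ {k} {x : Fin k} m → m ≡ just x → isAt x m ≡ true
isAt⁺ (just y) p = ==-true⁺ (just-injective p)

half-positive : ∀ {v} r → v < 2 * r → 1 ≤ r
half-positive (suc r) _ = s≤s z≤n

balance-drop : ∀ x r v → x + r ≤ v → v < 2 * r → 4 * x ≤ 3 * v
balance-drop x r v p q = lin (4 ⊙ p ⊕ 2 ⊙ q) (v + 2) (solve (x ∷ r ∷ v ∷ []))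

-- The set X′ has at most (v - r) + r / 2 = v - r / 2 vertices, and r exceeds v / 2. This is the
-- origin of the fraction 3 / 4.
balance-cut : ∀ x′ x y r v → x′ ≤ x + y → x + r ≤ v → v < 2 * r → 2 * y ≤ r → 4 * x′ ≤ 3 * v
balance-cut x′ x y r v p q s t = lin (4 ⊙ p ⊕ 4 ⊙ q ⊕ s ⊕ 2 ⊙ t) 1 (solve (x′ ∷ x ∷ y ∷ r ∷ v ∷ []))

-- The separator of Plotkin, Rao and Smith: either a clique model with small branch sets can be
-- extended, or a set with small frontier can be cut off.  X is the part cut off so far, R the part not
-- yet processed, and S with the branch sets forms the separator; frontiers are paid for by X.
module Separator {n} (A : Adj n) (V : Fin n → Bool) (l κ t : ℕ) .{{_ : NonZero l}} (V<2^κ : count V < 2 ^ κ)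
                 (noClique : ∀ {k} → t ≤ k → Model (complete k) A → ⊥) where

  private
    ρ w : ℕ
    ρ = κ * l
    w = suc (t * (ρ + ρ))

  fibre : ∀ {k} → (Fin n → Maybe (Fin k)) → Fin k → Fin n → Bool
  fibre f x v = isAt x (f v)

  record State (k : ℕ) : Set where
    field
      X S R : Fin n → Bool
      M : Model (complete k) A
    open Model M public using (f)
    field
      X⊆V : ∀ v → X v ≡ true → V v ≡ true
      R⊆V : ∀ v → R v ≡ true → V v ≡ true
      f⊆V : ∀ {v x} → f v ≡ just x → V v ≡ true
      X∩R : ∀ v → X v ≡ true → R v ≡ true → ⊥
      fresh : ∀ {v x} → f v ≡ just x → R v ≡ false
      covered : ∀ v → V v ≡ true → X v ≡ true ⊎ R v ≡ true ⊎ S v ≡ true ⊎ ∃ λ x → f v ≡ just x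
      separated : ∀ {u v} → X u ≡ true → R v ≡ true → E A u v ≡ true → ⊥
      budget : l * count S ≤ count X
      fibres : ∀ x → count (fibre f x) ≤ w
      balance : 4 * count X ≤ 3 * count V

  open State

  initial : State 0
  initial = record
    { X = λ _ → false ; S = λ _ → false ; R = V
    ; M = record { f = λ _ → nothing ; onto = λ () ; conn = λ () ; edge = λ {x} → case x of λ () }
    ; X⊆V = λ _ () ; R⊆V = λ _ p → p ; f⊆V = λ () ; X∩R = λ _ () ; fresh = λ ()
    ; covered = λ _ p → inj₂ (inj₁ p) ; separated = λ ()
    ; budget = ≤-trans (≤-reflexive (trans (cong (l *_) (count-false n)) (*-zeroʳ l))) z≤n
    ; fibres = λ ()
    ; balance = ≤-trans (≤-reflexive (cong (4 *_) (count-false n))) z≤n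
    }

  -- A branch set without neighbours in R is already cut off, so it moves to X and enlarges the
  -- budget.
  dropState : ∀ {k} (s : State (suc k)) (j : Fin (suc k)) → count V < 2 * count (R s) →
              (∀ {u v} → f s u ≡ just j → R s v ≡ true → E A u v ≡ true → ⊥) → State k
  dropState s j large far = record
    { X = X′ ; S = S s ; R = R s ; M = drop-model A (M s) j
    ; X⊆V = X′⊆V
    ; R⊆V = R⊆V s
    ; f⊆V = λ {v} p → f⊆V s (dropAux⁻ A (M s) j (f s v) p)
    ; X∩R = X′∩R
    ; fresh = λ {v} p → fresh s (dropAux⁻ A (M s) j (f s v) p)
    ; covered = covered′
    ; separated = λ {u} p q e → case X′⁻ u p of λ where
        (inj₁ r) → separated s r q e
        (inj₂ r) → far r q e
    ; budget = ≤-trans (budget s) (count-mono {P = X s} {X′} (λ v → ∨-true⁺ˡ))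
    ; fibres = λ x → ≤-trans (count-mono {P = fibre (dropAux A (M s) j ∘ f s) x} {fibre (f s) (punchIn j x)}
        (λ v p → isAt⁺ (f s v) (dropAux⁻ A (M s) j (f s v) (isAt⁻ (dropAux A (M s) j (f s v)) p)))) (fibres s (punchIn j x))
    ; balance = balance-drop (count X′) (count (R s)) (count V)
        (count-⊎ {P = X′} {R s} {V} X′⊆V (R⊆V s) X′∩R) large
    }
    where
    X′ : Fin n → Bool
    X′ v = X s v ∨ fibre (f s) j v
    X′⁻ : ∀ v → X′ v ≡ true → X s v ≡ true ⊎ f s v ≡ just j
    X′⁻ v p = map₂ (isAt⁻ (f s v)) (∨-true⁻ {X s v} p)
    X′⊆V : ∀ v → X′ v ≡ true → V v ≡ true
    X′⊆V v p = [ X⊆V s v , f⊆V s ]′ (X′⁻ v p)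
    X′∩R : ∀ v → X′ v ≡ true → R s v ≡ true → ⊥
    X′∩R v p q = case X′⁻ v p of λ where
      (inj₁ r) → X∩R s v r q
      (inj₂ r) → true≢false q (fresh s r)
    covered′ : ∀ v → V v ≡ true → X′ v ≡ true ⊎ R s v ≡ true ⊎ S s v ≡ true ⊎ ∃ λ x → dropAux A (M s) j (f s v) ≡ just x
    covered′ v p with covered s v p
    ... | inj₁ q = inj₁ (∨-true⁺ˡ q)
    ... | inj₂ (inj₁ q) = inj₂ (inj₁ q)
    ... | inj₂ (inj₂ (inj₁ q)) = inj₂ (inj₂ (inj₁ q))
    ... | inj₂ (inj₂ (inj₂ (i , q))) with i ≟F j
    ...   | yes refl = inj₁ (∨-true⁺ʳ {X s v} (isAt⁺ (f s v) q))
    ...   | no i≢j = let (x , r) = dropAux-total A (M s) j i i≢j in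
      inj₂ (inj₂ (inj₂ (x , trans (cong (dropAux A (M s) j) q) r)))

  cutState : ∀ {k} (s : State k) → count V < 2 * count (R s) → (c : Cut A (R s) l) → State k
  cutState s large c = record
    { X = X′ ; S = S′ ; R = R′ ; M = M s
    ; X⊆V = λ v p → [ X⊆V s v , (λ q → R⊆V s v (Y⊆R v q)) ]′ (∨-true⁻ {X s v} p)
    ; R⊆V = λ v p → R⊆V s v (proj₁ (R′⁻ p))
    ; f⊆V = f⊆V s
    ; X∩R = λ v p q → case ∨-true⁻ {X s v} p of λ where
        (inj₁ r) → X∩R s v r (proj₁ (R′⁻ q))
        (inj₂ r) → proj₂ (R′⁻ q) (∨-true⁺ˡ r)
    ; fresh = λ {v} p → ≢true⇒false λ q → true≢false (proj₁ (R′⁻ q)) (fresh s p)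
    ; covered = covered′
    ; separated = λ {u} {v} p q e → case ∨-true⁻ {X s u} p of λ where
        (inj₁ r) → separated s r (proj₁ (R′⁻ q)) e
        (inj₂ r) → proj₂ (R′⁻ q) (∨-true⁺ʳ {Y v} (frontier⁺ A (R s) Y
          (≢true⇒false λ y → proj₂ (R′⁻ q) (∨-true⁺ˡ y)) (proj₁ (R′⁻ q)) r e))
    ; budget = ≤-trans (l ⊙ count-∪ {P = S s} {Fr} {S′} (λ v → ∨-true⁻ {S s v}))
        (≤-trans (≤-reflexive (*-distribˡ-+ l (count (S s)) (count Fr))) (≤-trans (budget s ⊕ small)
          (count-⊎ {P = X s} {Y} {X′} (λ v → ∨-true⁺ˡ) (λ v → ∨-true⁺ʳ {X s v}) (λ v p q → X∩R s v p (Y⊆R v q)))))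
    ; fibres = fibres s
    ; balance = balance-cut (count X′) (count (X s)) (count Y) (count (R s)) (count V)
        (count-∪ {P = X s} {Y} {X′} (λ v → ∨-true⁻ {X s v}))
        (count-⊎ {P = X s} {R s} {V} (X⊆V s) (R⊆V s) (X∩R s)) large half
    }
    where
    open Cut c
    Fr X′ S′ R′ : Fin n → Bool
    Fr = frontier A (R s) Y
    X′ v = X s v ∨ Y v
    S′ v = S s v ∨ Fr v
    R′ v = R s v ∧ not (grow A (R s) Y v)
    R′⁻ : ∀ {v} → R′ v ≡ true → R s v ≡ true × ¬ (grow A (R s) Y v ≡ true)
    R′⁻ {v} p = let (q , r) = ∧-true⁻ {R s v} p in q , λ g → true≢false g (not-true⁻ r)
    covered′ : ∀ v → V v ≡ true → X′ v ≡ true ⊎ R′ v ≡ true ⊎ S′ v ≡ true ⊎ ∃ λ x → f s v ≡ just x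
    covered′ v p with covered s v p
    ... | inj₁ q = inj₁ (∨-true⁺ˡ q)
    ... | inj₂ (inj₂ (inj₁ q)) = inj₂ (inj₂ (inj₁ (∨-true⁺ˡ q)))
    ... | inj₂ (inj₂ (inj₂ q)) = inj₂ (inj₂ (inj₂ q))
    ... | inj₂ (inj₁ q) with true? (Y v) | true? (Fr v)
    ...   | yes y | _ = inj₁ (∨-true⁺ʳ {X s v} y)
    ...   | no _ | yes z = inj₂ (inj₂ (inj₁ (∨-true⁺ʳ {S s v} z)))
    ...   | no y | no z = inj₂ (inj₁ (∧-true⁺ q (not-true⁺ (≢true⇒false λ g → [ y , z ]′ (∨-true⁻ {Y v} g)))))

  addState : ∀ {k} (s : State k) {y} (T : Fin n → Bool) → Linked A (R s) y T → count T ≤ w →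
             (∀ x → ∃₂ λ u v → f s u ≡ just x × T v ≡ true × E A u v ≡ true) → State (suc k)
  addState s {y} T L T≤w touch = record
    { X = X s ; S = S s ; R = R′ ; M = add-model A (M s) (R s) T L (fresh s) touch
    ; X⊆V = X⊆V s
    ; R⊆V = λ v p → R⊆V s v (proj₁ (R′⁻ p))
    ; f⊆V = λ {v} p → case add⁻′ v p of λ where
        (inj₁ (q , _)) → R⊆V s v (Linked.T⊆R L v q)
        (inj₂ (_ , _ , q)) → f⊆V s q
    ; X∩R = λ v p q → X∩R s v p (proj₁ (R′⁻ q))
    ; fresh = λ {v} p → ≢true⇒false λ q → case add⁻′ v p of λ where
        (inj₁ (r , _)) → proj₂ (R′⁻ q) r
        (inj₂ (_ , _ , r)) → true≢false (proj₁ (R′⁻ q)) (fresh s r)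
    ; covered = covered′
    ; separated = λ p q e → separated s p (proj₁ (R′⁻ q)) e
    ; budget = budget s
    ; fibres = λ where
        zero → ≤-trans (count-mono {P = fibre f′ zero} {T} (λ v p → case add⁻′ v (isAt⁻ (f′ v) p) of λ where
          (inj₁ (q , _)) → q
          (inj₂ (_ , () , _)))) T≤w
        (suc x) → ≤-trans (count-mono {P = fibre f′ (suc x)} {fibre (f s) x} (λ v p → case add⁻′ v (isAt⁻ (f′ v) p) of λ where
          (inj₁ (_ , ()))
          (inj₂ (_ , refl , q)) → isAt⁺ (f s v) q)) (fibres s x)
    ; balance = balance s
    }
    where
    R′ : Fin n → Bool
    R′ v = R s v ∧ not (T v)
    f′ = add-f A (M s) (R s) T L (fresh s) touch
    add⁻′ = add⁻ A (M s) (R s) T L (fresh s) touch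
    R′⁻ : ∀ {v} → R′ v ≡ true → R s v ≡ true × ¬ (T v ≡ true)
    R′⁻ {v} p = let (q , r) = ∧-true⁻ {R s v} p in q , λ g → true≢false g (not-true⁻ r)
    covered′ : ∀ v → V v ≡ true → X s v ≡ true ⊎ R′ v ≡ true ⊎ S s v ≡ true ⊎ ∃ λ x → f′ v ≡ just x
    covered′ v p with covered s v p
    ... | inj₁ q = inj₁ q
    ... | inj₂ (inj₂ (inj₁ q)) = inj₂ (inj₂ (inj₁ q))
    ... | inj₂ (inj₂ (inj₂ (x , q))) = inj₂ (inj₂ (inj₂ (suc x , add-suc⁺ A (M s) (R s) T L (fresh s) touch v q)))
    ... | inj₂ (inj₁ q) with true? (T v)
    ...   | yes r = inj₂ (inj₂ (inj₂ (zero , add-zero⁺ A (M s) (R s) T L (fresh s) touch v r)))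
    ...   | no r = inj₂ (inj₁ (∧-true⁺ q (not-true⁺ (≢true⇒false r))))

  -- A new branch set raises k by one but takes a vertex from R, hence the weight 2. Dropping a
  -- branch set keeps R and lowers k.
  measure : ∀ {k} → State k → ℕ
  measure {k} s = 2 * count (R s) + k

  shrink : ∀ {k} (s : State k) {k′} (s′ : State k′) i → k′ ≤ suc k → (∀ v → R s′ v ≡ true → R s v ≡ true) →
           R s i ≡ true → ¬ (R s′ i ≡ true) → measure s′ < measure s
  shrink {k} s {k′} s′ i k′≤ sub i∈ i∉ = shrink-arith (count (R s)) (count (R s′)) k k′ fewer k′≤
    where
    fewer : suc (count (R s′)) ≤ count (R s)
    fewer = ≤-trans (count-pos {P = _== i} i (==-true⁺ {i = i} refl) ⊕ ≤-refl {count (R s′)})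
      (count-⊎ {P = _== i} {R s′} {R s} (λ v p → subst (λ z → R s z ≡ true) (sym (==-true⁻ p)) i∈) sub
        (λ v p q → i∉ (subst (λ z → R s′ z ≡ true) (==-true⁻ p) q)))
    shrink-arith : ∀ r r′ k k′ → suc r′ ≤ r → k′ ≤ suc k → 2 * r′ + k′ < 2 * r + k
    shrink-arith r r′ k k′ p q = lin (2 ⊙ p ⊕ q) 0 (solve (r ∷ r′ ∷ k ∷ k′ ∷ []))

  Smaller : ∀ {k} → State k → Set
  Smaller s = ∃₂ λ k′ (s′ : State k′) → measure s′ < measure s

  advance : ∀ {k} (s : State k) → count V < 2 * count (R s) → Smaller s
  advance {k} s large with t ≤? k
  ... | yes t≤k = ⊥-elim (noClique t≤k (M s))
  ... | no t≰k with any? (λ j → ¬? (any? λ u → any? λ v → true? (fibre (f s) j u) ×-dec (true? (R s v) ×-dec true? (E A u v))))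
  advance {suc k} s large | no t≰k | yes (j , far) = k , s′ , +-monoʳ-< (2 * count (R s)) (n<1+n k)
    where s′ = dropState s j large λ {u} {v} p q e → far (u , v , isAt⁺ (f s u) p , q , e)
  advance {k} s large | no t≰k | no near = continue (connect-all A (R s) l κ R<2^κ y∈R k τ τ∈R)
    where
    R-nonempty : 1 ≤ count (R s)
    R-nonempty = half-positive (count (R s)) large
    y = proj₁ (count-pos⁻ {P = R s} R-nonempty)
    y∈R = proj₂ (count-pos⁻ {P = R s} R-nonempty)
    R<2^κ : count (R s) < 2 ^ κ
    R<2^κ = ≤-trans (s≤s (count-mono {P = R s} {V} (R⊆V s))) V<2^κ
    link : ∀ j → ∃₂ λ u v → fibre (f s) j u ≡ true × R s v ≡ true × E A u v ≡ true
    link j with any? (λ u → any? λ v → true? (fibre (f s) j u) ×-dec (true? (R s v) ×-dec true? (E A u v)))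
    ... | yes (u , v , p) = u , v , p
    ... | no p = ⊥-elim (near (j , p))
    -- Every branch set has a neighbour in R. A tree in R through one such neighbour of each is
    -- adjacent to all of them and becomes the next branch set.
    τ : Fin k → Fin n
    τ j = proj₁ (proj₂ (link j))
    τ∈R : ∀ j → R s (τ j) ≡ true
    τ∈R j = proj₁ (proj₂ (proj₂ (proj₂ (link j))))
    continue : Cut A (R s) l ⊎ (∃ λ T → Linked A (R s) y T × count T ≤ suc (k * (ρ + ρ)) × ∀ j → T (τ j) ≡ true) → Smaller s
    continue (inj₁ c) = let (i , i∈Y) = count-pos⁻ {P = Cut.Y c} (Cut.nonempty c) ; s′ = cutState s large c in
      k , s′ , shrink s s′ i (n≤1+n k) (λ v p → proj₁ (∧-true⁻ {R s v} p)) (Cut.Y⊆R c i i∈Y)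
        (λ p → true≢false (∨-true⁺ˡ {b = frontier A (R s) (Cut.Y c) i} i∈Y) (not-true⁻ (proj₂ (∧-true⁻ {R s i} p))))
    continue (inj₂ (T , L , T≤ , t∈)) = suc k , s′ , shrink s s′ y ≤-refl (λ v p → proj₁ (∧-true⁻ {R s v} p)) y∈R
        (λ p → true≢false (Linked.centre L) (not-true⁻ (proj₂ (∧-true⁻ {R s y} p))))
      where
      s′ = addState s T L (≤-trans T≤ (s≤s (*-monoˡ-≤ (ρ + ρ) (<⇒≤ (≰⇒> t≰k))))) λ x →
        let (u , v , p , q , e) = link x in u , v , isAt⁻ (f s u) p , t∈ x , e

  run : ∀ fuel {k} (s : State k) → measure s < fuel → ∃₂ λ k′ (s′ : State k′) → 2 * count (R s′) ≤ count V
  run (suc fuel) {k} s m< with 2 * count (R s) ≤? count V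
  ... | yes p = k , s , p
  ... | no p = let (_ , s′ , lt) = advance s (≰⇒> p) in run fuel s′ (≤-trans lt (s≤s⁻¹ m<))

  record Separation : Set where
    field
      V₁ V₂ : Fin n → Bool
      z : ℕ
      cover : ∀ {i j} → V i ≡ true → V j ≡ true → E A i j ≡ true →
              (V₁ i ≡ true × V₁ j ≡ true) ⊎ (V₂ i ≡ true × V₂ j ≡ true)
      sizes : count V₁ + count V₂ ≤ count V + z
      size₁ : 4 * count V₁ ≤ 3 * count V + 4 * z
      size₂ : 4 * count V₂ ≤ 3 * count V + 4 * z
      z-small : l * z ≤ count V + l * (t * w)

  separate : Separation
  separate with run (suc (measure initial)) initial ≤-refl
  ... | k , s , half = record
    { V₁ = V₁ ; V₂ = V₂ ; z = z
    ; cover = λ {i} {j} → cover {i} {j}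
    ; sizes = total-arith (count V₁) (count V₂) (count (R s)) (count V) z
        (count-⊎ {P = V₁} {R s} {V} (λ v p → proj₁ (∧-true⁻ {V v} p)) (R⊆V s)
          (λ v p q → true≢false q (not-true⁻ (proj₂ (∧-true⁻ {V v} p))))) V₂≤
    ; size₁ = size₁-arith (count V₁) (count (X s)) (count V) z V₁≤ (balance s)
    ; size₂ = size₂-arith (count V₂) (count (R s)) (count V) z V₂≤ half
    ; z-small = ≤-trans (≤-reflexive (*-distribˡ-+ l (count (S s)) (count U)))
        (≤-trans (budget s) (count-mono {P = X s} {V} (X⊆V s)) ⊕ l ⊙ U≤)
    }
    where
    -- The two parts overlap in what lies outside both X and R, and this is covered by S and the
    -- branch sets, whence `z`.
    V₁ V₂ U : Fin n → Bool
    V₁ v = V v ∧ not (R s v)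
    V₂ v = V v ∧ not (X s v)
    U v = is-just (f s v)
    z = count (S s) + count U
    cover : ∀ {i j} → V i ≡ true → V j ≡ true → E A i j ≡ true →
            (V₁ i ≡ true × V₁ j ≡ true) ⊎ (V₂ i ≡ true × V₂ j ≡ true)
    cover {i} {j} p q e with true? (R s i) | true? (R s j)
    ... | yes a | _ = inj₂ (∧-true⁺ p (not-true⁺ (≢true⇒false λ x → X∩R s i x a)) ,
                            ∧-true⁺ q (not-true⁺ (≢true⇒false λ x → separated s x a (E-sym A e))))
    ... | no _ | yes b = inj₂ (∧-true⁺ p (not-true⁺ (≢true⇒false λ x → separated s x b e)) ,
                               ∧-true⁺ q (not-true⁺ (≢true⇒false λ x → X∩R s j x b)))
    ... | no a | no b = inj₁ (∧-true⁺ p (not-true⁺ (≢true⇒false a)) , ∧-true⁺ q (not-true⁺ (≢true⇒false b)))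
    part-bound : ∀ (P Q : Fin n → Bool) → (∀ v → Q v ≡ true → P v ≡ true ⊎ S s v ≡ true ⊎ ∃ λ x → f s v ≡ just x) →
                 count Q ≤ count P + z
    part-bound P Q h = ≤-trans (count-∪ {P = P} {SU} {Q} (λ v q → split v (h v q)))
      (+-monoʳ-≤ (count P) (count-∪ {P = S s} {U} {SU} (λ v → ∨-true⁻ {S s v})))
      where
      SU : Fin n → Bool
      SU v = S s v ∨ U v
      split : ∀ v → P v ≡ true ⊎ S s v ≡ true ⊎ (∃ λ x → f s v ≡ just x) → P v ≡ true ⊎ SU v ≡ true
      split v (inj₁ p) = inj₁ p
      split v (inj₂ (inj₁ p)) = inj₂ (∨-true⁺ˡ p)
      split v (inj₂ (inj₂ (x , p))) = inj₂ (∨-true⁺ʳ {S s v} (cong is-just p))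
    V₁≤ : count V₁ ≤ count (X s) + z
    V₁≤ = part-bound (X s) V₁ λ v p → case covered s v (proj₁ (∧-true⁻ {V v} p)) of λ where
      (inj₁ q) → inj₁ q
      (inj₂ (inj₁ q)) → ⊥-elim (true≢false q (not-true⁻ (proj₂ (∧-true⁻ {V v} p))))
      (inj₂ (inj₂ q)) → inj₂ q
    V₂≤ : count V₂ ≤ count (R s) + z
    V₂≤ = part-bound (R s) V₂ λ v p → case covered s v (proj₁ (∧-true⁻ {V v} p)) of λ where
      (inj₁ q) → ⊥-elim (true≢false q (not-true⁻ (proj₂ (∧-true⁻ {V v} p))))
      (inj₂ q) → q
    k≤t : k ≤ t
    k≤t = case t ≤? k of λ where
      (yes t≤k) → ⊥-elim (noClique t≤k (M s))
      (no t≰k) → <⇒≤ (≰⇒> t≰k)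
    is-just⁻ : ∀ {X : Set} (m : Maybe X) → is-just m ≡ true → ∃ λ x → m ≡ just x
    is-just⁻ (just x) _ = x , refl
    U≤ : count U ≤ t * w
    U≤ = ≤-trans (∑-mono {n} λ v → single v (true? (U v))) (≤-trans (≤-reflexive (∑-comm (λ v x → 𝟙 (fibre (f s) x v))))
      (≤-trans (∑-≤const (fibres s)) (*-monoˡ-≤ w k≤t)))
      where
      single : ∀ v → Dec (U v ≡ true) → 𝟙 (U v) ≤ ∑ (λ x → 𝟙 (fibre (f s) x v))
      single v (no p) = ≤-trans (≤-reflexive (cong 𝟙 (≢true⇒false p))) z≤n
      single v (yes p) = let (x , q) = is-just⁻ (f s v) p in
        ≤-trans (𝟙-mono {U v} {fibre (f s) x v} (λ _ → isAt⁺ (f s v) q)) (∑-single (λ x → 𝟙 (fibre (f s) x v)) x)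
    total-arith : ∀ a b r v z → a + r ≤ v → b ≤ r + z → a + b ≤ v + z
    total-arith a b r v z p q = lin (p ⊕ q) 0 (solve (a ∷ b ∷ r ∷ v ∷ z ∷ []))
    size₁-arith : ∀ a x v z → a ≤ x + z → 4 * x ≤ 3 * v → 4 * a ≤ 3 * v + 4 * z
    size₁-arith a x v z p q = lin (4 ⊙ p ⊕ q) 0 (solve (a ∷ x ∷ v ∷ z ∷ []))
    size₂-arith : ∀ b r v z → b ≤ r + z → 2 * r ≤ v → 4 * b ≤ 3 * v + 4 * z
    size₂-arith b r v z p q = lin (4 ⊙ p ⊕ 2 ⊙ q) v (solve (b ∷ r ∷ v ∷ z ∷ []))

-- Dense pieces of bounded size

n<2^n : ∀ n → n < 2 ^ n
n<2^n zero = s≤s z≤n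
n<2^n (suc n) = ≤-trans (+-mono-≤ (m^n>0 2 n) (n<2^n n)) (≤-reflexive (cong (2 ^ n +_) (sym (+-identityʳ (2 ^ n)))))

-- The inequality (1 - 1 / (j + 1)) ^ p ≥ 1 - p / (j + 1), with d = j + 1 - p and denominators
-- cleared.
bernoulli : ∀ p j d → d + p ≡ suc j → suc j ^ p * d ≤ j ^ p * suc j
bernoulli zero j d e = ≤-reflexive (cong (_+ 0) (trans (sym (+-identityʳ d)) e))
bernoulli (suc p) j d e = begin
  suc j * a * d         ≡⟨ rearrange₁ (suc j) a d ⟩
  a * (suc j * d)       ≤⟨ a ⊙ (d≤j ⊕ ≤-refl {j * d}) ⟩
  a * (j + j * d)       ≡⟨ rearrange₂ a j d ⟩
  j * (a * suc d)       ≤⟨ j ⊙ bernoulli p j (suc d) (trans (sym (+-suc d p)) e) ⟩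
  j * (b * suc j)       ≡⟨ *-assoc j b (suc j) ⟨
  j * b * suc j         ∎
  where
  open ≤-Reasoning
  a = suc j ^ p
  b = j ^ p
  d≤j : d ≤ j
  d≤j = ≤-trans (m≤m+n d p) (≤-reflexive (suc-injective (trans (sym (+-suc d p)) e)))
  rearrange₁ : ∀ s a d → s * a * d ≡ a * (s * d)
  rearrange₁ = solve-∀
  rearrange₂ : ∀ a j d → a * (j + j * d) ≡ j * (a * suc d)
  rearrange₂ = solve-∀

pairs-∪ : ∀ {n} {R : Fin n → Fin n → Bool} {P P₁ P₂ : Fin n → Bool} →
          (∀ {i j} → P i ≡ true → P j ≡ true → R i j ≡ true →
             (P₁ i ≡ true × P₁ j ≡ true) ⊎ (P₂ i ≡ true × P₂ j ≡ true)) →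
          pairs R P ≤ pairs R P₁ + pairs R P₂
pairs-∪ {R = R} {P} {P₁} {P₂} h = ≤-trans (∑∑-mono pointwise)
  (≤-reflexive (∑∑-+ (λ i j → 𝟙 (P₁ i ∧ (P₁ j ∧ R i j))) (λ i j → 𝟙 (P₂ i ∧ (P₂ j ∧ R i j)))))
  where
  pointwise : ∀ i j → 𝟙 (P i ∧ (P j ∧ R i j)) ≤ 𝟙 (P₁ i ∧ (P₁ j ∧ R i j)) + 𝟙 (P₂ i ∧ (P₂ j ∧ R i j))
  pointwise i j = 𝟙-∪ λ p →
    let (a , q) = ∧-true⁻ {P i} p ; (b , c) = ∧-true⁻ {P j} q in
    case h a b c of λ where
      (inj₁ (a′ , b′)) → inj₁ (∧-true⁺ a′ (∧-true⁺ b′ c))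
      (inj₂ (a′ , b′)) → inj₂ (∧-true⁺ a′ (∧-true⁺ b′ c))

pairs≤count² : ∀ {n} (R : Fin n → Fin n → Bool) P → pairs R P ≤ count P * count P
pairs≤count² {n} R P = begin
  pairs R P                                ≤⟨ ∑∑-mono (λ i j → ≤-trans (𝟙-mono {P i ∧ (P j ∧ R i j)} {P i ∧ P j} (λ p →
                                                let (a , q) = ∧-true⁻ {P i} p in ∧-true⁺ a (proj₁ (∧-true⁻ {P j} q))))
                                                (≤-reflexive (𝟙-∧ (P i) (P j)))) ⟩
  ∑ (λ i → ∑ λ j → 𝟙 (P i) * 𝟙 (P j))      ≡⟨ ∑-cong {n} (λ i → trans (∑-*ˡ (𝟙 (P i)) (𝟙 ∘ P)) (*-comm (𝟙 (P i)) (count P))) ⟩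
  ∑ (λ i → count P * 𝟙 (P i))              ≡⟨ ∑-*ˡ (count P) (𝟙 ∘ P) ⟩
  count P * count P                        ∎
  where open ≤-Reasoning

-- Vertex sets of size at most j¹⁰ are split by separators with parameters l = j³ and 2 ^ κ > (j + 1)¹⁰.
-- Lowering the density threshold from α (j + 1) / (j + 2) to α j / (j + 1) pays for the separator
-- vertices, which are counted in both parts.

power-step : ∀ p j → 5 * p ≤ suc j → 4 * suc j ^ p ≤ 5 * j ^ p
power-step p j 5p≤ = go (suc j ∸ p) (m∸n+n≡m (≤-trans (m≤m+n p (4 * p)) 5p≤))
  where
  go : ∀ d → d + p ≡ suc j → 4 * suc j ^ p ≤ 5 * j ^ p
  go d e = *-cancelʳ-≤ _ _ (suc j) (arith d p (suc j) (suc j ^ p) (j ^ p) e (bernoulli p j d e) 5p≤)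
    where
    arith : ∀ d p s a b → d + p ≡ s → a * d ≤ b * s → 5 * p ≤ s → 4 * a * s ≤ 5 * b * s
    arith d p _ a b refl h q = lin (5 ⊙ h ⊕ a ⊙ q) 0 (solve (d ∷ p ∷ a ∷ b ∷ []))

abstract
  -- The exponent 10 leaves room above j ^ 8 = j ^ 3 * j ^ 5, the separator parameter times the
  -- bound on the branch sets. For this exponent the condition 5 * p ≤ suc j of `power-step` reads
  -- 49 ≤ j.
  scale : ℕ → ℕ
  scale j = j ^ 10

  scale-step : ∀ j → 49 ≤ j → 4 * scale (suc j) ≤ 5 * scale j
  scale-step j 49≤j = power-step 10 j (s≤s 49≤j)

  scale-≥ : ∀ j → j ≤ scale j
  scale-≥ zero = z≤n
  scale-≥ (suc j) = ≤-trans (≤-reflexive (sym (^-identityʳ (suc j)))) (^-monoʳ-≤ (suc j) {1} {10} (s≤s z≤n))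

  scale<2^ : ∀ j → scale j < 2 ^ (j * 10)
  scale<2^ j = ≤-trans (^-monoˡ-< 10 (n<2^n j)) (≤-reflexive (^-*-assoc 2 j 10))

  j⁸≤scale : ∀ j → 1 ≤ j → j ^ 8 ≤ scale j
  j⁸≤scale j 1≤j = ^-monoʳ-≤ j {{>-nonZero 1≤j}} {8} {10} (m≤m+n 8 2)

-- The left side is the total size of t branch sets, each a tree through at most t targets with 2 κ
-- l vertices per target, for κ = (j + 1) * 10 and l = j ^ 3. It is at most (40 t² + t) j ^ 4.
branch-size : ∀ t j → 1 ≤ j → 40 * (t * t) + t ≤ j → t * suc (t * (suc j * 10 * j ^ 3 + suc j * 10 * j ^ 3)) ≤ j ^ 5
branch-size t j 1≤j p = begin
  t * suc (t * (suc j * 10 * j ^ 3 + suc j * 10 * j ^ 3))  ≡⟨ expand t j (j ^ 3) ⟩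
  20 * (t * t) * (j + 1) * j ^ 3 + t * 1          ≤⟨ (20 * (t * t) * (j + 1) * j ^ 3) ⊕′ (t ⊙ ≤-trans (m^n>0 j {{>-nonZero 1≤j}} 4) ≤-refl) ⟩
  20 * (t * t) * (j + 1) * j ^ 3 + t * j ^ 4      ≤⟨ ((20 * (t * t)) ⊙ʳ (j ^ 3)) ⊕ ≤-refl {t * j ^ 4} ⟩
  20 * (t * t) * (j + j) * j ^ 3 + t * j ^ 4      ≡⟨ collect t j (j ^ 3) ⟩
  (40 * (t * t) + t) * j ^ 4                      ≤⟨ *-monoˡ-≤ (j ^ 4) p ⟩
  j ^ 5                                           ∎
  where
  open ≤-Reasoning
  _⊕′_ : ∀ a {b c} → b ≤ c → a + b ≤ a + c
  a ⊕′ h = +-monoʳ-≤ a h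
  _⊙ʳ_ : ∀ a c → a * (j + 1) * c ≤ a * (j + j) * c
  a ⊙ʳ c = *-monoˡ-≤ c (a ⊙ (≤-refl {j} ⊕ 1≤j))
  expand : ∀ t j c → t * suc (t * (suc j * 10 * c + suc j * 10 * c)) ≡ 20 * (t * t) * (j + 1) * c + t * 1
  expand = solve-∀
  collect : ∀ t j c → 20 * (t * t) * (j + j) * c + t * (j * c) ≡ (40 * (t * t) + t) * (j * c)
  collect = solve-∀

separator-size : ∀ j v z tw → 1 ≤ j → scale j ≤ v → tw ≤ j ^ 5 → j ^ 3 * z ≤ v + j ^ 3 * tw → j ^ 3 * z ≤ 2 * v
separator-size j v z tw 1≤j J≤v tw≤ h = begin
  j ^ 3 * z              ≤⟨ h ⟩
  v + j ^ 3 * tw         ≤⟨ +-monoʳ-≤ v ((j ^ 3) ⊙ tw≤) ⟩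
  v + j ^ 3 * j ^ 5      ≡⟨ cong (v +_) (^-distribˡ-+-* j 3 5) ⟨
  v + j ^ 8              ≤⟨ +-monoʳ-≤ v (≤-trans (j⁸≤scale j 1≤j) J≤v) ⟩
  v + v                  ≡⟨ cong (v +_) (+-identityʳ v) ⟨
  2 * v                  ∎
  where open ≤-Reasoning

-- Since z ≤ 2 v / 40, a part has at most (3 / 4 + 1 / 20) v = (4 / 5) v vertices, and one level of
-- `scale` is a factor of at most 5 / 4.
part-size : ∀ l v v′ z J s → 40 ≤ l → v ≤ s → 4 * s ≤ 5 * J → l * z ≤ 2 * v → 4 * v′ ≤ 3 * v + 4 * z → v′ ≤ J
part-size l v v′ z J s p q r lz h = *-cancelˡ-≤ (16 * l) {{>-nonZero (≤-trans (s≤s z≤n) (16 ⊙ ≤-trans (s≤s z≤n) p))}}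
  (lin ((4 * l) ⊙ h ⊕ 16 ⊙ lz ⊕ (3 * l + 8) ⊙ ≤-trans (4 ⊙ q) r ⊕ J ⊙ p) 0 (solve (l ∷ v ∷ v′ ∷ z ∷ J ∷ [])))

level-down : ∀ α β j v e → α * suc j * v ≤ β * suc (suc j) * e → α * j * v ≤ β * suc j * e
level-down α β j v e h = *-cancelʳ-≤ _ _ (suc j) (lin (j ⊙ h) (β * e) (solve (α ∷ β ∷ j ∷ v ∷ e ∷ [])))

-- Consecutive thresholds differ by the factor 1 + 1 / (j² + 2 j). If both parts were below the
-- lower threshold, the separator would have at least v / (j² + 2 j) vertices, but it has at most 2
-- v / j³.
too-sparse : ∀ α β j v v₁ v₂ z e e₁ e₂ → 1 ≤ α → 4 ≤ j → 1 ≤ v → v₁ + v₂ ≤ v + z → j ^ 3 * z ≤ 2 * v → e ≤ e₁ + e₂ →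
             α * suc j * v ≤ β * suc (suc j) * e → β * suc j * e₁ ≤ α * j * v₁ → β * suc j * e₂ ≤ α * j * v₂ → ⊥
too-sparse α β j v v₁ v₂ z e e₁ e₂ 1≤α 4≤j 1≤v hv hz he h h₁ h₂ = n≮n _ (≤-trans cubic quadratic)
  where
  step₁ : α * v ≤ α * ((j * j + 2 * j) * z)
  step₁ = lin (suc j ⊙ h ⊕ (β * (suc j * suc (suc j))) ⊙ he ⊕ suc (suc j) ⊙ h₁ ⊕ suc (suc j) ⊙ h₂ ⊕ (α * j * suc (suc j)) ⊙ hv) 0
    (solve (α ∷ β ∷ j ∷ v ∷ v₁ ∷ v₂ ∷ z ∷ e ∷ e₁ ∷ e₂ ∷ []))
  step₂ : v ≤ (j * j + 2 * j) * z
  step₂ = *-cancelˡ-≤ α {{>-nonZero 1≤α}} step₁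
  quadratic : j ^ 3 ≤ (j * j + 2 * j) * 2
  quadratic = *-cancelʳ-≤ _ _ v {{>-nonZero 1≤v}} (quad-arith j v z (j ^ 3) step₂ hz)
    where
    quad-arith : ∀ j v z c → v ≤ (j * j + 2 * j) * z → c * z ≤ 2 * v → c * v ≤ (j * j + 2 * j) * 2 * v
    quad-arith j v z c p q = lin (c ⊙ p ⊕ (j * j + 2 * j) ⊙ q) 0 (solve (j ∷ v ∷ z ∷ c ∷ []))
  cubic : suc ((j * j + 2 * j) * 2) ≤ j * (j * (j * 1))
  cubic = lin ((j * j) ⊙ 4≤j ⊕ (2 * j) ⊙ 4≤j ⊕ 4≤j) (3 * j + 3) (solve (j ∷ []))

empty-arith : ∀ x y c e → c ≡ 0 → e ≤ c * c → x * e ≤ y * c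
empty-arith x y _ e refl h = ≤-trans (x ⊙ h) (≤-reflexive (trans (*-zeroʳ x) (sym (*-zeroʳ y))))

-- Density is counted in `Rel`, the edges that are still available, while the separators are those
-- of A, where large clique minors are excluded. A separator of A also separates `Rel`.
module DensePiece {n} (A : Adj n) (t : ℕ) (noClique : ∀ {k} → t ≤ k → Model (complete k) A → ⊥) (α β : ℕ) (1≤α : 1 ≤ α)
                  (Rel : Fin n → Fin n → Bool) (Rel⊆E : ∀ {i j} → Rel i j ≡ true → E A i j ≡ true)
                  (j₀ : ℕ) (49≤j₀ : 49 ≤ j₀) (t≤j₀ : 40 * (t * t) + t ≤ j₀) where

  Piece : Set
  Piece = ∃ λ P → 1 ≤ count P × count P ≤ scale j₀ × α * j₀ * count P ≤ β * suc j₀ * pairs Rel P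

  -- V is split only when it is too large for the next lower level. A nonempty part that meets the
  -- lower threshold fits into that level, and it is impossible that neither part does so.
  piece-at : ∀ d V → 1 ≤ count V → count V ≤ scale (d + j₀) → α * (d + j₀) * count V ≤ β * suc (d + j₀) * pairs Rel V → Piece
  piece-at zero V 1≤V V≤ h = V , 1≤V , V≤ , h
  piece-at (suc d) V 1≤V V≤ h with count V ≤? scale (d + j₀)
  ... | yes V≤′ = piece-at d V 1≤V V≤′ (level-down α β (d + j₀) (count V) (pairs Rel V) h)
  ... | no V≰ = decide (try V₁ size₁) (try V₂ size₂)
    where
    j = d + j₀
    49≤j : 49 ≤ j
    49≤j = ≤-trans 49≤j₀ (m≤n+m j₀ d)
    1≤j = ≤-trans (s≤s z≤n) 49≤j
    instance
      j-nonZero : NonZero j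
      j-nonZero = >-nonZero 1≤j
      j³-nonZero : NonZero (j ^ 3)
      j³-nonZero = m^n≢0 j 3
    V<2^κ : count V < 2 ^ (suc j * 10)
    V<2^κ = ≤-trans (s≤s V≤) (scale<2^ (suc j))
    open Separator A V (j ^ 3) (suc j * 10) t V<2^κ noClique
    open Separation separate
    z≤ : j ^ 3 * z ≤ 2 * count V
    z≤ = separator-size j (count V) z _ 1≤j (<⇒≤ (≰⇒> V≰)) (branch-size t j 1≤j (≤-trans t≤j₀ (m≤n+m j₀ d))) z-small
    40≤j³ : 40 ≤ j ^ 3
    40≤j³ = ≤-trans (≤-trans (m≤m+n 40 9) 49≤j) (≤-trans (≤-reflexive (sym (^-identityʳ j))) (^-monoʳ-≤ j (m≤m+n 1 2)))
    try : ∀ (V′ : Fin n → Bool) → 4 * count V′ ≤ 3 * count V + 4 * z → Piece ⊎ β * suc j * pairs Rel V′ ≤ α * j * count V′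
    try V′ size = cases (1 ≤? count V′) (α * j * count V′ ≤? β * suc j * pairs Rel V′)
      where
      cases : Dec (1 ≤ count V′) → Dec (α * j * count V′ ≤ β * suc j * pairs Rel V′) →
              Piece ⊎ β * suc j * pairs Rel V′ ≤ α * j * count V′
      cases (yes 1≤V′) (yes h′) = inj₁ (piece-at d V′ 1≤V′
        (part-size (j ^ 3) (count V) (count V′) z (scale j) (scale (suc j)) 40≤j³ V≤ (scale-step j 49≤j) z≤ size) h′)
      cases (yes _) (no h′) = inj₂ (<⇒≤ (≰⇒> h′))
      cases (no V′≡0) _ = inj₂ (empty-arith (β * suc j) (α * j) (count V′) (pairs Rel V′) (n<1⇒n≡0 (≰⇒> V′≡0)) (pairs≤count² Rel V′))
    decide : Piece ⊎ β * suc j * pairs Rel V₁ ≤ α * j * count V₁ → Piece ⊎ β * suc j * pairs Rel V₂ ≤ α * j * count V₂ → Piece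
    decide (inj₁ p) _ = p
    decide (inj₂ _) (inj₁ p) = p
    decide (inj₂ h₁) (inj₂ h₂) = ⊥-elim (too-sparse α β j (count V) (count V₁) (count V₂) z _ _ _ 1≤α (≤-trans (m≤m+n 4 45) 49≤j) 1≤V sizes z≤
      (pairs-∪ {R = Rel} {V} {V₁} {V₂} (λ p q r → cover p q (Rel⊆E r))) h h₁ h₂)

  piece : ∀ V → 1 ≤ count V → α * count V ≤ β * pairs Rel V → Piece
  -- The starting level n + j₀ admits every vertex set, because `scale` dominates the identity.
  piece V 1≤V h = piece-at n V 1≤V
    (≤-trans (count≤n V) (≤-trans (m≤m+n n j₀) (scale-≥ (n + j₀))))
    (arith α β (n + j₀) (count V) (pairs Rel V) h)
    where
    arith : ∀ α β j v e → α * v ≤ β * e → α * j * v ≤ β * suc j * e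
    arith α β j v e h = lin (j ⊙ h) (β * e) (solve (α ∷ β ∷ j ∷ v ∷ e ∷ []))

open import Data.List.Membership.Propositional using (_∈_)
open import Data.List.Relation.Binary.Sublist.Propositional using (_⊆_; []; _∷_; _∷ʳ_; ⊆-refl; ⊆-trans; minimum)
open import Data.List.Relation.Binary.Sublist.Propositional.Properties using (filter-⊆; All-resp-⊆)
open import Data.List.Relation.Unary.All as All using (All; []; _∷_)
open import Data.List.Relation.Unary.All.Properties as AllP using (all-filter; tabulate⁻)
open import Data.List.Relation.Unary.AllPairs using (AllPairs; []; _∷_)
open import Data.List.Relation.Unary.AllPairs.Properties as APP using ()
open import Data.List.Relation.Unary.Any using (here)

module _ {I : Set} where

  AllPairs-⊆ : ∀ {R : I → I → Set} {xs ys} → xs ⊆ ys → AllPairs R ys → AllPairs R xs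
  AllPairs-⊆ [] [] = []
  AllPairs-⊆ (y ∷ʳ s) (p ∷ ps) = AllPairs-⊆ s ps
  AllPairs-⊆ (refl ∷ s) (p ∷ ps) = All-resp-⊆ s p ∷ AllPairs-⊆ s ps

  keep : (I → Bool) → List I → List I
  keep g = filter (true? ∘ g)

  length-keep : ∀ g xs → length (keep g xs) + length (keep (not ∘ g) xs) ≡ length xs
  length-keep g [] = refl
  length-keep g (x ∷ xs) with g x
  ... | true = cong suc (length-keep g xs)
  ... | false = trans (+-suc _ _) (cong suc (length-keep g xs))

  Constant : List I → (I → Bool) → Set
  Constant xs g = ∃ λ b → All (λ x → g x ≡ b) xs

  -- Pigeonhole principle at the cost of a factor 2 for each predicate: if the sublist where `g` is
  -- true is too short, the one where it is false is long enough.
  uniformize : ∀ (gs : List (I → Bool)) m (xs : List I) → 2 ^ length gs * m ≤ length xs →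
               ∃ λ ys → ys ⊆ xs × m ≤ length ys × All (Constant ys) gs
  uniformize [] m xs le = xs , ⊆-refl , ≤-trans (≤-reflexive (sym (+-identityʳ m))) le , []
  uniformize (g ∷ gs) m xs le with 2 ^ length gs * m ≤? length (keep g xs)
  ... | yes p = let (ys , sub , len , cs) = uniformize gs m (keep g xs) p in
    ys , ⊆-trans sub (filter-⊆ (true? ∘ g) xs) , len , (true , All-resp-⊆ sub (all-filter (true? ∘ g) xs)) ∷ cs
  ... | no p = let (ys , sub , len , cs) = uniformize gs m (keep (not ∘ g) xs) q in
    ys , ⊆-trans sub (filter-⊆ (true? ∘ not ∘ g) xs) , len ,
    (false , All.map not-true⁻ (All-resp-⊆ sub (all-filter (true? ∘ not ∘ g) xs))) ∷ cs
    where
    arith : ∀ a m b c l → 2 * a * m ≤ l → b + c ≡ l → b < a * m → a * m ≤ c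
    arith a m b c l h e k = lin (≤-trans h (≤-reflexive (sym e)) ⊕ k) 1 (identity a m b c)
      where
      identity : ∀ a m b c → a * m + (b + c + a * m) + 1 ≡ c + (2 * a * m + suc b)
      identity = solve-∀
    q : 2 ^ length gs * m ≤ length (keep (not ∘ g) xs)
    q = arith (2 ^ length gs) m _ _ _ le (length-keep g xs) (≰⇒> p)

-- Sunflowers

-- If every point outside the kernel is in at most G = `flowerBound M q` sets, each of the q chosen
-- petals uses up itself and at most (M + 1) G others.
flowerBound : ℕ → ℕ → ℕ
flowerBound zero q = q * 1
flowerBound (suc M) q = q * suc (suc M * flowerBound M q)

module Sunflower {I : Set} {n} (S : I → Fin n → Bool) where

  occurrences : Fin n → List I → ℕ
  occurrences i xs = length (keep (λ x → S x i) xs)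

  occurrences-∷ : ∀ i x xs → occurrences i xs ≤ occurrences i (x ∷ xs)
  occurrences-∷ i x xs with S x i
  ... | true = n≤1+n _
  ... | false = ≤-refl

  outside : (Fin n → Bool) → I → Fin n → Bool
  outside N x i = S x i ∧ not (N i)

  meets : (Fin n → Bool) → I → I → Bool
  meets N x y = anyF (λ i → outside N x i ∧ S y i)

  length-keep-keep : ∀ (g h : I → Bool) xs → length (keep g (keep h xs)) ≤ length (keep g xs)
  length-keep-keep g h [] = z≤n
  length-keep-keep g h (x ∷ xs) with h x | g x in e
  ... | true | true rewrite e = s≤s (length-keep-keep g h xs)
  ... | true | false rewrite e = length-keep-keep g h xs
  ... | false | true = ≤-trans (length-keep-keep g h xs) (n≤1+n _)
  ... | false | false = length-keep-keep g h xs

  meeting-≤ : ∀ N x ys → length (keep (meets N x) ys) ≤ ∑ (λ i → 𝟙 (outside N x i) * occurrences i ys)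
  meeting-≤ N x [] = z≤n
  meeting-≤ N x (y ∷ ys) with true? (meets N x y)
  ... | no p = ≤-trans (meeting-≤ N x ys) (∑-mono λ i → 𝟙 (outside N x i) ⊙ occurrences-∷ i y ys)
  ... | yes p with anyF⁻ (λ i → outside N x i ∧ S y i) p
  ...   | i , q = ≤-trans (s≤s (meeting-≤ N x ys)) (∑-strict (λ j → 𝟙 (outside N x j) ⊙ occurrences-∷ j y ys) i strict)
    where
    strict : 𝟙 (outside N x i) * occurrences i ys < 𝟙 (outside N x i) * occurrences i (y ∷ ys)
    strict rewrite proj₁ (∧-true⁻ {outside N x i} q) | proj₂ (∧-true⁻ {outside N x i} q) = ≤-refl

  DisjointOutside : (Fin n → Bool) → I → I → Set
  DisjointOutside N x y = ∀ i → S x i ≡ true → S y i ≡ true → N i ≡ true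

  -- The first set x is kept and every set that meets it outside N is discarded. There are at most M
  -- * G of these, as x has at most M points outside N and each lies in at most G sets.
  greedy : ∀ N M G q xs → All (λ x → count (outside N x) ≤ M) xs → (∀ i → N i ≡ false → occurrences i xs ≤ G) →
           q * suc (M * G) ≤ length xs → ∃ λ ys → ys ⊆ xs × q ≤ length ys × AllPairs (DisjointOutside N) ys
  greedy N M G zero xs _ _ _ = [] , minimum xs , z≤n , []
  greedy N M G (suc q) (x ∷ xs) (x≤M ∷ xs≤M) rare (s≤s le) =
    let xs′ = keep (not ∘ meets N x) xs
        sub = filter-⊆ (true? ∘ not ∘ meets N x) xs
        (ys , sub′ , len , disj) = greedy N M G q xs′ (All-resp-⊆ sub xs≤M)
          (λ i p → ≤-trans (length-keep-keep (λ y → S y i) (not ∘ meets N x) xs) (rare′ i p)) enough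
    in x ∷ ys , refl ∷ ⊆-trans sub′ sub , s≤s len ,
       All.map apart (All-resp-⊆ sub′ (all-filter (true? ∘ not ∘ meets N x) xs)) ∷ disj
    where
    rare′ : ∀ i → N i ≡ false → occurrences i xs ≤ G
    rare′ i p = ≤-trans (occurrences-∷ i x xs) (rare i p)
    apart : ∀ {y} → not (meets N x y) ≡ true → DisjointOutside N x y
    apart {y} p i a b = case true? (N i) of λ where
      (yes c) → c
      (no c) → ⊥-elim (true≢false (anyF⁺ (λ i → outside N x i ∧ S y i) i (∧-true⁺ (∧-true⁺ a (not-true⁺ (≢true⇒false c))) b)) (not-true⁻ p))
    few : length (keep (meets N x) xs) ≤ M * G
    few = ≤-trans (meeting-≤ N x xs) (≤-trans (∑-mono {n} bound) (≤-trans (≤-reflexive (∑-*ˡ G (𝟙 ∘ outside N x)))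
      (≤-trans (G ⊙ x≤M) (≤-reflexive (*-comm G M)))))
      where
      bound : ∀ i → 𝟙 (outside N x i) * occurrences i xs ≤ G * 𝟙 (outside N x i)
      bound i with N i in e
      ... | false = ≤-trans (𝟙 (S x i ∧ true) ⊙ rare′ i e) (≤-reflexive (*-comm (𝟙 (S x i ∧ true)) G))
      ... | true with S x i
      ...   | true = z≤n
      ...   | false = z≤n
    enough : q * suc (M * G) ≤ length (keep (not ∘ meets N x) xs)
    enough = arith (M * G) (q * suc (M * G)) _ _ _ le (length-keep (meets N x) xs) few
      where
      arith : ∀ a b c d l → a + b ≤ l → c + d ≡ l → c ≤ a → b ≤ d
      arith a b c d l h e k = lin (≤-trans h (≤-reflexive (sym e)) ⊕ k) 0 (identity a b c d)
        where
        identity : ∀ a b c d → b + (c + d + a) + 0 ≡ d + (a + b + c)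
        identity = solve-∀

  record Flower (xs : List I) (q : ℕ) : Set where
    field
      kernel : Fin n → Bool
      petals : List I
      petals⊆ : petals ⊆ xs
      enough : q ≤ length petals
      kernel⊆ : All (λ x → ∀ i → kernel i ≡ true → S x i ≡ true) petals
      disjoint : AllPairs (DisjointOutside kernel) petals

  -- The argument of Erdős and Rado: a frequent point outside N joins the kernel and lowers M; if
  -- there is none, the greedy choice succeeds.
  sunflower : ∀ M q N xs → All (λ x → ∀ i → N i ≡ true → S x i ≡ true) xs → All (λ x → count (outside N x) ≤ M) xs →
              flowerBound M q ≤ length xs → Flower xs q
  -- No set has points outside N, so the trivial bound on occurrences is good enough: it is
  -- multiplied by 0.
  sunflower zero q N xs N⊆ small le =
    let (ys , sub , len , disj) = greedy N 0 (length xs) q xs small (λ i _ → ≤-trans (m≤m+n _ _) (≤-reflexive (length-keep (λ x → S x i) xs))) le in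
    record { kernel = N ; petals = ys ; petals⊆ = sub ; enough = len ; kernel⊆ = All-resp-⊆ sub N⊆ ; disjoint = disj }
  sunflower (suc M) q N xs N⊆ small le with any? (λ i → ¬? (true? (N i)) ×-dec (flowerBound M q ≤? occurrences i xs))
  ... | no none =
    let (ys , sub , len , disj) = greedy N (suc M) (flowerBound M q) q xs small
          (λ i p → <⇒≤ (≰⇒> λ h → none (i , (λ r → true≢false r p) , h))) le in
    record { kernel = N ; petals = ys ; petals⊆ = sub ; enough = len ; kernel⊆ = All-resp-⊆ sub N⊆ ; disjoint = disj }
  ... | yes (i , i∉N , many) = record { Flower rec ; petals⊆ = ⊆-trans (Flower.petals⊆ rec) sub }
    where
    N′ : Fin n → Bool
    N′ j = N j ∨ (j == i)
    sub = filter-⊆ (λ x → true? (S x i)) xs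
    xs∋i = all-filter (λ x → true? (S x i)) xs
    N′⊆ : ∀ {x} → (∀ j → N j ≡ true → S x j ≡ true) × S x i ≡ true → ∀ j → N′ j ≡ true → S x j ≡ true
    N′⊆ {x} (p , q) j r with ∨-true⁻ {N j} r
    ... | inj₁ s = p j s
    ... | inj₂ s = subst (λ z → S x z ≡ true) (sym (==-true⁻ s)) q
    smaller : ∀ {x} → count (outside N x) ≤ suc M × S x i ≡ true → count (outside N′ x) ≤ M
    smaller {x} (p , q) = s≤s⁻¹ (≤-trans (count-pos {P = _== i} i (==-true⁺ {i = i} refl) ⊕ ≤-refl {count (outside N′ x)})
      (≤-trans (count-⊎ {P = _== i} {outside N′ x} {outside N x}
        (λ j r → subst (λ z → outside N x z ≡ true) (sym (==-true⁻ r)) (∧-true⁺ q (not-true⁺ (≢true⇒false i∉N))))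
        (λ j r → let (a , b) = ∧-true⁻ {S x j} r in
          ∧-true⁺ a (not-true⁺ (≢true⇒false λ c → true≢false (∨-true⁺ˡ {b = j == i} c) (not-true⁻ b))))
        (λ j r s → true≢false (∨-true⁺ʳ {N j} r) (not-true⁻ (proj₂ (∧-true⁻ {S x j} s))))) p))
    rec : Flower (keep (λ x → S x i) xs) q
    rec = sunflower M q N′ (keep (λ x → S x i) xs) (All.map N′⊆ (All.zip (All-resp-⊆ sub N⊆ , xs∋i)))
      (All.map smaller (All.zip (All-resp-⊆ sub small , xs∋i))) many

-- Successive extraction of pieces, and connected petals

cross : ∀ {n} → (Fin n → Fin n → Bool) → (P Q : Fin n → Bool) → ℕ
cross R P Q = ∑ λ i → ∑ λ j → 𝟙 (P i ∧ (Q j ∧ R i j))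

cross-∪ : ∀ {n} (R : Fin n → Fin n → Bool) {P P₁ P₂ Q : Fin n → Bool} → (∀ i → P i ≡ true → P₁ i ≡ true ⊎ P₂ i ≡ true) →
          cross R P Q ≤ cross R P₁ Q + cross R P₂ Q
cross-∪ R {P} {P₁} {P₂} {Q} h = ≤-trans (∑∑-mono pointwise)
  (≤-reflexive (∑∑-+ (λ i j → 𝟙 (P₁ i ∧ (Q j ∧ R i j))) (λ i j → 𝟙 (P₂ i ∧ (Q j ∧ R i j)))))
  where
  pointwise : ∀ i j → 𝟙 (P i ∧ (Q j ∧ R i j)) ≤ 𝟙 (P₁ i ∧ (Q j ∧ R i j)) + 𝟙 (P₂ i ∧ (Q j ∧ R i j))
  pointwise i j = 𝟙-∪ λ p → let (a , b) = ∧-true⁻ {P i} p in case h i a of λ where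
    (inj₁ c) → inj₁ (∧-true⁺ c b)
    (inj₂ c) → inj₂ (∧-true⁺ c b)

cross-empty : ∀ {n} (R : Fin n → Fin n → Bool) (P Q : Fin n → Bool) → (∀ i → ¬ (P i ≡ true)) → cross R P Q ≡ 0
cross-empty R P Q h = ∑∑-zero λ i j → cong 𝟙 (≢true⇒false {P i ∧ (Q j ∧ R i j)} λ p → h i (proj₁ (∧-true⁻ {P i} p)))

module Extract {n} (A : Adj n) (M a b : ℕ) where

  -- The relation consists of the edges still available when the piece was chosen. Lists carry the
  -- newest piece first, so a piece avoids all those behind it.
  Piece : Set
  Piece = (Fin n → Bool) × (Fin n → Fin n → Bool)

  Good : Piece → Set
  Good (P , R) = 1 ≤ count P × count P ≤ M × a * count P ≤ b * pairs R P × (∀ {i j} → R i j ≡ true → E A i j ≡ true)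

  Free : (Fin n → Fin n → Bool) → Piece → Set
  Free R (P , _) = ∀ {i j} → P i ≡ true → P j ≡ true → R i j ≡ true → ⊥

  Avoids : Piece → Piece → Set
  Avoids (_ , R) = Free R

  remaining : List Piece → Fin n → Fin n → Bool
  remaining [] = E A
  remaining ((P , _) ∷ xs) i j = remaining xs i j ∧ not (P i ∧ P j)

  remaining⊆E : ∀ xs {i j} → remaining xs i j ≡ true → E A i j ≡ true
  remaining⊆E [] p = p
  remaining⊆E (x ∷ xs) {i} {j} p = remaining⊆E xs (proj₁ (∧-true⁻ {remaining xs i j} p))

  remaining-free : ∀ xs → All (Free (remaining xs)) xs
  remaining-free [] = []
  remaining-free (x ∷ xs) =
    (λ {i} {j} p q r → true≢false (∧-true⁺ p q) (not-true⁻ (proj₂ (∧-true⁻ {remaining xs i j} r)))) ∷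
    All.map (λ {y} free {i} {j} p q r → free p q (proj₁ (∧-true⁻ {remaining xs i j} r))) (remaining-free xs)

  full : Fin n → Bool
  full _ = true

  remaining-count : ∀ xs → All Good xs → edges₂ A ≤ pairs (remaining xs) full + length xs * (M * M)
  remaining-count [] [] = m≤m+n _ _
  remaining-count ((P , R) ∷ xs) ((_ , P≤M , _ , _) ∷ gs) = arith _ _ _ _ (M * M) (length xs) (remaining-count xs gs) split
    (≤-trans (pairs≤count² (remaining xs) P) (*-mono-≤ P≤M P≤M))
    where
    split : pairs (remaining xs) full ≤ pairs (remaining ((P , R) ∷ xs)) full + pairs (remaining xs) P
    split = ≤-trans (∑∑-mono pointwise) (≤-reflexive (∑∑-+ (λ i j → 𝟙 (remaining xs i j ∧ not (P i ∧ P j))) (λ i j → 𝟙 (P i ∧ (P j ∧ remaining xs i j)))))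
      where
      pointwise : ∀ i j → 𝟙 (remaining xs i j) ≤ 𝟙 (remaining xs i j ∧ not (P i ∧ P j)) + 𝟙 (P i ∧ (P j ∧ remaining xs i j))
      pointwise i j = 𝟙-∪ λ r → case true? (P i ∧ P j) of λ where
        (yes p) → let (c , d) = ∧-true⁻ {P i} p in inj₂ (∧-true⁺ c (∧-true⁺ d r))
        (no p) → inj₁ (∧-true⁺ r (not-true⁺ (≢true⇒false p)))
    arith : ∀ e p p′ q m l → e ≤ p + l * m → p ≤ p′ + q → q ≤ m → e ≤ p′ + suc l * m
    arith e p p′ q m l h k r = lin (h ⊕ k ⊕ r) 0 (identity e p p′ q m l)
      where
      identity : ∀ e p p′ q m l → e + (p + l * m + (p′ + q + m)) + 0 ≡ p′ + suc l * m + (e + (p + q))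
      identity = solve-∀

  module _ (α β : ℕ) (pick : ∀ R → (∀ {i j} → R i j ≡ true → E A i j ≡ true) → α * n ≤ β * pairs R full →
                            ∃ λ P → 1 ≤ count P × count P ≤ M × a * count P ≤ b * pairs R P) where

    extract : ∀ k → α * n + β * (k * (M * M)) ≤ β * edges₂ A →
              ∃ λ xs → length xs ≡ k × All Good xs × AllPairs Avoids xs
    extract zero _ = [] , refl , [] , []
    extract (suc k) le =
      let (xs , len , gs , av) = extract k (≤-trans (+-monoʳ-≤ (α * n) (β ⊙ m≤n+m (k * (M * M)) (M * M))) le)
          R = remaining xs
          dense = arith _ _ (α * n) β (M * M) k (subst (λ l → edges₂ A ≤ pairs R full + l * (M * M)) len (remaining-count xs gs)) le
          (P , g₁ , g₂ , g₃) = pick R (remaining⊆E xs) dense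
      in (P , R) ∷ xs , cong suc len , (g₁ , g₂ , g₃ , remaining⊆E xs) ∷ gs , remaining-free xs ∷ av
      where
      arith : ∀ e p x β m k → e ≤ p + k * m → x + β * (suc k * m) ≤ β * e → x ≤ β * p
      arith e p x β m k h h′ = lin (β ⊙ h ⊕ h′) (β * m) (identity e p x β m k)
        where
        identity : ∀ e p x β m k → x + (β * (p + k * m) + β * e) + β * m ≡ β * p + (β * e + (x + β * (suc k * m)))
        identity = solve-∀

  -- Edges meeting Z inside Z ∪ N, counted twice.

  τ : (N Z : Fin n → Bool) → ℕ
  τ N Z = pairs (E A) Z + 2 * cross (E A) Z N

  record Petal (N : Fin n → Bool) : Set where
    field
      C : Fin n → Bool
      root : Fin n
      root∈ : C root ≡ true
      connected : ∀ {i} → C i ≡ true → Path A (λ w → C w ≡ true) i root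
      small : count C ≤ M
      off-kernel : ∀ {i} → C i ≡ true → N i ≡ true → ⊥
      dense : a * count C ≤ b * τ N C

  saturated-ball : ∀ Z y → Z y ≡ true → ∃ λ r → count (frontier A Z (ball A Z y r)) ≡ 0
  saturated-ball Z y y∈Z with anyUpTo? (λ r → count (frontier A Z (ball A Z y r)) ≟ 0) (suc n)
  ... | yes (r , _ , p) = r , p
  ... | no none = ⊥-elim (n≮n n (≤-trans (n≤1+n (suc n)) (≤-trans (grows (suc n) ≤-refl) (count≤n (ball A Z y (suc n))))))
    where
    grows : ∀ r → r ≤ suc n → suc r ≤ count (ball A Z y r)
    grows zero _ = ball-nonempty A Z y y∈Z 0
    grows (suc r) r< = ≤-trans (≤-trans (≤-reflexive (+-comm 1 (suc r))) (grows r (<⇒≤ r<) ⊕ n≢0⇒n>0 (λ p → none (r , r< , p))))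
      (count-grow A Z (ball A Z y r))

  -- A ball with empty frontier is a component of Z, so `τ` and the vertex count split over it and
  -- the rest. If the component is too sparse, the rest is strictly dense, hence nonempty, and the
  -- search continues there.
  component : ∀ N fuel (Z : Fin n → Bool) → count Z ≤ fuel → 1 ≤ count Z → count Z ≤ M → (∀ {i} → Z i ≡ true → N i ≡ true → ⊥) →
              a * count Z ≤ b * τ N Z → ∃ λ (p : Petal N) → ∀ i → Petal.C p i ≡ true → Z i ≡ true
  component N zero Z Z≤0 1≤Z = ⊥-elim (n≮n 0 (≤-trans 1≤Z Z≤0))
  component N (suc fuel) Z Z≤ 1≤Z Z≤M off dense = cases (a * count C ≤? b * τ N C)
    where
    y = proj₁ (count-pos⁻ {P = Z} 1≤Z)
    y∈Z = proj₂ (count-pos⁻ {P = Z} 1≤Z)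
    r = proj₁ (saturated-ball Z y y∈Z)
    C C′ : Fin n → Bool
    C = ball A Z y r
    C′ i = Z i ∧ not (C i)
    C⊆Z : ∀ i → C i ≡ true → Z i ≡ true
    C⊆Z = ball⊆ A Z y y∈Z r
    closed : ∀ {i j} → C i ≡ true → Z j ≡ true → E A i j ≡ true → C j ≡ true
    closed {i} {j} p q e with true? (C j)
    ... | yes c = c
    ... | no c = ⊥-elim (n≮n 0 (≤-trans (count-pos {P = frontier A Z C} j (frontier⁺ A Z C (≢true⇒false c) q p e))
                                        (≤-reflexive (proj₂ (saturated-ball Z y y∈Z)))))
    C′⁻ : ∀ {i} → C′ i ≡ true → Z i ≡ true × ¬ (C i ≡ true)
    C′⁻ {i} p = let (q , s) = ∧-true⁻ {Z i} p in q , λ c → true≢false c (not-true⁻ s)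
    split-count : count C + count C′ ≤ count Z
    split-count = count-⊎ {P = C} {C′} {Z} C⊆Z (λ i → proj₁ ∘ C′⁻) (λ i p q → proj₂ (C′⁻ q) p)
    split-pairs : pairs (E A) Z ≤ pairs (E A) C + pairs (E A) C′
    split-pairs = pairs-∪ {R = E A} {Z} {C} {C′} λ {i} {j} p q e → case (true? (C i) , true? (C j)) of λ where
      (yes c , _) → inj₁ (c , closed c q e)
      (no c , yes d) → ⊥-elim (c (closed d p (E-sym A e)))
      (no c , no d) → inj₂ (∧-true⁺ p (not-true⁺ (≢true⇒false c)) , ∧-true⁺ q (not-true⁺ (≢true⇒false d)))
    split-cross : cross (E A) Z N ≤ cross (E A) C N + cross (E A) C′ N
    split-cross = cross-∪ (E A) {Z} {C} {C′} {N} λ i p → case true? (C i) of λ where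
      (yes c) → inj₁ c
      (no c) → inj₂ (∧-true⁺ p (not-true⁺ (≢true⇒false c)))
    rest-dense : b * τ N C < a * count C → a * count C′ < b * τ N C′
    rest-dense h = arith a b (count Z) (count C) (count C′) (pairs (E A) Z) (pairs (E A) C) (pairs (E A) C′)
      (cross (E A) Z N) (cross (E A) C N) (cross (E A) C′ N) split-count split-pairs split-cross dense h
      where
      arith : ∀ a b z c c′ p q q′ x y y′ → c + c′ ≤ z → p ≤ q + q′ → x ≤ y + y′ → a * z ≤ b * (p + 2 * x) → b * (q + 2 * y) < a * c →
              a * c′ < b * (q′ + 2 * y′)
      arith a b z c c′ p q q′ x y y′ h₁ h₂ h₃ h₄ h₅ = lin (a ⊙ h₁ ⊕ b ⊙ h₂ ⊕ (2 * b) ⊙ h₃ ⊕ h₄ ⊕ h₅) 0 (identity a b z c c′ p q q′ x y y′)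
        where
        identity : ∀ a b z c c′ p q q′ x y y′ →
          suc (a * c′) + (a * z + (b * (q + q′) + (2 * b * (y + y′) + (b * (p + 2 * x) + a * c)))) + 0 ≡
          b * (q′ + 2 * y′) + (a * (c + c′) + (b * p + (2 * b * x + (a * z + suc (b * (q + 2 * y))))))
        identity = solve-∀
    cases : Dec (a * count C ≤ b * τ N C) → ∃ λ (p : Petal N) → ∀ i → Petal.C p i ≡ true → Z i ≡ true
    cases (yes h) = record
      { C = C ; root = y ; root∈ = centre∈ball A Z y y∈Z r ; connected = ball-connected A Z y y∈Z r
      ; small = ≤-trans (count-mono {P = C} {Z} C⊆Z) Z≤M ; off-kernel = λ {i} p → off (C⊆Z i p) ; dense = h } , C⊆Z
    cases (no h) with 1 ≤? count C′
    ... | yes 1≤C′ =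
      let (p , sub) = component N fuel C′ (s≤s⁻¹ (≤-trans (ball-nonempty A Z y y∈Z r ⊕ ≤-refl {count C′}) (≤-trans split-count Z≤)))
            1≤C′ (≤-trans (count-mono {P = C′} {Z} (λ i → proj₁ ∘ C′⁻)) Z≤M) (λ p → off (proj₁ (C′⁻ p))) (<⇒≤ (rest-dense (≰⇒> h)))
      in p , λ i q → proj₁ (C′⁻ (sub i q))
    ... | no 1≰C′ = ⊥-elim (n≮0 (≤-trans (rest-dense (≰⇒> h)) (≤-reflexive
            (trans (cong₂ (λ u v → b * (u + 2 * v)) (cross-empty (E A) C′ C′ none) (cross-empty (E A) C′ N none)) (*-zeroʳ b)))))
      where
      none : ∀ i → ¬ (C′ i ≡ true)
      none i p = 1≰C′ (count-pos {P = C′} i p)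

  module _ (1≤a : 1 ≤ a) where
    open Sunflower {Piece} {n} proj₁

    -- The older piece y contains the kernel, and no edge of R lies inside y. So every pair that
    -- makes x dense has an end outside N and is counted by `τ`; nothing is lost when the kernel is
    -- removed.
    petal-of : ∀ N x y → Good x → Avoids x y → (∀ i → N i ≡ true → proj₁ x i ≡ true) → (∀ i → N i ≡ true → proj₁ y i ≡ true) →
               ∃ λ (p : Petal N) → ∀ i → Petal.C p i ≡ true → proj₁ x i ≡ true
    petal-of N (P , R) (Q , _) (1≤P , P≤M , dense , R⊆E) avoid N⊆P N⊆Q =
      let (p , sub) = component N (count Z) Z ≤-refl 1≤Z (≤-trans (count-mono {P = Z} {P} (λ i → proj₁ ∘ Z⁻)) P≤M)
            (λ p q → proj₂ (Z⁻ p) q) dense′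
      in p , λ i q → proj₁ (Z⁻ (sub i q))
      where
      Z : Fin n → Bool
      Z = outside N (P , R)
      Z⁻ : ∀ {i} → Z i ≡ true → P i ≡ true × ¬ (N i ≡ true)
      Z⁻ {i} p = let (q , s) = ∧-true⁻ {P i} p in q , λ c → true≢false c (not-true⁻ s)
      pairs≤τ : pairs R P ≤ τ N Z
      pairs≤τ = begin
        pairs R P
          ≤⟨ ∑∑-mono pointwise ⟩
        ∑ (λ i → ∑ λ j → X i j + (Y i j + Y j i))
          ≡⟨ ∑∑-+ X (λ i j → Y i j + Y j i) ⟩
        pairs (E A) Z + ∑ (λ i → ∑ λ j → Y i j + Y j i)
          ≡⟨ cong (pairs (E A) Z +_) (∑∑-+ Y (λ i j → Y j i)) ⟩
        pairs (E A) Z + (cross (E A) Z N + ∑ (λ i → ∑ λ j → Y j i))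
          ≡⟨ cong (λ c → pairs (E A) Z + (cross (E A) Z N + c)) (trans (∑-comm (λ i j → Y j i)) (sym (+-identityʳ _))) ⟩
        τ N Z ∎
        where
        open ≤-Reasoning
        X Y : Fin n → Fin n → ℕ
        X i j = 𝟙 (Z i ∧ (Z j ∧ E A i j))
        Y i j = 𝟙 (Z i ∧ (N j ∧ E A i j))
        pointwise : ∀ i j → 𝟙 (P i ∧ (P j ∧ R i j)) ≤ X i j + (Y i j + Y j i)
        pointwise i j with true? (P i ∧ (P j ∧ R i j))
        ... | no p = ≤-trans (≤-reflexive (cong 𝟙 (≢true⇒false p))) z≤n
        ... | yes p = ≤-trans (𝟙≤1 _) (cases (∧-true⁻ {P i} p))
          where
          cases : P i ≡ true × (P j ∧ R i j) ≡ true → 1 ≤ X i j + (Y i j + Y j i)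
          cases (pi , q) with ∧-true⁻ {P j} q
          ... | pj , e with true? (N i) | true? (N j)
          ...   | yes c | yes d = ⊥-elim (avoid (N⊆Q i c) (N⊆Q j d) e)
          ...   | yes c | no d = ≤-trans (≤-reflexive (sym (𝟙-true (∧-true⁺ (∧-true⁺ pj (not-true⁺ (≢true⇒false d))) (∧-true⁺ c (E-sym A (R⊆E e))))))) (≤-trans (m≤n+m (Y j i) (Y i j)) (m≤n+m _ (X i j)))
          ...   | no c | yes d = ≤-trans (≤-reflexive (sym (𝟙-true (∧-true⁺ (∧-true⁺ pi (not-true⁺ (≢true⇒false c))) (∧-true⁺ d (R⊆E e)))))) (≤-trans (m≤m+n (Y i j) (Y j i)) (m≤n+m _ (X i j)))
          ...   | no c | no d = ≤-trans (≤-reflexive (sym (𝟙-true (∧-true⁺ (∧-true⁺ pi (not-true⁺ (≢true⇒false c))) (∧-true⁺ (∧-true⁺ pj (not-true⁺ (≢true⇒false d))) (R⊆E e)))))) (m≤m+n (X i j) _)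
      dense′ : a * count Z ≤ b * τ N Z
      dense′ = ≤-trans (a ⊙ count-mono {P = Z} {P} (λ i → proj₁ ∘ Z⁻)) (≤-trans dense (b ⊙ pairs≤τ))
      1≤Z : 1 ≤ count Z
      1≤Z with 1 ≤? count Z
      ... | yes p = p
      ... | no p = ⊥-elim (n≮0 (≤-trans (*-mono-≤ 1≤a 1≤P) (≤-trans dense (≤-trans (b ⊙ pairs≤τ) (≤-reflexive
            (trans (cong₂ (λ u v → b * (u + 2 * v)) (cross-empty (E A) Z Z none) (cross-empty (E A) Z N none)) (*-zeroʳ b)))))))
        where
        none : ∀ i → ¬ (Z i ≡ true)
        none i q = p (count-pos {P = Z} i q)

    DisjointPetals : ∀ {N} → Petal N → Petal N → Set
    DisjointPetals p q = ∀ i → Petal.C p i ≡ true → Petal.C q i ≡ true → ⊥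

    -- Every piece but the oldest has an older one containing the kernel.
    petals-of : ∀ N xs → All Good xs → AllPairs Avoids xs → All (λ x → ∀ i → N i ≡ true → proj₁ x i ≡ true) xs →
                AllPairs (DisjointOutside N) xs →
                ∃ λ (ps : List (Petal N)) → length xs ≤ suc (length ps) × AllPairs DisjointPetals ps ×
                  (∀ z → All (DisjointOutside N z) xs → All (λ p → ∀ i → proj₁ z i ≡ true → Petal.C p i ≡ true → ⊥) ps)
    petals-of N [] _ _ _ _ = [] , z≤n , [] , λ _ _ → []
    petals-of N (x ∷ []) _ _ _ _ = [] , ≤-refl , [] , λ _ _ → []
    petals-of N (x ∷ y ∷ xs) (g ∷ gs) ((av ∷ _) ∷ avs) (k ∷ ks@(k′ ∷ _)) (d ∷ ds) =
      let (p , sub) = petal-of N x y g av k k′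
          (ps , len , disj , far) = petals-of N (y ∷ xs) gs avs ks ds
      in p ∷ ps , s≤s len , All.map (λ h i a b → h i (sub i a) b) (far x d) ∷ disj ,
         λ { z (dz ∷ dzs) → (λ i a b → Petal.off-kernel p b (dz i a (sub i b))) ∷ far z dzs }

    abundant-petals : ∀ q xs → All Good xs → AllPairs Avoids xs → flowerBound M (suc q) ≤ length xs →
                      ∃₂ λ N (ps : List (Petal N)) → q ≤ length ps × AllPairs DisjointPetals ps × count N ≤ M
    -- One more set than needed, as the oldest piece of the flower yields no petal.
    abundant-petals q xs gs av le with sunflower M (suc q) (λ _ → false) xs (All.map (λ _ _ ()) gs)
      (All.map (λ {x} (_ , P≤M , _) → ≤-trans (count-mono {P = outside (λ _ → false) x} {proj₁ x} (λ i p → proj₁ (∧-true⁻ {proj₁ x i} p))) P≤M) gs) le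
    ... | record { kernel = N ; petals = ys ; petals⊆ = sub ; enough = len ; kernel⊆ = k ; disjoint = d } =
      let gs′ = All-resp-⊆ sub gs
          (ps , len′ , disj , _) = petals-of N ys gs′ (AllPairs-⊆ sub av) k d
      in N , ps , s≤s⁻¹ (≤-trans len len′) , disj , N≤M ys gs′ k len
      where
      N≤M : ∀ ys → All Good ys → All (λ x → ∀ i → N i ≡ true → proj₁ x i ≡ true) ys → suc q ≤ length ys → count N ≤ M
      N≤M (y ∷ ys) ((_ , P≤M , _) ∷ _) (k ∷ _) _ = ≤-trans (count-mono {P = N} {proj₁ y} k) P≤M

-- Models are labelled by vertices of A: ρ v is the representative of the branch set of v, chosen in N
-- if possible.  Models agreeing on N can then be glued along N.
module Amalgam {n} (A : Adj n) (p W : ℕ) (N : Fin n → Bool) where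

  isRep : (Fin n → Maybe (Fin n)) → Fin n → Bool
  isRep ρ x = isAt x (ρ x)

  adjacent : (Fin n → Maybe (Fin n)) → Fin n → Fin n → Bool
  adjacent ρ x y = anyF λ u → anyF λ v → isAt x (ρ u) ∧ (isAt y (ρ v) ∧ E A u v)

  adjacent⁻ : ∀ ρ {x y} → adjacent ρ x y ≡ true → ∃₂ λ u v → ρ u ≡ just x × ρ v ≡ just y × E A u v ≡ true
  adjacent⁻ ρ {x} {y} h =
    let (u , h′) = anyF⁻ (λ u → anyF λ v → isAt x (ρ u) ∧ (isAt y (ρ v) ∧ E A u v)) h
        (v , h″) = anyF⁻ (λ v → isAt x (ρ u) ∧ (isAt y (ρ v) ∧ E A u v)) h′
        (a , b) = ∧-true⁻ {isAt x (ρ u)} h″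
        (c , d) = ∧-true⁻ {isAt y (ρ v)} b
    in u , v , isAt⁻ (ρ u) a , isAt⁻ (ρ v) c , d

  adjacent⁺ : ∀ ρ {x y u v} → ρ u ≡ just x → ρ v ≡ just y → E A u v ≡ true → adjacent ρ x y ≡ true
  adjacent⁺ ρ {x} {y} {u} {v} a b e = anyF⁺ (λ u → anyF λ v → isAt x (ρ u) ∧ (isAt y (ρ v) ∧ E A u v)) u
    (anyF⁺ (λ v → isAt x (ρ u) ∧ (isAt y (ρ v) ∧ E A u v)) v (∧-true⁺ (isAt⁺ (ρ u) a) (∧-true⁺ (isAt⁺ (ρ v) b) e)))

  -- One end must lie in the private set D, since pairs inside N would be counted again by every
  -- item.
  touch : (D : Fin n → Bool) → (Fin n → Maybe (Fin n)) → Fin n → Fin n → Bool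
  touch D ρ x y = (D x ∨ D y) ∧ (isRep ρ x ∧ (isRep ρ y ∧ (not (x == y) ∧ adjacent ρ x y)))

  Touch : (D : Fin n → Bool) → (Fin n → Maybe (Fin n)) → Fin n → Fin n → Set
  Touch D ρ x y = (D x ≡ true ⊎ D y ≡ true) × ρ x ≡ just x × ρ y ≡ just y × x ≢ y × adjacent ρ x y ≡ true

  touch⁻ : ∀ D ρ {x y} → touch D ρ x y ≡ true → Touch D ρ x y
  touch⁻ D ρ {x} {y} h =
    let (a , h₁) = ∧-true⁻ {D x ∨ D y} h
        (b , h₂) = ∧-true⁻ {isRep ρ x} h₁
        (c , h₃) = ∧-true⁻ {isRep ρ y} h₂
        (d , e) = ∧-true⁻ {not (x == y)} h₃
    in ∨-true⁻ a , isAt⁻ (ρ x) b , isAt⁻ (ρ y) c , (λ q → true≢false (==-true⁺ q) (not-true⁻ d)) , e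

  touch⁺ : ∀ D ρ {x y} → Touch D ρ x y → touch D ρ x y ≡ true
  touch⁺ D ρ {x} {y} (a , b , c , d , e) =
    ∧-true⁺ ([ ∨-true⁺ˡ , ∨-true⁺ʳ {D x} ]′ a) (∧-true⁺ (isAt⁺ (ρ x) b) (∧-true⁺ (isAt⁺ (ρ y) c) (∧-true⁺ (not-true⁺ (==-false⁺ d)) e)))

  -- Only representatives in D and pairs that touch D enter the density condition; both numbers add
  -- up when items with disjoint D are glued. By `root`, the trace on N takes its values in N, so
  -- there are boundedly many traces.
  record Item : Set where
    field
      D : Fin n → Bool
      ρ : Fin n → Maybe (Fin n)
      D∩N : ∀ {i} → D i ≡ true → N i ≡ true → ⊥
      supp : ∀ {v x} → ρ v ≡ just x → N v ≡ true ⊎ D v ≡ true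
      rep : ∀ {v x} → ρ v ≡ just x → ρ x ≡ just x
      path : ∀ {v x} → ρ v ≡ just x → Path A (λ w → ρ w ≡ just x) v x
      root : ∀ {v x} → N v ≡ true → ρ v ≡ just x → N x ≡ true
    newReps : ℕ
    newReps = count (λ x → D x ∧ isRep ρ x)
    newEdges : ℕ
    newEdges = ∑ λ x → ∑ λ y → 𝟙 (touch D ρ x y)
    field
      dense : 2 * (p + 2) * newReps ≤ W * newEdges

  open Item

  module _ (I J : Item) (agree : ∀ v → N v ≡ true → ρ I v ≡ ρ J v) (disjoint : ∀ i → D I i ≡ true → D J i ≡ true → ⊥) where

    private
      D′ : Fin n → Bool
      D′ v = D I v ∨ D J v
      ρ′ : Fin n → Maybe (Fin n)
      ρ′ v = if D J v then ρ J v else ρ I v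

    embedI : ∀ {v x} → ρ I v ≡ just x → ρ′ v ≡ just x
    embedI {v} h with D J v in e
    ... | false = h
    ... | true = case supp I h of λ where
      (inj₁ q) → ⊥-elim (D∩N J e q)
      (inj₂ q) → ⊥-elim (disjoint v q e)

    embedJ : ∀ {v x} → ρ J v ≡ just x → ρ′ v ≡ just x
    embedJ {v} h with D J v in e
    ... | true = h
    ... | false = case supp J h of λ where
      (inj₁ q) → trans (agree v q) h
      (inj₂ q) → ⊥-elim (true≢false q e)

    split : ∀ {v x} → ρ′ v ≡ just x → ρ I v ≡ just x ⊎ ρ J v ≡ just x
    split {v} h with D J v
    ... | true = inj₂ h
    ... | false = inj₁ h

    private
      reps-upper : count (λ x → D′ x ∧ isRep ρ′ x) ≤ newReps I + newReps J
      reps-upper = count-∪ {P = λ x → D I x ∧ isRep (ρ I) x} {λ x → D J x ∧ isRep (ρ J) x} λ x h →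
        let (a , b) = ∧-true⁻ {D′ x} h in cases x (∨-true⁻ {D I x} a) (split (isAt⁻ (ρ′ x) b))
        where
        cases : ∀ x → D I x ≡ true ⊎ D J x ≡ true → ρ I x ≡ just x ⊎ ρ J x ≡ just x →
                (D I x ∧ isRep (ρ I) x) ≡ true ⊎ (D J x ∧ isRep (ρ J) x) ≡ true
        cases x (inj₁ a) (inj₁ b) = inj₁ (∧-true⁺ a (isAt⁺ (ρ I x) b))
        cases x (inj₂ a) (inj₂ b) = inj₂ (∧-true⁺ a (isAt⁺ (ρ J x) b))
        cases x (inj₁ a) (inj₂ b) = case supp J b of λ where
          (inj₁ q) → ⊥-elim (D∩N I a q)
          (inj₂ q) → ⊥-elim (disjoint x a q)
        cases x (inj₂ a) (inj₁ b) = case supp I b of λ where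
          (inj₁ q) → ⊥-elim (D∩N J a q)
          (inj₂ q) → ⊥-elim (disjoint x q a)

      reps-lower : newReps I + newReps J ≤ count (λ x → D′ x ∧ isRep ρ′ x)
      reps-lower = count-⊎ {P = λ x → D I x ∧ isRep (ρ I) x} {λ x → D J x ∧ isRep (ρ J) x}
        (λ x h → let (a , b) = ∧-true⁻ {D I x} h in ∧-true⁺ (∨-true⁺ˡ a) (isAt⁺ (ρ′ x) (embedI (isAt⁻ (ρ I x) b))))
        (λ x h → let (a , b) = ∧-true⁻ {D J x} h in ∧-true⁺ (∨-true⁺ʳ {D I x} a) (isAt⁺ (ρ′ x) (embedJ (isAt⁻ (ρ J x) b))))
        (λ x h k → disjoint x (proj₁ (∧-true⁻ {D I x} h)) (proj₁ (∧-true⁻ {D J x} k)))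

      edges-lower : newEdges I + newEdges J ≤ ∑ (λ x → ∑ λ y → 𝟙 (touch D′ ρ′ x y))
      edges-lower = ≤-trans (≤-reflexive (sym (∑∑-+ (λ x y → 𝟙 (touch (D I) (ρ I) x y)) (λ x y → 𝟙 (touch (D J) (ρ J) x y)))))
        (∑∑-mono λ x y → 𝟙-+ {touch (D I) (ρ I) x y} {touch (D J) (ρ J) x y} {touch D′ ρ′ x y}
          (λ h → touch⁺ D′ ρ′ (fromI (touch⁻ (D I) (ρ I) h)))
          (λ h → touch⁺ D′ ρ′ (fromJ (touch⁻ (D J) (ρ J) h)))
          (λ h k → exclusive (touch⁻ (D I) (ρ I) h) (touch⁻ (D J) (ρ J) k)))
        where
        fromI : ∀ {x y} → Touch (D I) (ρ I) x y → Touch D′ ρ′ x y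
        fromI {x} {y} (a , b , c , d , e) = let (u , v , q , r , s) = adjacent⁻ (ρ I) e in
          [ inj₁ ∘ ∨-true⁺ˡ , inj₂ ∘ ∨-true⁺ˡ ]′ a , embedI b , embedI c , d , adjacent⁺ ρ′ (embedI q) (embedI r) s
        fromJ : ∀ {x y} → Touch (D J) (ρ J) x y → Touch D′ ρ′ x y
        fromJ {x} {y} (a , b , c , d , e) = let (u , v , q , r , s) = adjacent⁻ (ρ J) e in
          [ inj₁ ∘ ∨-true⁺ʳ {D I x} , inj₂ ∘ ∨-true⁺ʳ {D I y} ]′ a , embedJ b , embedJ c , d , adjacent⁺ ρ′ (embedJ q) (embedJ r) s
        foreign : ∀ {x} → D I x ≡ true → ρ J x ≡ just x → ⊥
        foreign a b = case supp J b of λ where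
          (inj₁ q) → D∩N I a q
          (inj₂ q) → disjoint _ a q
        exclusive : ∀ {x y} → Touch (D I) (ρ I) x y → Touch (D J) (ρ J) x y → ⊥
        exclusive (inj₁ a , _) (_ , b , _) = foreign a b
        exclusive (inj₂ a , _) (_ , _ , c , _) = foreign a c

    -- A branch set that meets N may come from both items. Each of its two halves is connected to
    -- the common representative, so the union is connected.
    mergeItems : Item
    mergeItems = record
      { D = D′
      ; ρ = ρ′
      ; D∩N = λ {i} a b → [ (λ q → D∩N I q b) , (λ q → D∩N J q b) ]′ (∨-true⁻ {D I i} a)
      ; supp = λ {v} h → case split h of λ where
          (inj₁ q) → map₂ ∨-true⁺ˡ (supp I q)
          (inj₂ q) → map₂ (∨-true⁺ʳ {D I v}) (supp J q)
      ; rep = λ h → [ embedI ∘ rep I , embedJ ∘ rep J ]′ (split h)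
      ; path = λ h → [ (λ q → path-map id embedI id (path I q)) , (λ q → path-map id embedJ id (path J q)) ]′ (split h)
      ; root = λ a h → [ root I a , root J a ]′ (split h)
      ; dense = arith (2 * (p + 2)) W _ _ _ _ _ _ reps-upper edges-lower (dense I) (dense J)
      }
      where
      arith : ∀ c W r r₁ r₂ e e₁ e₂ → r ≤ r₁ + r₂ → e₁ + e₂ ≤ e → c * r₁ ≤ W * e₁ → c * r₂ ≤ W * e₂ → c * r ≤ W * e
      arith c W r r₁ r₂ e e₁ e₂ h₁ h₂ h₃ h₄ = lin (c ⊙ h₁ ⊕ W ⊙ h₂ ⊕ h₃ ⊕ h₄) 0 (identity c W r r₁ r₂ e e₁ e₂)
        where
        identity : ∀ c W r r₁ r₂ e e₁ e₂ → c * r + (c * (r₁ + r₂) + (W * e + (W * e₁ + W * e₂))) + 0 ≡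
                                           W * e + (c * r + (W * (e₁ + e₂) + (c * r₁ + c * r₂)))
        identity = solve-∀

    mergeItems-reps : newReps I + newReps J ≤ newReps mergeItems
    mergeItems-reps = reps-lower

    mergeItems-trace : ∀ v → N v ≡ true → ρ mergeItems v ≡ ρ I v
    mergeItems-trace v h with D J v in e
    ... | false = refl
    ... | true = ⊥-elim (D∩N J e h)

  mergeAll : (ν : Fin n → Maybe (Fin n)) → ∀ I Is → All (λ I → ∀ v → N v ≡ true → ρ I v ≡ ν v) (I ∷ Is) →
             AllPairs (λ I J → ∀ i → D I i ≡ true → D J i ≡ true → ⊥) (I ∷ Is) → All (λ I → 1 ≤ newReps I) (I ∷ Is) →
             ∃ λ T → length (I ∷ Is) ≤ newReps T × (∀ v → N v ≡ true → ρ T v ≡ ν v) ×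
               (∀ Z → All (λ I → ∀ i → Z i ≡ true → D I i ≡ true → ⊥) (I ∷ Is) → ∀ i → Z i ≡ true → D T i ≡ true → ⊥)
  mergeAll ν I [] (t ∷ []) _ (r ∷ []) = I , r , t , λ { Z (z ∷ []) → z }
  mergeAll ν I (J ∷ Js) (t ∷ ts) (d ∷ ds) (r ∷ rs) =
    let (T , len , tr , far) = mergeAll ν J Js ts ds rs
        agree = λ v h → trans (t v h) (sym (tr v h))
        disj = far (D I) d
    in mergeItems I T agree disj , ≤-trans (r ⊕ len) (mergeItems-reps I T agree disj) ,
       (λ v h → trans (mergeItems-trace I T agree disj v h) (t v h)) ,
       λ { Z (z ∷ zs) i a b → [ z i a , far Z zs i a ]′ (∨-true⁻ {D I i} b) }

  -- The vertices are the representatives. Those outside D lie in N and are not counted by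
  -- `newReps`, which gives the upper bound on h.
  item-graph : ∀ I → ∃₂ λ h (H : Adj h) → Model H A × newReps I ≤ h × h ≤ newReps I + count N ×
                     2 * (p + 2) * newReps I ≤ W * edges₂ H
  item-graph I = count R , H , model , lower , upper , ≤-trans (dense I) (W ⊙ edges-≥)
    where
    R : Fin n → Bool
    R = isRep (ρ I)
    H : Adj (count R)
    H x y = adjacent (ρ I) (enum R x) (enum R y)
    f : Fin n → Maybe (Fin (count R))
    f v = ρ I v >>= locate R
    f⁺ : ∀ v k → ρ I v ≡ just (enum R k) → f v ≡ just k
    f⁺ v k h = trans (cong (_>>= locate R) h) (locate⁺ R k)
    f⁻ : ∀ v {k} → f v ≡ just k → ρ I v ≡ just (enum R k)
    f⁻ v h = let (x , a , b) = >>=-just⁻ (ρ I v) h in trans a (cong just (sym (locate⁻ R x b)))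
    model : Model H A
    model = record
      { f = f
      ; onto = λ k → enum R k , f⁺ (enum R k) k (isAt⁻ (ρ I (enum R k)) (enum-∈ R k))
      ; conn = λ {u} {v} {k} a b → path-map id (λ {w} → f⁺ w k) id (path-trans (path I (f⁻ u a)) (path-sym (path I (f⁻ v b))))
      ; edge = λ {x} {y} e → case proj₂ (E-true⁻ H {x} {y} e) of λ where
          (inj₁ q) → let (u , v , a , b , c) = adjacent⁻ (ρ I) q in u , v , f⁺ u x a , f⁺ v y b , c
          (inj₂ q) → let (u , v , a , b , c) = adjacent⁻ (ρ I) q in v , u , f⁺ v x b , f⁺ u y a , E-sym A c
      }
    lower : newReps I ≤ count R
    lower = count-mono {P = λ x → D I x ∧ R x} {R} (λ x h → proj₂ (∧-true⁻ {D I x} h))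
    upper : count R ≤ newReps I + count N
    upper = count-∪ {P = λ x → D I x ∧ R x} {N} {R} λ x h → case supp I (isAt⁻ (ρ I x) h) of λ where
      (inj₁ q) → inj₂ q
      (inj₂ q) → inj₁ (∧-true⁺ q h)
    G : Fin n → Fin n → ℕ
    G x y = 𝟙 (not (x == y) ∧ adjacent (ρ I) x y)
    edges-≥ : newEdges I ≤ edges₂ H
    edges-≥ = begin
      newEdges I
        ≤⟨ ∑∑-mono pointwise ⟩
      ∑ (λ x → ∑ λ y → 𝟙 (R x) * (𝟙 (R y) * G x y))
        ≡⟨ ∑-cong {n} (λ x → ∑-*ˡ (𝟙 (R x)) (λ y → 𝟙 (R y) * G x y)) ⟩
      ∑ (λ x → 𝟙 (R x) * ∑ (λ y → 𝟙 (R y) * G x y))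
        ≡⟨ ∑-enum R (λ x → ∑ (λ y → 𝟙 (R y) * G x y)) ⟨
      ∑ (λ x → ∑ (λ y → 𝟙 (R y) * G (enum R x) y))
        ≡⟨ ∑-cong {count R} (λ x → ∑-enum R (G (enum R x))) ⟨
      ∑ (λ x → ∑ (λ y → G (enum R x) (enum R y)))
        ≤⟨ ∑∑-mono (λ x y → 𝟙-mono {not (enum R x == enum R y) ∧ adjacent (ρ I) (enum R x) (enum R y)} {E H x y} (back x y)) ⟩
      edges₂ H ∎
      where
      open ≤-Reasoning
      pointwise : ∀ x y → 𝟙 (touch (D I) (ρ I) x y) ≤ 𝟙 (R x) * (𝟙 (R y) * G x y)
      pointwise x y = ≤-trans (𝟙-mono {touch (D I) (ρ I) x y} {R x ∧ (R y ∧ (not (x == y) ∧ adjacent (ρ I) x y))}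
        (λ h → proj₂ (∧-true⁻ {D I x ∨ D I y} h)))
        (≤-reflexive (trans (𝟙-∧ (R x) _) (cong (𝟙 (R x) *_) (𝟙-∧ (R y) _))))
      back : ∀ x y → (not (enum R x == enum R y) ∧ adjacent (ρ I) (enum R x) (enum R y)) ≡ true → E H x y ≡ true
      back x y h = let (a , b) = ∧-true⁻ {not (enum R x == enum R y)} h in
        E-true⁺ H {x} {y} (λ q → true≢false (==-true⁺ (cong (enum R) q)) (not-true⁻ a)) (inj₁ b)

-- Items built from single petals and from groups of petals

module FromPetals {n} (A : Adj n) (M p W K : ℕ) (W≡2K : W ≡ 2 * K) (1≤W : 1 ≤ W) where

  open Extract A M (suc (4 * p)) (2 * W)
  open Overfull p W

  neighbours : (N C : Fin n → Bool) → Fin n → Bool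
  neighbours N C x = N x ∧ anyF (λ i → C i ∧ E A i x)

  neighbours⁻ : ∀ {N C x} → neighbours N C x ≡ true → N x ≡ true × ∃ λ i → C i ≡ true × E A i x ≡ true
  neighbours⁻ {N} {C} {x} h = let (a , b) = ∧-true⁻ {N x} h ; (i , c) = anyF⁻ (λ i → C i ∧ E A i x) b in a , i , ∧-true⁻ c

  neighbours⁺ : ∀ {N C x i} → N x ≡ true → C i ≡ true → E A i x ≡ true → neighbours N C x ≡ true
  neighbours⁺ {N} {C} {x} {i} a b c = ∧-true⁺ a (anyF⁺ (λ i → C i ∧ E A i x) i (∧-true⁺ b c))

  -- Petals have 4 p + 1 instead of 4 p in units of 1 / (4 W). Over m₀ vertices this excess pays for
  -- the vertices of N′, at most M, and for the additive terms in `Over`.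
  m₀ : ℕ
  m₀ = 4 * p * suc M + 4 * W

  module _ {N : Fin n → Bool} (N′ : Fin n → Bool) where

    open Amalgam A p W N′

    Attached : Petal N → Set
    Attached q = ∀ x → neighbours N (Petal.C q) x ≡ N′ x

    module _ (q : Petal N) (att : Attached q) where
      open Petal q

      N′⇒N : ∀ {x} → N′ x ≡ true → N x ≡ true
      N′⇒N {x} h = proj₁ (neighbours⁻ {N} {C} (trans (att x) h))

      attach-edge : ∀ {x} → N′ x ≡ true → ∃ λ i → C i ≡ true × E A i x ≡ true
      attach-edge {x} h = proj₂ (neighbours⁻ {N} {C} (trans (att x) h))

      C∩N′ : ∀ {x} → C x ≡ true → N′ x ≡ true → ⊥
      C∩N′ a b = off-kernel a (N′⇒N b)

      star-ρ : Fin n → Maybe (Fin n)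
      star-ρ v = if C v then just root else (if N′ v then just v else nothing)

      star-C : ∀ {v} → C v ≡ true → star-ρ v ≡ just root
      star-C h rewrite h = refl

      star-N : ∀ {v} → N′ v ≡ true → star-ρ v ≡ just v
      star-N {v} h rewrite ≢true⇒false (λ c → C∩N′ {v} c h) | h = refl

      star⁻ : ∀ {v x} → star-ρ v ≡ just x → (C v ≡ true × x ≡ root) ⊎ (N′ v ≡ true × x ≡ v)
      star⁻ {v} h with C v
      star⁻ {v} refl | true = inj₁ (refl , refl)
      ... | false with N′ v
      star⁻ {v} refl | false | true = inj₂ (refl , refl)

      -- The contracted petal is the only new representative and is joined to all of N′, so the
      -- density required of an item is the hypothesis.
      starItem : p + 2 ≤ W * count N′ → Item
      starItem many = record
        { D = C
        ; ρ = star-ρ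
        ; D∩N = C∩N′
        ; supp = λ h → case star⁻ h of λ where
            (inj₁ (a , _)) → inj₂ a
            (inj₂ (a , _)) → inj₁ a
        ; rep = λ h → case star⁻ h of λ where
            (inj₁ (_ , refl)) → star-C root∈
            (inj₂ (_ , refl)) → h
        ; path = λ h → case star⁻ h of λ where
            (inj₁ (a , refl)) → path-map id star-C id (connected a)
            (inj₂ (_ , refl)) → stop h
        ; root = λ a h → case star⁻ h of λ where
            (inj₁ (b , _)) → ⊥-elim (C∩N′ b a)
            (inj₂ (_ , refl)) → a
        ; dense = arith (p + 2) W (count N′) _ _ reps spokes many
        }
        where
        reps : count (λ x → C x ∧ isRep star-ρ x) ≤ 1
        reps = ≤-trans (count-mono {P = λ x → C x ∧ isRep star-ρ x} {_== root} λ x h →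
          let (a , b) = ∧-true⁻ {C x} h in ==-true⁺ (just-injective (trans (sym (isAt⁻ (star-ρ x) b)) (star-C a)))) (count-== root)
        Y Z : Fin n → Fin n → ℕ
        Y x y = 𝟙 ((x == root) ∧ N′ y)
        Z x y = 𝟙 ((y == root) ∧ N′ x)
        row : count N′ ≤ ∑ (λ x → ∑ (Y x))
        row = ≤-trans (≤-reflexive (∑-cong {n} λ y → cong 𝟙 (sym (cong (_∧ N′ y) (==-true⁺ {i = root} refl)))))
          (∑-single (λ x → ∑ (Y x)) root)
        centre : ∀ {x y} → ((x == root) ∧ N′ y) ≡ true → Touch C star-ρ x y
        centre {x} {y} h with ∧-true⁻ {x == root} h
        ... | a , b with ==-true⁻ {i = x} a
        ...   | refl = let (i , c , e) = attach-edge b in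
          inj₁ root∈ , star-C root∈ , star-N b , (λ { refl → C∩N′ root∈ b }) , adjacent⁺ star-ρ (star-C c) (star-N b) e
        flip : ∀ {x y} → Touch C star-ρ x y → Touch C star-ρ y x
        flip (a , b , c , d , e) = let (u , v , f , g , r) = adjacent⁻ star-ρ e in
          [ inj₂ , inj₁ ]′ a , c , b , d ∘ sym , adjacent⁺ star-ρ g f (E-sym A r)
        spokes : count N′ + count N′ ≤ ∑ (λ x → ∑ λ y → 𝟙 (touch C star-ρ x y))
        spokes = ≤-trans (row ⊕ ≤-trans row (≤-reflexive (∑-comm Y))) (≤-trans (≤-reflexive (sym (∑∑-+ Y Z)))
          (∑∑-mono λ x y → 𝟙-+ {(x == root) ∧ N′ y} {(y == root) ∧ N′ x} {touch C star-ρ x y}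
            (λ h → touch⁺ C star-ρ (centre h)) (λ h → touch⁺ C star-ρ (flip (centre h))) (exclusive x y)))
          where
          exclusive : ∀ x y → ((x == root) ∧ N′ y) ≡ true → ((y == root) ∧ N′ x) ≡ true → ⊥
          exclusive x y h k = C∩N′ (subst (λ z → C z ≡ true) (sym (==-true⁻ (proj₁ (∧-true⁻ {x == root} h)))) root∈) (proj₂ (∧-true⁻ {y == root} k))
        arith : ∀ c W r nr e → nr ≤ 1 → r + r ≤ e → c ≤ W * r → 2 * c * nr ≤ W * e
        arith c W r nr e h₁ h₂ h₃ = lin ((2 * c) ⊙ h₁ ⊕ W ⊙ h₂ ⊕ 2 ⊙ h₃) 0 (identity c W r nr e)
          where
          identity : ∀ c W r nr e → 2 * c * nr + (2 * c * 1 + (W * e + 2 * (W * r))) + 0 ≡ W * e + (2 * c * nr + (W * (r + r) + 2 * c))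
          identity = solve-∀

      star-reps : ∀ many → 1 ≤ Item.newReps (starItem many)
      star-reps many = count-pos {P = λ x → C x ∧ isRep star-ρ x} root (∧-true⁺ root∈ (isAt⁺ (star-ρ root) (star-C root∈)))

    record Group (m : ℕ) : Set where
      field
        D : Fin n → Bool
        off : ∀ {i} → D i ≡ true → N′ i ≡ true → ⊥
        large : m ≤ count D
        small : count D ≤ m * M
        dense : suc (4 * p) * count D ≤ 2 * W * pairs (E A) (λ v → N′ v ∨ D v)

    Apart : (Z : Fin n → Bool) → Petal N → Set
    Apart Z q = ∀ i → Z i ≡ true → Petal.C q i ≡ true → ⊥

    -- All edges from the petal to the kernel end in N′. Since C is disjoint from N′ and from D, the
    -- pairs counted by `τ` are new in N′ ∪ D′.
    addPetal : ∀ {m} (G : Group m) (q : Petal N) → Attached q → Apart (Group.D G) q → Group (suc m)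
    addPetal {m} G q att apart = record
      { D = D′
      ; off = λ {i} h k → [ (λ a → C∩N′ q att a k) , (λ a → off a k) ]′ (∨-true⁻ {C i} h)
      ; large = ≤-trans (count-pos {P = C} root root∈ ⊕ large) (count-⊎ {P = C} {D} {D′} (λ i → ∨-true⁺ˡ) (λ i → ∨-true⁺ʳ {C i}) (λ i a b → apart i b a))
      ; small = ≤-trans D′≤ (Petal.small q ⊕ small)
      ; dense = arith (suc (4 * p)) (2 * W) (count D) (count C) (count D′) (pairs (E A) (λ v → N′ v ∨ D v)) (pairs (E A) C)
          (cross (E A) C N) (cross (E A) C N′) (pairs (E A) (λ v → N′ v ∨ D′ v)) D′≤ dense (Petal.dense q) cross≤ more
      }
      where
      open Petal q using (C; root; root∈)
      open Group G
      D′ : Fin n → Bool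
      D′ i = C i ∨ D i
      D′≤ : count D′ ≤ count C + count D
      D′≤ = count-∪ {P = C} {D} {D′} (λ i → ∨-true⁻ {C i})
      cross≤ : cross (E A) C N ≤ cross (E A) C N′
      cross≤ = ∑∑-mono λ i j → 𝟙-mono {C i ∧ (N j ∧ E A i j)} λ h →
        let (a , b) = ∧-true⁻ {C i} h ; (c , e) = ∧-true⁻ {N j} b in
        ∧-true⁺ a (∧-true⁺ (trans (sym (att j)) (neighbours⁺ {N} {C} c a e)) e)
      more : pairs (E A) (λ v → N′ v ∨ D v) + (pairs (E A) C + (cross (E A) C N′ + cross (E A) C N′)) ≤ pairs (E A) (λ v → N′ v ∨ D′ v)
      more = ≤-trans (≤-reflexive (sym sums)) (∑∑-mono λ i j → ≤-trans (+-monoʳ-≤ (𝟙 (X i j)) (≤-trans (+-monoʳ-≤ (𝟙 (Y i j)) (ZZ i j)) (YZ i j))) (XYZ i j))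
        where
        X Y Z : Fin n → Fin n → Bool
        X i j = (N′ i ∨ D i) ∧ ((N′ j ∨ D j) ∧ E A i j)
        Y i j = C i ∧ (C j ∧ E A i j)
        Z i j = C i ∧ (N′ j ∧ E A i j)
        sums : ∑ (λ i → ∑ λ j → 𝟙 (X i j) + (𝟙 (Y i j) + (𝟙 (Z i j) + 𝟙 (Z j i)))) ≡
               pairs (E A) (λ v → N′ v ∨ D v) + (pairs (E A) C + (cross (E A) C N′ + cross (E A) C N′))
        sums = trans (∑∑-+ (λ i j → 𝟙 (X i j)) (λ i j → 𝟙 (Y i j) + (𝟙 (Z i j) + 𝟙 (Z j i)))) (cong (pairs (E A) (λ v → N′ v ∨ D v) +_)
          (trans (∑∑-+ (λ i j → 𝟙 (Y i j)) (λ i j → 𝟙 (Z i j) + 𝟙 (Z j i))) (cong (pairs (E A) C +_)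
          (trans (∑∑-+ (λ i j → 𝟙 (Z i j)) (λ i j → 𝟙 (Z j i))) (cong (cross (E A) C N′ +_) (∑-comm (λ i j → 𝟙 (Z j i))))))))
        Z⁻ : ∀ {i j} → Z i j ≡ true → C i ≡ true × N′ j ≡ true × E A i j ≡ true
        Z⁻ {i} {j} h = let (a , b) = ∧-true⁻ {C i} h in a , ∧-true⁻ {N′ j} b
        Y⁻ : ∀ {i j} → Y i j ≡ true → C i ≡ true × C j ≡ true × E A i j ≡ true
        Y⁻ {i} {j} h = let (a , b) = ∧-true⁻ {C i} h in a , ∧-true⁻ {C j} b
        X⁻ : ∀ {i j} → X i j ≡ true → (N′ i ∨ D i) ≡ true × (N′ j ∨ D j) ≡ true × E A i j ≡ true
        X⁻ {i} {j} h = let (a , b) = ∧-true⁻ {N′ i ∨ D i} h in a , ∧-true⁻ {N′ j ∨ D j} b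
        ZZ : ∀ i j → 𝟙 (Z i j) + 𝟙 (Z j i) ≤ 𝟙 (Z i j ∨ Z j i)
        ZZ i j = 𝟙-+ {Z i j} {Z j i} ∨-true⁺ˡ (∨-true⁺ʳ {Z i j}) λ h k → C∩N′ q att (proj₁ (Z⁻ h)) (proj₁ (proj₂ (Z⁻ k)))
        YZ : ∀ i j → 𝟙 (Y i j) + 𝟙 (Z i j ∨ Z j i) ≤ 𝟙 (Y i j ∨ (Z i j ∨ Z j i))
        YZ i j = 𝟙-+ {Y i j} {Z i j ∨ Z j i} ∨-true⁺ˡ (∨-true⁺ʳ {Y i j}) λ h k → case ∨-true⁻ {Z i j} k of λ where
          (inj₁ z) → C∩N′ q att (proj₁ (proj₂ (Y⁻ h))) (proj₁ (proj₂ (Z⁻ z)))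
          (inj₂ z) → C∩N′ q att (proj₁ (Y⁻ h)) (proj₁ (proj₂ (Z⁻ z)))
        old : ∀ {i} → (N′ i ∨ D i) ≡ true → (N′ i ∨ D′ i) ≡ true
        old {i} h = [ ∨-true⁺ˡ , (λ d → ∨-true⁺ʳ {N′ i} (∨-true⁺ʳ {C i} d)) ]′ (∨-true⁻ {N′ i} h)
        new : ∀ {i} → C i ≡ true → (N′ i ∨ D′ i) ≡ true
        new {i} h = ∨-true⁺ʳ {N′ i} (∨-true⁺ˡ h)
        clash : ∀ {i} → (N′ i ∨ D i) ≡ true → C i ≡ true → ⊥
        clash {i} h c = [ C∩N′ q att c , (λ d → apart i d c) ]′ (∨-true⁻ {N′ i} h)
        YZ⁻ : ∀ i j → (Y i j ∨ (Z i j ∨ Z j i)) ≡ true → (C i ≡ true × (N′ j ∨ D′ j) ≡ true × E A i j ≡ true) ⊎ (C j ≡ true × (N′ i ∨ D′ i) ≡ true × E A i j ≡ true)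
        YZ⁻ i j h with ∨-true⁻ {Y i j} h
        ... | inj₁ y = let (a , b , e) = Y⁻ y in inj₁ (a , new b , e)
        ... | inj₂ k with ∨-true⁻ {Z i j} k
        ...   | inj₁ z = let (a , b , e) = Z⁻ z in inj₁ (a , ∨-true⁺ˡ b , e)
        ...   | inj₂ z = let (a , b , e) = Z⁻ z in inj₂ (a , ∨-true⁺ˡ b , E-sym A e)
        XYZ : ∀ i j → 𝟙 (X i j) + 𝟙 (Y i j ∨ (Z i j ∨ Z j i)) ≤ 𝟙 ((N′ i ∨ D′ i) ∧ ((N′ j ∨ D′ j) ∧ E A i j))
        XYZ i j = 𝟙-+ {X i j} {Y i j ∨ (Z i j ∨ Z j i)}
          (λ h → let (a , b , e) = X⁻ h in ∧-true⁺ (old a) (∧-true⁺ (old b) e))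
          (λ h → case YZ⁻ i j h of λ where
            (inj₁ (a , b , e)) → ∧-true⁺ (new a) (∧-true⁺ b e)
            (inj₂ (a , b , e)) → ∧-true⁺ b (∧-true⁺ (new a) e))
          (λ h k → let (a , b , e) = X⁻ h in case YZ⁻ i j k of λ where
            (inj₁ (c , _)) → clash a c
            (inj₂ (c , _)) → clash b c)
      arith : ∀ a b d c d′ s x y y′ t → d′ ≤ c + d → a * d ≤ b * s → a * c ≤ b * (x + 2 * y) → y ≤ y′ → s + (x + (y′ + y′)) ≤ t → a * d′ ≤ b * t
      arith a b d c d′ s x y y′ t h₁ h₂ h₃ h₄ h₅ = lin (a ⊙ h₁ ⊕ h₂ ⊕ h₃ ⊕ (2 * b) ⊙ h₄ ⊕ b ⊙ h₅) 0 (identity a b d c d′ s x y y′ t)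
        where
        identity : ∀ a b d c d′ s x y y′ t → a * d′ + (a * (c + d) + (b * s + (b * (x + 2 * y) + (2 * b * y′ + b * t)))) + 0 ≡
                   b * t + (a * d′ + (a * d + (a * c + (2 * b * y + b * (s + (x + (y′ + y′)))))))
        identity = solve-∀

    Disj : Petal N → Petal N → Set
    Disj p q = ∀ i → Petal.C p i ≡ true → Petal.C q i ≡ true → ⊥

    -- The last component transfers separation from the petals to the group and to the remaining
    -- petals, as the induction needs for the next petal.
    takeGroup : ∀ m ps → m ≤ length ps → All Attached ps → AllPairs Disj ps →
                ∃₂ λ (G : Group m) qs → length ps ≡ m + length qs × All Attached qs × AllPairs Disj qs × All (Apart (Group.D G)) qs ×
                  (∀ Z → All (Apart Z) ps → (∀ i → Z i ≡ true → Group.D G i ≡ true → ⊥) × All (Apart Z) qs)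
    takeGroup zero ps _ att disj = empty , ps , refl , att , disj , All.map (λ _ i ()) att , λ Z z → (λ i _ ()) , z
      where
      empty : Group 0
      empty = record { D = λ _ → false ; off = λ () ; large = z≤n ; small = ≤-reflexive (count-false n)
        ; dense = ≤-trans (≤-reflexive (trans (cong (suc (4 * p) *_) (count-false n)) (*-zeroʳ (suc (4 * p))))) z≤n }
    takeGroup (suc m) (q ∷ ps) (s≤s le) (at ∷ att) (d ∷ disj) =
      let (G , qs , len , att′ , disj′ , apart , far) = takeGroup m ps le att disj
          (C∩D , C∩qs) = far (Petal.C q) d
      in addPetal G q at (λ i a b → C∩D i b a) , qs , cong suc len , att′ , disj′ ,
         All.map (λ (a , b) i h k → [ (λ c → b i c k) , (λ c → a i c k) ]′ (∨-true⁻ {Petal.C q i} h)) (All.zip (apart , C∩qs)) ,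
         λ { Z (z ∷ zs) → let (x , y) = far Z zs in
           (λ i a b → [ z i a , x i a ]′ (∨-true⁻ {Petal.C q i} b)) , y }

    GroupDisj : ∀ {m} → Group m → Group m → Set
    GroupDisj G G′ = ∀ i → Group.D G i ≡ true → Group.D G′ i ≡ true → ⊥

    chunk : ∀ m g ps → g * m ≤ length ps → All Attached ps → AllPairs Disj ps →
            ∃ λ (Gs : List (Group m)) → length Gs ≡ g × AllPairs GroupDisj Gs ×
              (∀ Z → All (Apart Z) ps → All (λ G → ∀ i → Z i ≡ true → Group.D G i ≡ true → ⊥) Gs)
    chunk m zero ps _ _ _ = [] , refl , [] , λ _ _ → []
    chunk m (suc g) ps le att disj =
      let (G , qs , len , att′ , disj′ , apart , far) = takeGroup m ps (≤-trans (m≤m+n m (g * m)) le) att disj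
          (Gs , len′ , disj″ , far′) = chunk m g qs (+-cancelˡ-≤ m _ _ (≤-trans le (≤-reflexive len))) att′ disj′
      in G ∷ Gs , cong suc len′ , far′ (Group.D G) apart ∷ disj″ ,
         λ Z z → let (x , y) = far Z z in x ∷ far′ Z y

    module _ (N′≤M : count N′ ≤ M) (G : Group m₀) where
      open Group G

      private
        S : Fin n → Bool
        S v = N′ v ∨ D v

      group-size : count S < suc (M + m₀ * M)
      group-size = s≤s (≤-trans (count-∪ {P = N′} {D} {S} (λ v → ∨-true⁻ {N′ v})) (N′≤M ⊕ small))

      group-over : Over (induced A S)
      group-over = subst (λ e → 2 * (p * suc (count S) + W) ≤ W * e) (sym (edges₂-induced A S))
        (*-cancelˡ-≤ 2 (arith p W M (count D) (count S) (pairs (E A) S)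
          (≤-trans (count-∪ {P = N′} {D} {S} (λ v → ∨-true⁻ {N′ v})) (+-monoˡ-≤ (count D) N′≤M)) large dense))
        where
        arith : ∀ p W M d s e → s ≤ M + d → 4 * p * suc M + 4 * W ≤ d → suc (4 * p) * d ≤ 2 * W * e → 2 * (2 * (p * suc s + W)) ≤ 2 * (W * e)
        arith p W M d s e h₁ h₂ h₃ = lin ((4 * p) ⊙ h₁ ⊕ h₂ ⊕ h₃) 0 (identity p W M d s e)
          where
          identity : ∀ p W M d s e → 2 * (2 * (p * suc s + W)) + (4 * p * (M + d) + (d + 2 * W * e)) + 0 ≡
                                     2 * (W * e) + (4 * p * s + (4 * p * suc M + 4 * W + suc (4 * p) * d))
          identity = solve-∀

    module _ (few : W * count N′ ≤ suc p) (D : Fin n → Bool) (off : ∀ {i} → D i ≡ true → N′ i ≡ true → ⊥)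
             {h} (H : Adj h) (h≤K : h ≤ K) (over : Over H) (Mod : Model H A)
             (inside : ∀ {v x} → Model.f Mod v ≡ just x → (N′ v ∨ D v) ≡ true) where

      private
        open Model Mod

        -- A branch set that meets N′ is represented there, as `root` demands.
        pickRep : ∀ x → Dec (∃ λ v → (N′ v ∧ isAt x (f v)) ≡ true) → Fin n
        pickRep x (yes (v , _)) = v
        pickRep x (no _) = proj₁ (onto x)

        has? : ∀ x → Dec (∃ λ v → (N′ v ∧ isAt x (f v)) ≡ true)
        has? x = any? (λ v → true? (N′ v ∧ isAt x (f v)))

        repOf : Fin h → Fin n
        repOf x = pickRep x (has? x)

        f-repOf : ∀ x → f (repOf x) ≡ just x
        f-repOf x = cases (has? x)
          where
          cases : ∀ d → f (pickRep x d) ≡ just x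
          cases (yes (v , q)) = isAt⁻ (f v) (proj₂ (∧-true⁻ {N′ v} q))
          cases (no _) = proj₂ (onto x)

        repOf-root : ∀ {v x} → N′ v ≡ true → f v ≡ just x → N′ (repOf x) ≡ true
        repOf-root {v} {x} a b = cases (has? x)
          where
          cases : ∀ d → N′ (pickRep x d) ≡ true
          cases (yes (u , q)) = proj₁ (∧-true⁻ {N′ u} q)
          cases (no none) = ⊥-elim (none (v , ∧-true⁺ a (isAt⁺ (f v) b)))

        repOf-injective : ∀ {x y} → repOf x ≡ repOf y → x ≡ y
        repOf-injective {x} {y} e = just-injective (trans (sym (f-repOf x)) (trans (cong f e) (f-repOf y)))

        ρ : Fin n → Maybe (Fin n)
        ρ v = mapM repOf (f v)

        ρ⁺ : ∀ {v x} → f v ≡ just x → ρ v ≡ just (repOf x)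
        ρ⁺ e = cong (mapM repOf) e

        mapM⁻ : ∀ (m : Maybe (Fin h)) {y} → mapM repOf m ≡ just y → ∃ λ x → m ≡ just x × y ≡ repOf x
        mapM⁻ (just x) refl = x , refl , refl

        ρ⁻ : ∀ {v y} → ρ v ≡ just y → ∃ λ x → f v ≡ just x × y ≡ repOf x
        ρ⁻ {v} = mapM⁻ (f v)

        new old : Fin n → Bool
        new x = D x ∧ isRep ρ x
        old x = N′ x ∧ isRep ρ x

        rep-supp : ∀ {v y} → ρ v ≡ just y → N′ v ≡ true ⊎ D v ≡ true
        rep-supp {v} e = let (x , a , _) = ρ⁻ e in ∨-true⁻ {N′ v} (inside a)

        reps-total : count new + count old ≤ h
        reps-total = ≤-trans (count-⊎ {P = new} {old} {isRep ρ} (λ x q → proj₂ (∧-true⁻ {D x} q)) (λ x q → proj₂ (∧-true⁻ {N′ x} q))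
            (λ x q r → off (proj₁ (∧-true⁻ {D x} q)) (proj₁ (∧-true⁻ {N′ x} r))))
          (≤-trans (∑-mono {n} bound) (≤-trans (≤-reflexive (∑-comm (λ u x → 𝟙 (u == repOf x))))
            (≤-trans (∑-≤const {h} {1} (λ x → count-== (repOf x))) (≤-reflexive (*-identityʳ h)))))
          where
          bound : ∀ u → 𝟙 (isRep ρ u) ≤ ∑ (λ x → 𝟙 (u == repOf x))
          bound u = case true? (isRep ρ u) of λ where
           (no q) → ≤-trans (≤-reflexive (cong 𝟙 (≢true⇒false q))) z≤n
           (yes q) → let (x , _ , e) = ρ⁻ (isAt⁻ (ρ u) q) in
            ≤-trans (𝟙-mono {isRep ρ u} {u == repOf x} (λ _ → ==-true⁺ e)) (∑-single (λ x → 𝟙 (u == repOf x)) x)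

        T : Fin n → Fin n → ℕ
        T u v = 𝟙 (touch D ρ u v) + 𝟙 (old u) * 𝟙 (old v)

        edges-total : edges₂ H ≤ ∑ (λ u → ∑ λ v → 𝟙 (touch D ρ u v)) + count old * count old
        edges-total = begin
          edges₂ H
            ≤⟨ ∑∑-mono pointwise ⟩
          ∑ (λ x → ∑ λ y → T (repOf x) (repOf y))
            ≤⟨ ∑-mono {h} (λ x → ∑-injective repOf repOf-injective (T (repOf x))) ⟩
          ∑ (λ x → ∑ (T (repOf x)))
            ≤⟨ ∑-injective repOf repOf-injective (λ u → ∑ (T u)) ⟩
          ∑ (λ u → ∑ (T u))
            ≡⟨ ∑∑-+ (λ u v → 𝟙 (touch D ρ u v)) (λ u v → 𝟙 (old u) * 𝟙 (old v)) ⟩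
          ∑ (λ u → ∑ λ v → 𝟙 (touch D ρ u v)) + ∑ (λ u → ∑ λ v → 𝟙 (old u) * 𝟙 (old v))
            ≡⟨ cong (∑ (λ u → ∑ λ v → 𝟙 (touch D ρ u v)) +_) (trans (∑-cong {n} λ u → trans (∑-*ˡ (𝟙 (old u)) (𝟙 ∘ old)) (*-comm (𝟙 (old u)) (count old))) (∑-*ˡ (count old) (𝟙 ∘ old))) ⟩
          ∑ (λ u → ∑ λ v → 𝟙 (touch D ρ u v)) + count old * count old ∎
          where
          open ≤-Reasoning
          rep-rep : ∀ x → ρ (repOf x) ≡ just (repOf x)
          rep-rep x = ρ⁺ (f-repOf x)
          pointwise : ∀ x y → 𝟙 (E H x y) ≤ T (repOf x) (repOf y)
          adj : ∀ {x y} → E H x y ≡ true → adjacent ρ (repOf x) (repOf y) ≡ true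
          adj e = let (u , v , a , b , c) = edge e in adjacent⁺ ρ (ρ⁺ a) (ρ⁺ b) c
          touching : ∀ {x y} → E H x y ≡ true → D (repOf x) ≡ true ⊎ D (repOf y) ≡ true → touch D ρ (repOf x) (repOf y) ≡ true
          touching {x} {y} e d = touch⁺ D ρ (d , rep-rep x , rep-rep y , (λ q → E⇒≢ H e (repOf-injective q)) , adj e)
          is-old : ∀ x → N′ (repOf x) ≡ true → old (repOf x) ≡ true
          is-old x a = ∧-true⁺ a (isAt⁺ (ρ (repOf x)) (rep-rep x))
          cases : ∀ {x y} → E H x y ≡ true → N′ (repOf x) ≡ true ⊎ D (repOf x) ≡ true → N′ (repOf y) ≡ true ⊎ D (repOf y) ≡ true →
                  touch D ρ (repOf x) (repOf y) ≡ true ⊎ (old (repOf x) ∧ old (repOf y)) ≡ true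
          cases e (inj₂ a) _ = inj₁ (touching e (inj₁ a))
          cases e (inj₁ _) (inj₂ b) = inj₁ (touching e (inj₂ b))
          cases {x} {y} e (inj₁ a) (inj₁ b) = inj₂ (∧-true⁺ (is-old x a) (is-old y b))
          pointwise x y = ≤-trans (𝟙-∪ {touch D ρ (repOf x) (repOf y)} {old (repOf x) ∧ old (repOf y)} {E H x y}
            (λ e → cases e (rep-supp (rep-rep x)) (rep-supp (rep-rep y))))
            (≤-reflexive (cong (𝟙 (touch D ρ (repOf x) (repOf y)) +_) (𝟙-∧ (old (repOf x)) (old (repOf y)))))

        old-few : W * count old ≤ suc p
        old-few = ≤-trans (W ⊙ count-mono {P = old} {N′} (λ x q → proj₁ (∧-true⁻ {N′ x} q))) few

      -- Let r be the number of representatives in N′. At most r² of the ordered pairs lie inside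
      -- N′, and W r ≤ p + 1 makes this loss affordable, as the r old vertices need not be paid for.
      -- The additive term of `Over H`, worth 2 W = 4 K here, raises the density of the new vertices
      -- from p to p + 2, because H has at most K vertices.
      groupItem : Item
      groupItem = record
        { D = D
        ; ρ = ρ
        ; D∩N = off
        ; supp = rep-supp
        ; rep = λ e → let (x , _ , q) = ρ⁻ e in subst (λ z → ρ z ≡ just z) (sym q) (ρ⁺ (f-repOf x))
        ; path = λ {v} e → let (x , a , q) = ρ⁻ e in subst (λ z → Path A (λ w → ρ w ≡ just z) v z) (sym q) (path-map id ρ⁺ id (conn a (f-repOf x)))
        ; root = λ a e → let (x , b , q) = ρ⁻ e in subst (λ z → N′ z ≡ true) (sym q) (repOf-root a b)
        ; dense = arith p W K h (count new) (count old) _ (edges₂ H) W≡2K h≤K over reps-total edges-total old-few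
        }
        where
        arith : ∀ p W K h nr r ed e → W ≡ 2 * K → h ≤ K → 2 * (p * suc h + W) ≤ W * e → nr + r ≤ h → e ≤ ed + r * r → W * r ≤ suc p →
                2 * (p + 2) * nr ≤ W * ed
        arith p _ K h nr r ed e refl h₁ h₂ h₃ h₄ h₅ = lin (4 ⊙ h₁ ⊕ h₂ ⊕ (2 * p + 4) ⊙ h₃ ⊕ (2 * K) ⊙ h₄ ⊕ r ⊙ h₅) (p * r + 3 * r + 2 * p) (identity p K h nr r ed e)
          where
          identity : ∀ p K h nr r ed e →
            2 * (p + 2) * nr + (4 * K + (2 * K * e + ((2 * p + 4) * h + (2 * K * (ed + r * r) + r * suc p)))) + (p * r + 3 * r + 2 * p) ≡
            2 * K * ed + (4 * h + (2 * (p * suc h + 2 * K) + ((2 * p + 4) * (nr + r) + (2 * K * e + r * (2 * K * r)))))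
          identity = solve-∀

      -- If no representative lay in D, then H would have at most r² ordered pairs with r ≤ h and W
      -- r ≤ p + 1, too few to be overfull.
      group-reps : 1 ≤ Item.newReps groupItem
      group-reps = case 1 ≤? count new of λ where
          (yes q) → q
          (no q) → ⊥-elim (n≮n _ (arith p W h (count old) (edges₂ H) 1≤W over (≤-trans (m≤n+m (count old) (count new)) reps-total)
            (≤-trans edges-total (≤-reflexive (cong (_+ count old * count old) (none q)))) old-few))
        where
        no-new : ¬ (1 ≤ count new) → ∀ {x} → D x ≡ true → ρ x ≡ just x → ⊥
        no-new q {x} a b = q (count-pos {P = new} x (∧-true⁺ a (isAt⁺ (ρ x) b)))
        none : ¬ (1 ≤ count new) → ∑ (λ u → ∑ λ v → 𝟙 (touch D ρ u v)) ≡ 0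
        none q = ∑∑-zero λ u v → cong 𝟙 (≢true⇒false {touch D ρ u v} λ t → case touch⁻ D ρ {u} {v} t of λ where
          (inj₁ a , b , _) → no-new q a b
          (inj₂ a , _ , b , _) → no-new q a b)
        arith : ∀ p W h r e → 1 ≤ W → 2 * (p * suc h + W) ≤ W * e → r ≤ h → e ≤ 0 + r * r → W * r ≤ suc p → p * h + p + W + r < p * h + p + W + r
        arith p W h r e h₀ h₁ h₂ h₃ h₄ = lin (r ⊙ h₄ ⊕ h₁ ⊕ W ⊙ h₃ ⊕ p ⊙ h₂ ⊕ (r + 2) ⊙ h₀ ⊕ h₄) (p * h + p) (identity p W h r e)
          where
          identity : ∀ p W h r e →
            suc (p * h + p + W + r) + (r * suc p + (W * e + (W * (0 + r * r) + (p * h + ((r + 2) * W + suc p))))) + (p * h + p) ≡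
            p * h + p + W + r + (r * (W * r) + (2 * (p * suc h + W) + (W * e + (p * r + ((r + 2) * 1 + W * r)))))
          identity = solve-∀

  -- As q grows, the M extra vertices become negligible and a density of at least (p + 2) / W
  -- remains in the limit.
  DenseMinor : ℕ → Set
  DenseMinor q = ∃₂ λ h (H : Adj h) → ∃ λ r → Model H A × q ≤ r × r ≤ h × h ≤ r + M × 2 * (p + 2) * r ≤ W * edges₂ H

-- From many petals to a dense minor

maybe-ext : ∀ {X : Set} (m m′ : Maybe X) → (∀ x → m ≡ just x → m′ ≡ just x) → (∀ x → m′ ≡ just x → m ≡ just x) → m ≡ m′
maybe-ext (just x) m′ f g = sym (f x refl)
maybe-ext nothing nothing f g = refl
maybe-ext nothing (just x) f g = g x refl

constant-on : ∀ {I : Set} {xs : List I} {x y} {g : I → Bool} → Constant xs g → x ∈ xs → y ∈ xs → g x ≡ g y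
constant-on (b , h) x∈ y∈ = trans (All.lookup h x∈) (sym (All.lookup h y∈))

module _ {n} (A : Adj n) (M p W K : ℕ) (W≡2K : W ≡ 2 * K) (1≤W : 1 ≤ W) where

  open FromPetals A M p W K W≡2K 1≤W
  open Extract A M (suc (4 * p)) (2 * W)
  open Overfull p W

  module _ (N′ : Fin n → Bool) (N′≤M : count N′ ≤ M) where

    open Amalgam A p W N′

    DisjItems : Item → Item → Set
    DisjItems I J = ∀ i → Item.D I i ≡ true → Item.D J i ≡ true → ⊥

    items⇒minor : ∀ q ν I Is → suc q ≤ length (I ∷ Is) → All (λ I → ∀ v → N′ v ≡ true → Item.ρ I v ≡ ν v) (I ∷ Is) →
                  AllPairs DisjItems (I ∷ Is) → All (λ I → 1 ≤ Item.newReps I) (I ∷ Is) → DenseMinor (suc q)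
    items⇒minor q ν I Is len tr disj reps =
      let (T , len′ , _) = mergeAll ν I Is tr disj reps
          (h , H , M , low , up , dns) = item-graph T
      in h , H , Item.newReps T , M , ≤-trans len len′ , low , ≤-trans up (+-monoʳ-≤ (Item.newReps T) N′≤M) , dns

    stars : ∀ {N} → p + 2 ≤ W * count N′ → (ps : List (Petal N)) → All (Attached N′) ps → AllPairs (Disj {N} N′) ps →
            ∃ λ Is → length Is ≡ length ps × All (λ I → ∀ v → N′ v ≡ true → Item.ρ I v ≡ just v) Is × AllPairs DisjItems Is ×
              All (λ I → 1 ≤ Item.newReps I) Is × (∀ Z → All (Apart N′ Z) ps → All (λ I → ∀ i → Z i ≡ true → Item.D I i ≡ true → ⊥) Is)
    stars many [] _ _ = [] , refl , [] , [] , [] , λ _ _ → []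
    stars many (q ∷ ps) (a ∷ as) (d ∷ ds) =
      let (Is , len , tr , disj , reps , far) = stars many ps as ds in
      starItem N′ q a many ∷ Is , cong suc len , (λ v h → star-N N′ q a h) ∷ tr , far (Petal.C q) d ∷ disj ,
      star-reps N′ q a many ∷ reps , λ { Z (z ∷ zs) → z ∷ far Z zs }

    module _ {N : Fin n → Bool} (few : W * count N′ ≤ suc p)
             (smallOver : ∀ {s} → s < suc (M + m₀ * M) → (B : Adj s) → Over B → SmallOver K B) where

      toItem : (G : Group {N} N′ m₀) → Σ Item λ I → 1 ≤ Item.newReps I × Item.D I ≡ Group.D G
      toItem G =
        let (h , H , h≤K , over , Mod) = smallOver (group-size {N} N′ N′≤M G) _ (group-over {N} N′ N′≤M G)
            S = λ v → N′ v ∨ Group.D G v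
            inside = λ {v} {x} → induced-f-∈ {A = A} S Mod {v} {x}
        in groupItem {N} N′ few (Group.D G) (Group.off G) H h≤K over (model-induced {A = A} S Mod) inside ,
           group-reps {N} N′ few (Group.D G) (Group.off G) H h≤K over (model-induced {A = A} S Mod) inside , refl

      -- Whether the item maps one given vertex of N′ to another. Together these Booleans determine
      -- the trace on N′, whose values lie in N′.
      feature : Fin (count N′ * count N′) → Item → Bool
      feature k I = isAt (enum N′ (remainder {count N′} (count N′) k)) (Item.ρ I (enum N′ (quotient {count N′} (count N′) k)))

      same-trace : ∀ {Is} → (∀ k → Constant Is (feature k)) → ∀ {I J} → I ∈ Is → J ∈ Is → ∀ v → N′ v ≡ true →
                   ∀ x → Item.ρ I v ≡ just x → Item.ρ J v ≡ just x
      same-trace cs {I} {J} I∈ J∈ v v∈ x e =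
        let (a , a≡) = enum-onto N′ v v∈
            (b , b≡) = enum-onto N′ x (Item.root I v∈ e)
            k = combine a b
            at = λ (T : Item) → cong₂ (λ y u → isAt y (Item.ρ T u))
                   (trans (cong (enum N′ ∘ proj₂) (remQuot-combine a b)) b≡) (trans (cong (enum N′ ∘ proj₁) (remQuot-combine a b)) a≡)
        in isAt⁻ (Item.ρ J v) (trans (sym (at J)) (trans (constant-on (cs k) J∈ I∈) (trans (at I) (isAt⁺ (Item.ρ I v) e))))

      groups⇒minor : ∀ q (Gs : List (Group {N} N′ m₀)) → 2 ^ (M * M) * suc q ≤ length Gs → AllPairs (GroupDisj {N} N′) Gs → DenseMinor (suc q)
      groups⇒minor q Gs len disj = finish (uniformize (tabulate feature) (suc q) Is
          (≤-trans (*-monoˡ-≤ (suc q) (^-monoʳ-≤ 2 (≤-trans (≤-reflexive (length-tabulate feature)) (*-mono-≤ N′≤M N′≤M))))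
            (≤-trans len (≤-reflexive (sym (length-map (proj₁ ∘ toItem) Gs))))))
        where
        Is : List Item
        Is = map (proj₁ ∘ toItem) Gs
        Is-disj : AllPairs DisjItems Is
        Is-disj = APP.map⁺ disj
        Is-reps : All (λ I → 1 ≤ Item.newReps I) Is
        Is-reps = AllP.map⁺ (All.tabulate (λ {G} _ → proj₁ (proj₂ (toItem G))))
        finish : (∃ λ Js → Js ⊆ Is × suc q ≤ length Js × All (Constant Js) (tabulate feature)) → DenseMinor (suc q)
        finish (J ∷ Js , sub , len′ , cs) = items⇒minor q (Item.ρ J) J Js len′
          (All.tabulate λ {I} I∈ v v∈ → maybe-ext (Item.ρ I v) (Item.ρ J v)
            (same-trace (tabulate⁻ cs) I∈ (here refl) v v∈) (same-trace (tabulate⁻ cs) (here refl) I∈ v v∈))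
          (AllPairs-⊆ sub Is-disj) (All-resp-⊆ sub Is-reps)

  -- The number of petals provides a factor 2 ^ M for equal neighbourhoods in the kernel, 2 ^ (M *
  -- M) for equal traces on N′, and m₀ petals for each group.
  petals⇒minor : (∀ {s} → s < suc (M + m₀ * M) → (B : Adj s) → Over B → SmallOver K B) →
                 ∀ q {N} (ps : List (Petal N)) → count N ≤ M → AllPairs (Disj {N} N) ps →
                 2 ^ M * (2 ^ (M * M) * suc q * m₀) ≤ length ps → DenseMinor (suc q)
  petals⇒minor smallOver q {N} ps N≤M disj len = go (uniformize (tabulate nb) need ps
      (≤-trans (*-monoˡ-≤ need (^-monoʳ-≤ 2 (≤-trans (≤-reflexive (length-tabulate nb)) N≤M))) len))
    where
    need : ℕ
    need = 2 ^ (M * M) * suc q * m₀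
    q≤need : suc q ≤ need
    q≤need = ≤-trans (≤-reflexive (sym (trans (*-identityʳ (1 * suc q)) (+-identityʳ (suc q))))) (*-mono-≤ (*-monoˡ-≤ (suc q) (m^n>0 2 (M * M)))
      (≤-trans (≤-trans 1≤W (m≤m+n W (3 * W))) (m≤n+m (4 * W) (4 * p * suc M))))
    nb : Fin (count N) → Petal N → Bool
    nb k P = neighbours N (Petal.C P) (enum N k)
    go : (∃ λ qs → qs ⊆ ps × need ≤ length qs × All (Constant qs) (tabulate nb)) → DenseMinor (suc q)
    go ([] , _ , len′ , _) = ⊥-elim (n≮0 (≤-trans q≤need len′))
    go (P ∷ qs , sub , len′ , cs) = cases (p + 2 ≤? W * count N′)
      where
      N′ : Fin n → Bool
      N′ = neighbours N (Petal.C P)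
      N′≤M : count N′ ≤ M
      N′≤M = ≤-trans (count-mono {P = N′} {N} (λ i h → proj₁ (∧-true⁻ {N i} h))) N≤M
      att : All (Attached N′) (P ∷ qs)
      att = All.tabulate λ {Q} Q∈ x → same Q Q∈ x (true? (N x))
        where
        same : ∀ Q → Q ∈ (P ∷ qs) → ∀ x → Dec (N x ≡ true) → neighbours N (Petal.C Q) x ≡ N′ x
        same Q Q∈ x (yes x∈) = let (k , k≡) = enum-onto N x x∈ in
          subst (λ z → neighbours N (Petal.C Q) z ≡ N′ z) k≡ (constant-on (tabulate⁻ cs k) Q∈ (here refl))
        same Q Q∈ x (no x∉) = ⇔⇒≡ {neighbours N (Petal.C Q) x} (λ h → ⊥-elim (x∉ (proj₁ (∧-true⁻ {N x} h)))) (λ h → ⊥-elim (x∉ (proj₁ (∧-true⁻ {N x} h))))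
      disj′ : AllPairs (Disj {N} N′) (P ∷ qs)
      disj′ = AllPairs-⊆ sub disj
      star-case : p + 2 ≤ W * count N′ →
                  (∃ λ Is → length Is ≡ suc (length qs) × All (λ I → ∀ v → N′ v ≡ true → Amalgam.Item.ρ I v ≡ just v) Is ×
                    AllPairs (DisjItems N′ N′≤M) Is × All (λ I → 1 ≤ Amalgam.Item.newReps I) Is × _) → DenseMinor (suc q)
      star-case many (I ∷ Is , len″ , tr , dj , rp , _) =
        items⇒minor N′ N′≤M q just I Is (≤-trans q≤need (≤-trans len′ (≤-reflexive (sym len″)))) tr dj rp
      cases : Dec (p + 2 ≤ W * count N′) → DenseMinor (suc q)
      cases (yes many) = star-case many (stars N′ N′≤M many (P ∷ qs) att disj′)
      cases (no few) =
        let (Gs , lenG , disjG , _) = chunk {N} N′ m₀ (2 ^ (M * M) * suc q) (P ∷ qs) len′ att disj′ in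
        groups⇒minor N′ N′≤M {N} (s≤s⁻¹ (≤-trans (≰⇒> few) (≤-reflexive (+-comm p 2)))) smallOver q Gs (≤-reflexive (sym lenG)) disjG

-- Raising a lower bound for the density

edges₂-complete : ∀ k → k * k ≤ edges₂ (complete k) + k
edges₂-complete k = begin
  k * k                                                        ≡⟨ cong (k *_) (*-identityʳ k) ⟨
  k * (k * 1)                                                  ≡⟨ ∑-const k (k * 1) ⟨
  ∑ {k} (λ i → k * 1)                                          ≡⟨ ∑-cong {k} (λ i → ∑-const k 1) ⟨
  ∑ {k} (λ i → ∑ {k} (λ j → 1))                                ≤⟨ ∑∑-mono {k} {k} {λ _ _ → 1} pointwise ⟩
  ∑ (λ i → ∑ λ j → 𝟙 (E (complete k) i j) + 𝟙 (j == i))        ≡⟨ ∑∑-+ (λ i j → 𝟙 (E (complete k) i j)) (λ i j → 𝟙 (j == i)) ⟩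
  edges₂ (complete k) + ∑ {k} (λ i → count {k} (_== i))                ≤⟨ +-monoʳ-≤ (edges₂ (complete k)) (≤-trans (∑-≤const {k} {1} {λ i → count (_== i)} count-==) (≤-reflexive (*-identityʳ k))) ⟩
  edges₂ (complete k) + k                                      ∎
  where
  open ≤-Reasoning
  pointwise : ∀ i j → 1 ≤ 𝟙 (E (complete k) i j) + 𝟙 (j == i)
  pointwise i j = 𝟙-∪ {E (complete k) i j} {j == i} {true} λ _ → case j ≟F i of λ where
    (yes e) → inj₂ (==-true⁺ e)
    (no ne) → inj₁ (E-true⁺ (complete k) {i} {j} (ne ∘ sym) (inj₁ refl))

Sparse : Family → ℕ → Set
Sparse F B = ∀ {n} (A : Adj n) → F (n , A) → edges₂ A ≤ 2 * B * n

-- The limiting density of F is at least i / W.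
DenseAt : Family → ℕ → ℕ → Set
DenseAt F i W = ∀ u v → u * W < i * v → ∀ N → ∃ λ n → N ≤ n × ∃ λ (A : Adj n) → F (n , A) × 2 * (u * n) < v * edges₂ A

module _ (F : Family) (closed : MinorClosed F) {B : ℕ} (sparse : Sparse F B) where

  -- A clique on k vertices has k (k - 1) ordered pairs, more than 2 B k once k ≥ 2 B + 2.
  noClique : ∀ {n} (A : Adj n) → F (n , A) → ∀ {k} → 2 * B + 2 ≤ k → Model (complete k) A → ⊥
  noClique A A∈ {k} t≤k Mod = n≮n _ (arith k B (edges₂ (complete k)) (edges₂-complete k)
    (sparse (complete k) (closed _ _ A∈ (Model⇒≼ Mod))) t≤k (≤-trans (≤-trans (s≤s z≤n) (m≤n+m 2 (2 * B))) t≤k))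
    where
    arith : ∀ k B e → k * k ≤ e + k → e ≤ 2 * B * k → 2 * B + 2 ≤ k → 1 ≤ k → k * k < k * k
    arith k B e h₁ h₂ h₃ h₄ = lin (h₁ ⊕ h₂ ⊕ k ⊙ h₃ ⊕ h₄) 0 (identity k B e)
      where
      identity : ∀ k B e → suc (k * k) + (e + k + (2 * B * k + (k * k + k))) + 0 ≡ k * k + (k * k + (e + (k * (2 * B + 2) + 1)))
      identity = solve-∀

  module Jump (K : ℕ) (1≤K : 1 ≤ K) (p : ℕ) where

    W t j₀ M : ℕ
    W = 2 * K
    t = 2 * B + 2
    -- The summands serve `scale-step`, `branch-size` and `pick`, where j₀ ≥ 4 p + 1 gives (4 p + 2)
    -- j₀ / (j₀ + 1) ≥ 4 p + 1.
    j₀ = 49 + (40 * (t * t) + t) + suc (4 * p)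
    M = scale j₀

    1≤W : 1 ≤ W
    1≤W = ≤-trans 1≤K (m≤m+n K (K + 0))

    open Overfull p W

    bound-size : ℕ
    bound-size = suc (M + (4 * p * suc M + 4 * W) * M)

    pick : ∀ {n} (A : Adj n) → F (n , A) → 1 ≤ n → ∀ R → (∀ {i j} → R i j ≡ true → E A i j ≡ true) →
           (4 * p + 2) * n ≤ 2 * W * pairs R (λ _ → true) →
           ∃ λ P → 1 ≤ count P × count P ≤ M × suc (4 * p) * count P ≤ 2 * W * pairs R P
    pick {n} A A∈ 1≤n R R⊆E h =
      let (P , a , b , c) = piece (λ _ → true) (≤-trans 1≤n (≤-reflexive (sym (count-true n))))
                              (≤-trans (≤-reflexive (cong ((4 * p + 2) *_) (count-true n))) h)
      in P , a , b , *-cancelʳ-≤ _ _ (suc j₀) (arith (4 * p) j₀ (2 * W) (count P) (pairs R P) c (m≤n+m (suc (4 * p)) (49 + (40 * (t * t) + t))))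
      where
      open DensePiece A t (noClique A A∈) (4 * p + 2) (2 * W) (≤-trans (s≤s z≤n) (m≤n+m 2 (4 * p))) R R⊆E j₀
        (≤-trans (m≤m+n 49 (40 * (t * t) + t)) (m≤m+n (49 + (40 * (t * t) + t)) (suc (4 * p))))
        (≤-trans (m≤n+m (40 * (t * t) + t) 49) (m≤m+n (49 + (40 * (t * t) + t)) (suc (4 * p))))
      arith : ∀ a j b c e → (a + 2) * j * c ≤ b * suc j * e → suc a ≤ j → suc a * c * suc j ≤ b * e * suc j
      arith a j b c e h k = lin (h ⊕ c ⊙ k) 0 (identity a j b c e)
        where
        identity : ∀ a j b c e → suc a * c * suc j + (b * suc j * e + c * j) + 0 ≡ b * e * suc j + ((a + 2) * j * c + c * suc a)
        identity = solve-∀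

    module _ (smallOver : ∀ {s} → s < bound-size → (C : Adj s) → Over C → SmallOver K C) where

      pieces : ℕ → ℕ
      pieces q = flowerBound M (suc (2 ^ M * (2 ^ (M * M) * suc q * (4 * p * suc M + 4 * W))))

      denseMinor : ∀ q {n} (A : Adj n) → F (n , A) → 1 ≤ n →
                   (4 * p + 2) * n + 2 * W * (pieces q * (M * M)) ≤ 2 * W * edges₂ A →
                   FromPetals.DenseMinor A M p W K refl 1≤W (suc q)
      denseMinor q {n} A A∈ 1≤n le =
        let (xs , len , good , avoid) = extract (4 * p + 2) (2 * W) (pick A A∈ 1≤n) _ le
            (N , ps , enough , disj , N≤M) = abundant-petals (s≤s z≤n) _ xs good avoid (≤-reflexive (sym len))
        in petals⇒minor A M p W K refl 1≤W smallOver q ps N≤M disj enough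
        where open Extract A M (suc (4 * p)) (2 * W)

      -- In units of 1 / (4 W): density 4 p + 4 of F provides graphs above 4 p + 3, at least 4 p + 2
      -- is left while pieces are taken out, and the separators reduce this to 4 p + 1 for a piece,
      -- still above 4 p.
      jump : DenseAt F (suc p) W → DenseAt F (p + 2) W
      jump dense u v uW< N₀ =
        -- The summand u W M outweighs the at most M vertices of the minor that the density does not
        -- count.
        let q = N₀ + u * W * M
            (n , n≥ , A , A∈ , e>) = dense (4 * p + 3) (4 * W) (slope p W 1≤W) (suc (2 * W * (pieces q * (M * M))))
            (h , H , r , Mod , q≤r , r≤h , h≤ , dns) = denseMinor q A A∈ (≤-trans (s≤s z≤n) n≥) (room p n W _ (edges₂ A) e> (≤-trans (n≤1+n _) n≥))
        in h , ≤-trans (≤-trans (≤-trans (m≤m+n N₀ (u * W * M)) (n≤1+n q)) q≤r) r≤h , H , closed _ _ A∈ (Model⇒≼ Mod) ,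
           *-cancelˡ-< W _ _ (final p u v W h r M N₀ (edges₂ H) uW< q≤r h≤ dns)
        where
        slope : ∀ p W → 1 ≤ W → (4 * p + 3) * W < suc p * (4 * W)
        slope p W h = lin h 0 (identity p W)
          where
          identity : ∀ p W → suc ((4 * p + 3) * W) + W + 0 ≡ suc p * (4 * W) + 1
          identity = solve-∀
        room : ∀ p n W x e → 2 * ((4 * p + 3) * n) < 4 * W * e → x ≤ n → (4 * p + 2) * n + x ≤ 2 * W * e
        room p n W x e h k = *-cancelˡ-≤ 2 (lin (h ⊕ 2 ⊙ k) 1 (identity p n W x e))
          where
          identity : ∀ p n W x e → 2 * ((4 * p + 2) * n + x) + (4 * W * e + 2 * n) + 1 ≡ 2 * (2 * W * e) + (suc (2 * ((4 * p + 3) * n)) + 2 * x)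
          identity = solve-∀
        final : ∀ p u v W h r M N₀ e → u * W < (p + 2) * v → suc (N₀ + u * W * M) ≤ r → h ≤ r + M → 2 * (p + 2) * r ≤ W * e →
                W * (2 * (u * h)) < W * (v * e)
        final p u v W h r M N₀ e h₁ h₂ h₃ h₄ = lin ((2 * r) ⊙ h₁ ⊕ 2 ⊙ h₂ ⊕ (2 * u * W) ⊙ h₃ ⊕ v ⊙ h₄) (1 + 2 * N₀) (identity p u v W h r M N₀ e)
          where
          identity : ∀ p u v W h r M N₀ e →
            suc (W * (2 * (u * h))) + (2 * r * ((p + 2) * v) + (2 * r + (2 * u * W * (r + M) + v * (W * e)))) + (1 + 2 * N₀) ≡
            W * (v * e) + (2 * r * suc (u * W) + (2 * suc (N₀ + u * W * M) + (2 * u * W * h + v * (2 * (p + 2) * r))))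
          identity = solve-∀

  -- Raising the known lower bound for the density until a large critical graph appears.

  climb : ∀ K → 1 ≤ K → ∀ fuel p → suc (B * (2 * K)) ≤ fuel + suc p → DenseAt F (suc p) (2 * K) →
          ∃ λ p′ → p ≤ p′ × DenseAt F (suc p′) (2 * K) × Overfull.BigCritical p′ (2 * K) K
  climb K 1≤K zero p le dense =
    -- With the fuel used up, p is at least B W and the density would exceed B.
    let (n , _ , A , A∈ , e>) = dense B 1 (≤-trans le (≤-reflexive (sym (*-identityʳ (suc p))))) 0 in
    ⊥-elim (n≮n _ (≤-trans e> (≤-trans (≤-reflexive (+-identityʳ (edges₂ A))) (≤-trans (sparse A A∈) (≤-reflexive (*-assoc 2 B n))))))
  climb K 1≤K (suc fuel) p le dense with Overfull.dichotomy p (2 * K) K (Jump.bound-size K 1≤K p)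
  ... | inj₂ critical = p , ≤-refl , dense , critical
  ... | inj₁ smallOver =
    let (p′ , p≤ , r) = climb K 1≤K fuel (suc p) (≤-trans le (≤-reflexive (sym (+-suc fuel (suc p)))))
          (λ u v h → Jump.jump K 1≤K p smallOver dense u v (≤-trans h (≤-reflexive (cong (_* v) (+-comm 2 p)))))
    in p′ , <⇒≤ p≤ , r

-- Fractions with natural numerator and denominator

frac : ℕ → ℕ → ℚ
frac u d = (ℤ.+ u) ℚ./ suc d

frac-toℚᵘ : ∀ u d → ℚ.toℚᵘ (frac u d) ℚᵘ.≃ mkℚᵘ (ℤ.+ u) d
frac-toℚᵘ u d = ℚ.toℚᵘ-fromℚᵘ (mkℚᵘ (ℤ.+ u) d)

frac-< : ∀ {u d u′ d′} → u * suc d′ < u′ * suc d → frac u d ℚ.< frac u′ d′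
frac-< {u} {d} {u′} {d′} h = ℚ.toℚᵘ-cancel-<
  (ℚᵘ.<-respˡ-≃ (ℚᵘ.≃-sym (frac-toℚᵘ u d)) (ℚᵘ.<-respʳ-≃ (ℚᵘ.≃-sym (frac-toℚᵘ u′ d′))
    (*<* (subst₂ ℤ._<_ (ℤ.pos-* u (suc d′)) (ℤ.pos-* u′ (suc d)) (+<+ h)))))

frac-<⁻ : ∀ {u d u′ d′} → frac u d ℚ.< frac u′ d′ → u * suc d′ < u′ * suc d
frac-<⁻ {u} {d} {u′} {d′} h with ℚᵘ.<-respˡ-≃ (frac-toℚᵘ u d) (ℚᵘ.<-respʳ-≃ (frac-toℚᵘ u′ d′) (ℚ.toℚᵘ-mono-< h))
... | *<* k = ℤ.drop‿+<+ (subst₂ ℤ._<_ (sym (ℤ.pos-* u (suc d′))) (sym (ℤ.pos-* u′ (suc d))) k)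

frac-≤ : ∀ {u d u′ d′} → u * suc d′ ≤ u′ * suc d → frac u d ℚ.≤ frac u′ d′
frac-≤ {u} {d} {u′} {d′} h = ℚ.≮⇒≥ λ k → ≤⇒≯ h (frac-<⁻ {u′} {d′} {u} {d} k)

frac-≤⁻ : ∀ {u d u′ d′} → frac u d ℚ.≤ frac u′ d′ → u * suc d′ ≤ u′ * suc d
frac-≤⁻ {u} {d} {u′} {d′} h = ≮⇒≥ λ k → ℚ.<-irrefl refl (ℚ.<-≤-trans (frac-< {u′} {d′} {u} {d} k) h)

frac-* : ∀ u d n → frac u d ℚ.* frac n 0 ≡ frac (u * n) d
frac-* u d n = ℚ.toℚᵘ-injective (ℚᵘ.≃-trans (ℚ.toℚᵘ-homo-* (frac u d) (frac n 0))
  (ℚᵘ.≃-trans (ℚᵘ.*-cong (frac-toℚᵘ u d) (frac-toℚᵘ n 0)) (ℚᵘ.≃-trans core (ℚᵘ.≃-sym (frac-toℚᵘ (u * n) d)))))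
  where
  core : mkℚᵘ (ℤ.+ u) d ℚᵘ.* mkℚᵘ (ℤ.+ n) 0 ℚᵘ.≃ mkℚᵘ (ℤ.+ (u * n)) d
  core = *≡* (cong₂ ℤ._*_ (sym (ℤ.pos-* u n)) (cong (λ k → ℤ.+ suc k) (sym (*-identityʳ d))))

frac-+ : ∀ x y d → frac x d ℚ.+ frac y d ≡ frac (x + y) d
frac-+ x y d = ℚ.toℚᵘ-injective (ℚᵘ.≃-trans (ℚ.toℚᵘ-homo-+ (frac x d) (frac y d))
  (ℚᵘ.≃-trans (ℚᵘ.+-cong (frac-toℚᵘ x d) (frac-toℚᵘ y d)) (ℚᵘ.≃-trans core (ℚᵘ.≃-sym (frac-toℚᵘ (x + y) d)))))
  where
  D = suc d
  ring : ∀ x y D → (x * D + y * D) * D ≡ (x + y) * (D * D)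
  ring = solve-∀
  core : mkℚᵘ (ℤ.+ x) d ℚᵘ.+ mkℚᵘ (ℤ.+ y) d ℚᵘ.≃ mkℚᵘ (ℤ.+ (x + y)) d
  core = *≡* (trans (cong (ℤ._* ℤ.+ D) (trans (cong₂ ℤ._+_ (sym (ℤ.pos-* x D)) (sym (ℤ.pos-* y D))) (sym (ℤ.pos-+ (x * D) (y * D)))))
    (trans (sym (ℤ.pos-* (x * D + y * D) D)) (trans (cong ℤ.+_ (ring x y D)) (ℤ.pos-* (x + y) (D * D)))))

frac-1 : ∀ d → frac (suc d) d ≡ ℚ.1ℚ
frac-1 d = ℚ.≤-antisym (frac-≤ {suc d} {d} {1} {0} (≤-reflexive (*-comm (suc d) 1))) (frac-≤ {1} {0} {suc d} {d} (≤-reflexive (*-comm 1 (suc d))))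

nonNeg-frac : ∀ (q : ℚ) → ℚ.0ℚ ℚ.≤ q → ∃₂ λ u d → q ≡ frac u d
nonNeg-frac q@(ℚ.mkℚ (ℤ.+ u) d _) _ = u , d , sym (ℚ.↥p/↧p≡p q)
nonNeg-frac q@(ℚ.mkℚ -[1+ u ] d _) h with ℚ.nonNegative h
... | ()

-- Limiting densities in terms of natural numbers

densGe⇒denseAt : ∀ {F a} i w → DensGe F a → frac i w ℚ.≤ a → DenseAt F i (suc w)
densGe⇒denseAt i w ge i≤a u zero h N = ⊥-elim (n≮0 (≤-trans h (≤-reflexive (*-zeroʳ i))))
densGe⇒denseAt {F} i w ge i≤a u (suc d) h N = go (ge (frac u d) (ℚ.<-≤-trans (frac-< {u} {d} {i} {w} h) i≤a) N)
  where
  go : (∃ λ n → N ≤ n × ExGt F n (frac u d ℚ.* ℕ→ℚ n)) →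
       ∃ λ n → N ≤ n × ∃ λ (A : Adj n) → F (n , A) × 2 * (u * n) < suc d * edges₂ A
  go (n , N≤n , inj₁ neg) = ⊥-elim (n≮0 (frac-<⁻ {u * n} {d} {0} {0} (subst (ℚ._< ℕ→ℚ 0) (frac-* u d n) neg)))
  go (n , N≤n , inj₂ (A , A∈ , lt)) = n , N≤n , A , A∈ ,
    subst (λ e → 2 * (u * n) < suc d * e) (sym (edges₂≡2*edges A))
      (arith (u * n) d (edges A) (frac-<⁻ {u * n} {d} {edges A} {0} (subst (ℚ._< ℕ→ℚ (edges A)) (frac-* u d n) lt)))
    where
    arith : ∀ x d e → x * 1 < e * suc d → 2 * x < suc d * (2 * e)
    arith x d e h = lin (2 ⊙ h) 1 (identity x d e)
      where
      identity : ∀ x d e → suc (2 * x) + 2 * (e * suc d) + 1 ≡ suc d * (2 * e) + 2 * suc (x * 1)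
      identity = solve-∀

denseAt⇒densGe : ∀ {F} i w → DenseAt F i (suc w) → DensGe F (frac i w)
denseAt⇒densGe {F} i w dense q′ q′< N = cases (0ℚ ℚ.≤? q′)
  where
  cases : Dec (0ℚ ℚ.≤ q′) → ∃ λ n → N ≤ n × ExGt F n (q′ ℚ.* ℕ→ℚ n)
  cases (no neg) = suc N , n≤1+n N , inj₁ (subst (q′ ℚ.* ℕ→ℚ (suc N) ℚ.<_) (ℚ.*-zeroˡ (ℕ→ℚ (suc N)))
    (ℚ.*-monoˡ-<-pos (ℕ→ℚ (suc N)) {{ℚ.normalize-pos (suc N) 1}} (ℚ.≰⇒> neg)))
  cases (yes nn) =
    let (u , d , q′≡) = nonNeg-frac q′ nn
        (n , N≤n , A , A∈ , lt) = dense u (suc d) (frac-<⁻ {u} {d} {i} {w} (subst (ℚ._< frac i w) q′≡ q′<)) N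
    in n , N≤n , inj₂ (A , A∈ , subst (ℚ._< ℕ→ℚ (edges A)) (sym (trans (cong (ℚ._* ℕ→ℚ n) q′≡) (frac-* u d n)))
         (frac-< {u * n} {d} {edges A} {0} (arith (u * n) d (edges A) (subst (λ e → 2 * (u * n) < suc d * e) (edges₂≡2*edges A) lt))))
    where
    arith : ∀ x d e → 2 * x < suc d * (2 * e) → x * 1 < e * suc d
    arith x d e h = *-cancelˡ-< 2 _ _ (≤-trans (≤-reflexive (cong (λ y → suc (2 * y)) (*-identityʳ x))) (≤-trans h (≤-reflexive (identity d e))))
      where
      identity : ∀ d e → suc d * (2 * e) ≡ 2 * (e * suc d)
      identity = solve-∀

densGe-0 : ∀ {F} → DensGe F 0ℚ
densGe-0 = denseAt⇒densGe 0 0 λ u v h → ⊥-elim (n≮0 h)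

densGe≤densLe : ∀ {F s b} → DensGe F s → DensLe F b → s ℚ.≤ b
densGe≤densLe {F} {s} {b} ge le = ℚ.≮⇒≥ λ b<s →
  let (m , b<m , m<s) = ℚ.<-dense b<s
      (N , ub) = le m b<m
      (n , N≤n , gt) = ge m m<s N
      (nn , small) = ub n N≤n
  in case gt of λ where
    (inj₁ neg) → ℚ.<-irrefl refl (ℚ.<-≤-trans neg nn)
    (inj₂ (A , A∈ , lt)) → ℚ.<-irrefl refl (ℚ.<-≤-trans lt (small A A∈))

above : ∀ b → ∃ λ c → b ℚ.< ℕ→ℚ c
above b with 0ℚ ℚ.≤? b
... | no neg = 0 , ℚ.≰⇒> neg
... | yes nn = let (u , d , b≡) = nonNeg-frac b nn in
  suc u , subst (ℚ._< ℕ→ℚ (suc u)) (sym b≡) (frac-< {u} {d} {suc u} {0} (s≤s (≤-trans (≤-reflexive (*-identityʳ u)) (≤-trans (m≤m*n u (suc d)) (m≤n+m (u * suc d) d)))))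

-- Graphs with fewer than N vertices are covered by the trivial bound n * n on ordered pairs, whence
-- the summand N.
densLe⇒sparse : ∀ {F b} → DensLe F b → ∃ (Sparse F)
densLe⇒sparse {F} {b} le =
  let (c , b<c) = above b
      (N , ub) = le (ℕ→ℚ c) b<c
  in c + N , λ {n} A A∈ → cases c N n A (λ N≤n → subst (ℕ→ℚ (edges A) ℚ.≤_) (frac-* c 0 n) (proj₂ (ub n N≤n) A A∈)) (N ≤? n)
  where
  cases : ∀ c N n (A : Adj n) → (N ≤ n → ℕ→ℚ (edges A) ℚ.≤ frac (c * n) 0) → Dec (N ≤ n) → edges₂ A ≤ 2 * (c + N) * n
  cases c N n A ub (yes N≤n) = ≤-trans (≤-reflexive (edges₂≡2*edges A)) (arith (edges A) c N n (frac-≤⁻ {edges A} {0} {c * n} {0} (ub N≤n)))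
    where
    arith : ∀ e c N n → e * 1 ≤ c * n * 1 → 2 * e ≤ 2 * (c + N) * n
    arith e c N n h = lin (2 ⊙ h) (2 * N * n) (identity e c N n)
      where
      identity : ∀ e c N n → 2 * e + 2 * (c * n * 1) + 2 * N * n ≡ 2 * (c + N) * n + 2 * (e * 1)
      identity = solve-∀
  cases c N n A ub (no N≰n) = ≤-trans (edges₂-≤ A) (*-monoˡ-≤ n (≤-trans (<⇒≤ (≰⇒> N≰n)) (≤-trans (m≤n+m N c) (m≤m+n (c + N) _))))

-- The families of certified graphs and their densities

Certified : ℕ → ℕ → Family
Certified U V (n , A) = Cert U V A

certified-closed : ∀ U V → MinorClosed (Certified U V)
certified-closed U V (n , A) (h , H) C d = cert-≼ d C

certified-densLe : ∀ U v → DensLe (Certified U (suc v)) (frac U v)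
certified-densLe U v q′ U<q′ = 0 , λ n _ →
  let below = subst (ℚ._≤ q′ ℚ.* ℕ→ℚ n) (frac-* U v n)
                (ℚ.*-monoʳ-≤-nonNeg (ℕ→ℚ n) {{ℚ.normalize-nonNeg n 1}} (ℚ.<⇒≤ U<q′))
  in ℚ.≤-trans (frac-≤ {0} {0} {U * n} {v} z≤n) below ,
     λ A C → ℚ.≤-trans (frac-≤ {edges A} {0} {U * n} {v} (arith (edges A) v U n (subst (λ e → suc v * e ≤ 2 * (U * n)) (edges₂≡2*edges A) (cert-edges A C)))) below
  where
  arith : ∀ e v U n → suc v * (2 * e) ≤ 2 * (U * n) → e * suc v ≤ U * n * 1
  arith e v U n h = *-cancelˡ-≤ 2 (≤-trans (≤-reflexive (identity e v)) (≤-trans h (≤-reflexive (cong (2 *_) (sym (*-identityʳ (U * n)))))))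
    where
    identity : ∀ e v → 2 * (e * suc v) ≡ suc v * (2 * e)
    identity = solve-∀

-- Edges per vertex of the cone, both doubled; `h + (suc h + 0)` is the predecessor of `2 * suc h`.
cone-density : ∀ {h} → Adj h → ℚ
cone-density {h} A = frac (edges₂ A + 2 * h) (h + (suc h + 0))

certified-densGe : ∀ {U V h} (A : Adj h) → (∀ {h′} (H : Adj h′) → Model H A → V * (edges₂ H + 2 * h′) ≤ 2 * (U * suc h′)) →
                   DensGe (Certified U V) (cone-density A)
certified-densGe {U} {V} {h} A bnd q′ q′< N = n , N≤n , inj₂ (X , cert-copies-cone A bnd k , ℚ.<-≤-trans
    (ℚ.*-monoˡ-<-pos (ℕ→ℚ n) {{ℚ.normalize-pos n 1}} q′<)
    (subst (ℚ._≤ ℕ→ℚ (edges X)) (sym (frac-* (edges₂ A + 2 * h) (h + (suc h + 0)) n))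
      (frac-≤ {(edges₂ A + 2 * h) * n} {h + (suc h + 0)} {edges X} {0}
        (arith (edges₂ A + 2 * h) k h (edges X) (≤-trans (≤-reflexive (cong (k *_) (sym (edges₂-cone A))))
          (≤-trans (edges₂-copies k (cone A)) (≤-reflexive (edges₂≡2*edges X))))))))
  where
  k n : ℕ
  k = suc N
  n = k * suc h
  X : Adj n
  X = copies k (cone A)
  N≤n : N ≤ n
  N≤n = ≤-trans (n≤1+n N) (m≤m*n (suc N) (suc h))
  arith : ∀ a k h e → k * a ≤ 2 * e → a * (k * suc h) * 1 ≤ e * (2 * suc h)
  arith a k h e p = lin (suc h ⊙ p) 0 (identity a k h e)
    where
    identity : ∀ a k h e → a * (k * suc h) * 1 + suc h * (2 * e) + 0 ≡ e * (2 * suc h) + suc h * (k * a)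
    identity = solve-∀

-- An overfull graph has an edge, and the additive term of `Over` makes up for deleting it. For the
-- minors of the result, failing to be overfull rearranges to the cone bound with U / V = 1 + p / W.
critical⇒graph : ∀ p K → Overfull.BigCritical p (2 * suc K) (suc K) →
                 ∃₂ λ h (A : Adj h) → K ≤ h × 2 * (p * suc h) ≤ 2 * suc K * edges₂ A ×
                   (∀ {h′} (H : Adj h′) → Model H A → 2 * suc K * (edges₂ H + 2 * h′) ≤ 2 * ((p + 2 * suc K) * suc h′))
critical⇒graph p K (h , H , K<h , over , crit) = go (any? λ u → any? λ v → true? (E H u v))
  where
  W = 2 * suc K
  go : Dec (∃₂ λ u v → E H u v ≡ true) →
       ∃₂ λ h (A : Adj h) → K ≤ h × 2 * (p * suc h) ≤ W * edges₂ A ×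
         (∀ {h′} (H : Adj h′) → Model H A → W * (edges₂ H + 2 * h′) ≤ 2 * ((p + W) * suc h′))
  go (yes (u , v , e)) = h , deleteEdge u v H , ≤-trans (n≤1+n K) (<⇒≤ K<h) ,
    lower (p * suc h) W (edges₂ H) (edges₂ (deleteEdge u v H)) over (edges₂-deleteEdge-≥ u v H) ,
    λ {h′} H′ Mod → upper p W h′ (edges₂ H′) (≰⇒> (crit u v e H′ (Model⇒≼ Mod)))
    where
    lower : ∀ x W a b → 2 * (x + W) ≤ W * a → a ≤ b + 2 → 2 * x ≤ W * b
    lower x W a b h k = lin (h ⊕ W ⊙ k) 0 (identity x W a b)
      where
      identity : ∀ x W a b → 2 * x + (W * a + W * (b + 2)) + 0 ≡ W * b + (2 * (x + W) + W * a)
      identity = solve-∀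
    upper : ∀ p W h e → W * e < 2 * (p * suc h + W) → W * (e + 2 * h) ≤ 2 * ((p + W) * suc h)
    upper p W h e k = lin k 1 (identity p W h e)
      where
      identity : ∀ p W h e → W * (e + 2 * h) + 2 * (p * suc h + W) + 1 ≡ 2 * ((p + W) * suc h) + suc (W * e)
      identity = solve-∀
  go (no none) = ⊥-elim (n≮0 (≤-trans (≤-trans (s≤s z≤n) (m≤n+m (2 * W) (2 * (p * suc h))))
    (≤-trans (≤-reflexive (sym (*-distribˡ-+ 2 (p * suc h) W))) (≤-trans over (≤-reflexive (trans (cong (W *_) empty) (*-zeroʳ W)))))))
    where
    empty : edges₂ H ≡ 0
    empty = ∑∑-zero λ u v → cong 𝟙 (≢true⇒false λ e → none (u , v , e))

edgeless : ∀ k → Adj k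
edgeless k _ _ = false

edgeless-bound : ∀ k {h′} (H : Adj h′) → Model H (edgeless k) → suc k * (edges₂ H + 2 * h′) ≤ 2 * (k * suc h′)
edgeless-bound k {h′} H Mod = subst (λ e → suc k * (e + 2 * h′) ≤ 2 * (k * suc h′)) (sym empty) (arith k h′ (injective⇒≤ {f = s} s-inj))
  where
  open Model Mod
  s : Fin h′ → Fin k
  s x = proj₁ (onto x)
  s-inj : ∀ {x y} → s x ≡ s y → x ≡ y
  s-inj {x} {y} e = just-injective (trans (sym (proj₂ (onto x))) (trans (cong f e) (proj₂ (onto y))))
  empty : edges₂ H ≡ 0
  empty = ∑∑-zero λ x y → cong 𝟙 (≢true⇒false λ e → let (u , v , _ , _ , r) = edge {x} {y} e in
    case proj₂ (E-true⁻ (edgeless k) {u} {v} r) of λ { (inj₁ ()) ; (inj₂ ()) })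
  arith : ∀ k h → h ≤ k → suc k * (0 + 2 * h) ≤ 2 * (k * suc h)
  arith k h p = lin (2 ⊙ p) 0 (identity k h)
    where
    identity : ∀ k h → suc k * (0 + 2 * h) + 2 * k + 0 ≡ 2 * (k * suc h) + 2 * h
    identity = solve-∀

-- Choice of the grid and conclusion

floor : ∀ a w → ∃ λ i → a ℚ.< frac (suc i) w × (i ≡ 0 ⊎ frac i w ℚ.≤ a)
floor a w with 0ℚ ℚ.≤? a
... | no neg = 0 , ℚ.<-≤-trans (ℚ.≰⇒> neg) (frac-≤ {0} {0} {1} {w} z≤n) , inj₁ refl
... | yes nn = let (u , d , a≡) = nonNeg-frac a nn ; x = u * suc w ; i = x / suc d in
  i , subst (ℚ._< frac (suc i) w) (sym a≡) (frac-< {u} {d} {suc i} {w}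
        (≤-trans (≤-reflexive (cong suc (m≡m%n+[m/n]*n x (suc d)))) (+-monoˡ-≤ (i * suc d) (m%n<n x (suc d))))) ,
  inj₂ (subst (frac i w ℚ.≤_) (sym a≡) (frac-≤ {i} {w} {u} {d}
        (≤-trans (m≤n+m (i * suc d) (x % suc d)) (≤-reflexive (sym (m≡m%n+[m/n]*n x (suc d)))))))

open ℚ.+-*-Solver using (_:+_; _:-_; _:=_; con)

gap-identity : ∀ l a → l ℚ.+ (a ℚ.- (l ℚ.- 1ℚ)) ≡ a ℚ.+ 1ℚ
gap-identity = ℚ.+-*-Solver.solve 2 (λ l a → l :+ (a :- (l :- con 1ℚ)) := a :+ con 1ℚ) refl

diff-identity : ∀ q → (q ℚ.+ 1ℚ) ℚ.- 1ℚ ≡ q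
diff-identity = ℚ.+-*-Solver.solve 1 (λ q → (q :+ con 1ℚ) :- con 1ℚ := q) refl

cancel-identity : ∀ q → (q ℚ.- 1ℚ) ℚ.+ 1ℚ ≡ q
cancel-identity = ℚ.+-*-Solver.solve 1 (λ q → (q :- con 1ℚ) :+ con 1ℚ := q) refl

-- A mesh 1/W fine enough that 4/W is at most the gap between l - 1 and a.
mesh : ∀ {l a} → l ℚ.- 1ℚ ℚ.< a → ∃ λ K → l ℚ.+ frac 4 (K + (suc K + 0)) ℚ.≤ a ℚ.+ 1ℚ
mesh {l} {a} h =
  let g = a ℚ.- (l ℚ.- 1ℚ)
      0<g = subst (ℚ._< g) (ℚ.+-inverseʳ (l ℚ.- 1ℚ)) (ℚ.+-monoˡ-< (ℚ.- (l ℚ.- 1ℚ)) h)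
      (u , d , g≡) = nonNeg-frac g (ℚ.<⇒≤ 0<g)
      1≤u = frac-<⁻ {0} {0} {u} {d} (subst (0ℚ ℚ.<_) g≡ 0<g)
      -- Then W = 2 * suc K = 4 * suc d, so 4 / W = 1 / suc d, at most the gap u / suc d.
      K = d + (suc d + 0)
  in K , subst (l ℚ.+ frac 4 (K + (suc K + 0)) ℚ.≤_) (gap-identity l a)
       (ℚ.+-monoʳ-≤ l (subst (frac 4 (K + (suc K + 0)) ℚ.≤_) (sym g≡) (frac-≤ {4} {K + (suc K + 0)} {u} {d} (arith d u 1≤u))))
  where
  arith : ∀ d u → 1 ≤ u * 1 → 4 * suc d ≤ u * (2 * (2 * suc d))
  arith d u h = lin ((4 * suc d) ⊙ h) 0 (identity d u)
    where
    identity : ∀ d u → 4 * suc d + 4 * suc d * (u * 1) + 0 ≡ u * (2 * (2 * suc d)) + 4 * suc d * 1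
    identity = solve-∀

-- Of the four grid steps, one is the rounding of a, one separates p / W from the known bound (p +
-- 1) / W, and two account for the cone vertex: h / (h + 1) ≥ 1 - 2 / W for h ≥ K.
below-grid : ∀ {l a} w i t → l ℚ.+ frac 4 w ℚ.≤ a ℚ.+ 1ℚ → a ℚ.< frac (suc i) w → suc i + suc w ≤ t + 4 → l ℚ.< frac t w
below-grid {l} {a} w i t h a< le = ℚ.≰⇒> λ t≤l → ℚ.<-irrefl refl (ℚ.<-≤-trans
  (ℚ.≤-<-trans h (subst (a ℚ.+ 1ℚ ℚ.<_) (trans (cong (frac (suc i) w ℚ.+_) (sym (frac-1 w))) (frac-+ (suc i) (suc w) w)) (ℚ.+-monoˡ-< 1ℚ a<)))
  (ℚ.≤-trans (frac-≤ {suc i + suc w} {w} {t + 4} {w} (*-monoˡ-≤ (suc w) le))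
    (subst (ℚ._≤ l ℚ.+ frac 4 w) (frac-+ t 4 w) (ℚ.+-monoˡ-≤ (frac 4 w) t≤l))))

Conclusion : Family → ℚ → ℚ → Set₁
Conclusion F l r = Σ Family λ G → MinorClosed G × DensGt G l × DensLt G r ×
    ((∃ λ q → DensLt G q × DensGt F (q - 1ℚ)) ⊎
    (∃ λ q → DensGt G q × DensLt F (q - 1ℚ)))

-- A rational strictly between U / (v + 1) and s + 1 separates the new density from 1 plus that of
-- F. The upper end r needs no estimate of its own, as s is at most the density of F.
conclude : ∀ {F l r U v x s} → DensLt F (r - 1ℚ) → DensGe F s → frac U v ℚ.< s ℚ.+ 1ℚ →
           DensGe (Certified U (suc v)) x → l ℚ.< x → Conclusion F l r
conclude {F} {l} {r} {U} {v} {x} {s} (b , b< , le) ge u< geG l<x =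
  Certified U (suc v) , certified-closed U (suc v) , (x , l<x , geG) , (frac U v , u<r , leG) ,
  inj₁ (q , (frac U v , u<q , leG) , (s , subst (q - 1ℚ ℚ.<_) (diff-identity s) (ℚ.+-monoˡ-< (ℚ.- 1ℚ) q<) , ge))
  where
  leG = certified-densLe U v
  mid = ℚ.<-dense u<
  q = proj₁ mid
  u<q = proj₁ (proj₂ mid)
  q< = proj₂ (proj₂ mid)
  u<r : frac U v ℚ.< r
  u<r = ℚ.<-trans u< (subst (s ℚ.+ 1ℚ ℚ.<_) (cancel-identity r) (ℚ.+-monoˡ-< 1ℚ (ℚ.≤-<-trans (densGe≤densLe ge le) b<)))

module _ (F : Family) (closed : MinorClosed F) {b} (le : DensLe F b) {l r a} (ge : DensGe F a) (lt : DensLt F (r - 1ℚ))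
         (K : ℕ) (fine : l ℚ.+ frac 4 (K + (suc K + 0)) ℚ.≤ a ℚ.+ 1ℚ) where

  private
    w W : ℕ
    -- The predecessor of `2 * suc K`, so that W computes to the value used by `climb` at `suc K`.
    w = K + (suc K + 0)
    W = suc w

  below-cone : ∀ p {h} (A : Adj h) → (p + 2 * K) * (2 * suc h) ≤ (edges₂ A + 2 * h) * W → frac (p + 2 * K) w ℚ.≤ cone-density A
  below-cone p {h} A h≤ = frac-≤ {p + 2 * K} {w} {edges₂ A + 2 * h} {h + (suc h + 0)} h≤
  byFloor : (∃ λ i → a ℚ.< frac (suc i) w × (i ≡ 0 ⊎ frac i w ℚ.≤ a)) → Conclusion F l r
  -- Here a < 1 / W, and 0 serves as the lower bound s. Disjoint stars with W edges have density W /
  -- (W + 1), just below 1.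
  byFloor (zero , a< , _) = conclude {x = cone-density (edgeless W)} {s = 0ℚ} lt densGe-0
      (subst (frac W W ℚ.<_) (sym (ℚ.+-identityˡ 1ℚ)) (frac-< {W} {W} {1} {0} (≤-reflexive (cong suc (trans (*-identityʳ W) (sym (+-identityʳ W)))))))
      (certified-densGe {W} {suc W} (edgeless W) (edgeless-bound W))
      (ℚ.<-≤-trans (below-grid w 0 (0 + 2 * K) fine a< (≤-trans (n≤1+n _) (≤-reflexive (grid K)))) (below-cone 0 (edgeless W) (≤-trans (small K) (*-monoˡ-≤ W (m≤n+m (2 * W) (edges₂ (edgeless W)))))))
    where
    grid : ∀ K → suc (1 + suc (K + (suc K + 0))) ≡ 0 + 2 * K + 4
    grid = solve-∀
    small : ∀ K → (0 + 2 * K) * (2 * suc (2 * suc K)) ≤ 2 * (2 * suc K) * (2 * suc K)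
    small K = lin {0} {0} z≤n (4 * K + 8) (identity K)
      where
      identity : ∀ K → (0 + 2 * K) * (2 * suc (2 * suc K)) + 0 + (4 * K + 8) ≡ 2 * (2 * suc K) * (2 * suc K) + 0
      identity = solve-∀
  byFloor (suc p₀ , a< , inj₂ p₀≤a) =
    let (B , sparse) = densLe⇒sparse le
        (p , p₀≤p , dense , critical) = climb F closed {B} (λ {n} → sparse {n}) (suc K) (s≤s z≤n) (suc (B * W)) p₀ (m≤m+n (suc (B * W)) (suc p₀)) (densGe⇒denseAt (suc p₀) w ge p₀≤a)
        (h , A , K≤h , low , bnd) = critical⇒graph p K critical
    in conclude {x = cone-density A} {s = frac (suc p) w} lt (denseAt⇒densGe (suc p) w dense)
         (subst (frac (p + W) w ℚ.<_) (trans (sym (frac-+ (suc p) W w)) (cong (frac (suc p) w ℚ.+_) (frac-1 w)))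
           (frac-< {p + W} {w} {suc p + W} {w} (*-monoˡ-< (suc w) (n<1+n (p + W)))))
         (certified-densGe {p + W} {W} A bnd)
         (ℚ.<-≤-trans (below-grid w (suc p₀) (p + 2 * K) fine a< (≤-trans (s≤s (s≤s (+-monoˡ-≤ W p₀≤p))) (≤-reflexive (grid p K))))
           (below-cone p A (arith p K h (edges₂ A) low K≤h)))
    where
    grid : ∀ p K → suc (suc (p + suc (K + (suc K + 0)))) ≡ p + 2 * K + 4
    grid = solve-∀
    arith : ∀ p K h e → 2 * (p * suc h) ≤ 2 * suc K * e → K ≤ h → (p + 2 * K) * (2 * suc h) ≤ (e + 2 * h) * (2 * suc K)
    arith p K h e h₁ h₂ = lin (h₁ ⊕ 4 ⊙ h₂) 0 (identity p K h e)
      where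
      identity : ∀ p K h e → (p + 2 * K) * (2 * suc h) + (2 * suc K * e + 4 * h) + 0 ≡ (e + 2 * h) * (2 * suc K) + (2 * (p * suc h) + 4 * K)
      identity = solve-∀

theorem3 : (F : Family) → MinorClosed F → FiniteDens F →
    (l r : ℚ) → DensGt F (l - 1ℚ) → DensLt F (r - 1ℚ) →
    Σ Family λ G → MinorClosed G × DensGt G l × DensLt G r ×
    ((∃ λ q → DensLt G q × DensGt F (q - 1ℚ)) ⊎
    (∃ λ q → DensGt G q × DensLt F (q - 1ℚ)))
theorem3 F closed (b , le) l r (a , l<a , ge) lt =
  let (K , fine) = mesh {l} {a} l<a in byFloor F closed le ge lt K fine (floor a (K + (suc K + 0)))
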